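{- Let $s,t\ge1$ be coprime integers, and let $k=\frac12(s+1)(t-1)\in\mathbb{Z}$. Consider the affine change of variables $$z_{t,j}=\frac1t\bigl(a_{t,sj+k}-[a_{t,s(j+1)+k}-s]\bigr),\qquad j\in\mathbb{Z}/t\mathbb{Z},$$ from the hyperplane $\{(a_{t,i})_{i\in\mathbb{Z}/t\mathbb{Z}}:\sum_i a_{t,i}=\binom t2\}$ to the hyperplane $\{(z_{t,j})_{j\in\mathbb{Z}/t\mathbb{Z}}:\sum_j z_{t,j}=s\}$ of $\mathbb{R}^t$. It is an invertible affine map, carrying the simplex defined by $a_{t,i}\ge a_{t,i+s}-s$ (all $i$) onto the simplex defined by $z_{t,j}\ge0$ (all $j$), with inverse given by $$a_{t,k+\ell s}-\frac{t-1}{2}=\sum_{j=0}^{t-1}\Bigl(\frac{t-1}{2}-j\Bigr)z_{t,j+\ell},\qquad \ell\in\mathbb{Z}/t\mathbb{Z}.$$ (1) The set $\mathcal{C}_s\cap\mathcal{C}_t$ of simultaneous $s$- and $t$-cores is parameterized, via $\lambda\mapsto(a_{t,i}(\lambda))_{i\in\mathbb{Z}/t\mathbb{Z}}$, by the set $A_t(s)$ of all integer points $(a_{t,i})_{i\in\mathbb{Z}/t\mathbb{Z}}$ with $a_{t,i}\ge a_{t,i+s}-s$ and $a_{t,i}\equiv i\pmod t$ for all $i$, and $\sum_{i}a_{t,i}=\binom t2$; and the change of variables $z_{t,j}=\frac1t\bigl(a_{t,sj+k}-[a_{t,s(j+1)+k}-s]\bigr)$ ($j\in\mathbb{Z}/t\mathbb{Z}$)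 restricts to a bijection from $A_t(s)$ onto the set $\mathrm{TD}_t(s)$ of all points $(z_{t,i})_{i\in\mathbb{Z}/t\mathbb{Z}}$ with $z_{t,i}\in\mathbb{Z}$ and $z_{t,i}\ge0$ for all $i$, $\sum_i z_{t,i}=s$, and $\sum_{i\in\mathbb{Z}/t\mathbb{Z}} i\,z_{t,i}\equiv0\pmod t$. (2) The larger set $\mathcal{C}_t$ of all $t$-cores is parameterized, via $\lambda\mapsto(a_{t,i}(\lambda))_{i\in\mathbb{Z}/t\mathbb{Z}}$, by the set of all integer points $(a_{t,i})_{i\in\mathbb{Z}/t\mathbb{Z}}$ with $\sum_i a_{t,i}=\binom t2$ and $a_{t,i}\equiv i\pmod t$ for all $i$; and the same change of variables $z_{t,j}=\frac1t\bigl(a_{t,sj+k}-[a_{t,s(j+1)+k}-s]\bigr)$ ($j\in\mathbb{Z}/t\mathbb{Z}$) restricts to a bijection from this set onto the set of all points $(z_{t,i})_{i\in\mathbb{Z}/t\mathbb{Z}}$ with $z_{t,i}\in\mathbb{Z}$ for all $i$, $\sum_i z_{t,i}=s$, and $\sum_{i\in\mathbb{Z}/t\mathbb{Z}} i\,z_{t,i}\equiv0\pmod t$.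
   Context: A partition is an infinite weakly decreasing sequence $\lambda=(\lambda_1,\lambda_2,\ldots)$ of nonnegative integers with finite sum. Its Young diagram is $[\lambda]=\{(r,c)\in\mathbb{Z}_{>0}^2 : c\le\lambda_r\}$, its conjugate $\overline{\lambda}$ is given by $\overline{\lambda}_r=\#\{c\in\mathbb{Z}_{>0}: r\le\lambda_c\}$, and the hook length at $(r,c)\in[\lambda]$ is $1+(\lambda_r-r)+(\overline{\lambda}_c-c)$. A partition is a $t$-core if it has no hook of length $t$; $\mathcal{C}_t$ is the set of $t$-cores. The beta-set of $\lambda$ is $B^\lambda=\{\lambda_i-i: i\ge1\}\subset\mathbb{Z}$; $\lambda$ is a $t$-core iff $B^\lambda-t\subseteq B^\lambda$. For a $t$-core $\lambda$ and $i\in\mathbb{Z}$ (only $i$ mod $t$ matters) put $a_{t,i}(\lambda)=t+\max[B^\lambda\cap(i+t\mathbb{Z})]$. All indices of $a_{t,\cdot}$ and $z_{t,\cdot}$ are taken modulo $t$. "Parameterized" means that the indicated map is a bijection. -}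

module Defs where

open import Algebra.Bundles using (RawMonoid)
import Algebra.Definitions.RawMonoid as RawMonoidDefs
open import Data.Fin.Base using (Fin; toℕ; fromℕ<)
open import Data.Integer.Base as ℤ using (ℤ; +_; 0ℤ; 1ℤ)
open import Data.Integer.DivMod using (n%ℕd<d; a≡a%ℕn+[a/ℕn]*n)
open import Data.Integer.Divisibility.Signed using (_∣_; divides; _∣?_)
import Data.Integer.Properties as ℤₚ
import Data.Integer.Solver as ℤSolver
open import Data.List.Base using (length; filter; upTo)
open import Data.Nat.Base as ℕ using (ℕ; zero; suc; NonZero; s≤s)
open import Data.Nat.Combinatorics using (_C_)
import Data.Nat.Properties as ℕₚ
open import Data.Product.Base using (Σ-syntax; ∃; ∃-syntax; _×_; _,_; proj₁; proj₂; map)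
open import Data.Rational.Base as ℚ using (ℚ; 0ℚ; 1ℚ; ½)
import Data.Rational.Properties as ℚₚ
import Data.Rational.Solver as ℚSolver
open import Data.Vec.Functional using (Vector)
open import Function.Base using (_on_)
open import Function.Structures using (IsBijection)
open import Level using (0ℓ)
open import Relation.Binary.Core using (Rel)
open import Relation.Binary.PropositionalEquality
  using (_≡_; refl; sym; trans; cong; cong₂; subst)
open import Relation.Nullary using (¬_; yes; no)
open import Relation.Unary using (Pred; _∩_; Decidable)

------------------------------------------------------------------------
-- Real numbers: Cauchy sequences of rationals, up to ≈ℝ

IsCauchy : (ℕ → ℚ) → Set
IsCauchy x = ∀ ε → 0ℚ ℚ.< ε →
  ∃[ N ] ∀ m n → N ℕ.≤ m → N ℕ.≤ n → ℚ.∣ x m ℚ.- x n ∣ ℚ.≤ ε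

record ℝ : Set where
  constructor mkℝ
  field
    seq    : ℕ → ℚ
    cauchy : IsCauchy seq
open ℝ public

infix 4 _≈ℝ_ _≤ℝ_

_≈ℝ_ : Rel ℝ 0ℓ
x ≈ℝ y = ∀ ε → 0ℚ ℚ.< ε → ∃[ N ] ∀ n → N ℕ.≤ n → ℚ.∣ seq x n ℚ.- seq y n ∣ ℚ.≤ ε

_≤ℝ_ : Rel ℝ 0ℓ
x ≤ℝ y = ∀ ε → 0ℚ ℚ.< ε → ∃[ N ] ∀ n → N ℕ.≤ n → seq x n ℚ.≤ seq y n ℚ.+ ε

private
  0<½* : ∀ {ε} → 0ℚ ℚ.< ε → 0ℚ ℚ.< ½ ℚ.* ε
  0<½* {ε} 0<ε = ℚₚ.positive⁻¹ _ {{ℚₚ.pos*pos⇒pos ½ ε {{ℚ.positive 0<ε}}}}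

  ½+½ : ∀ ε → ½ ℚ.* ε ℚ.+ ½ ℚ.* ε ≡ ε
  ½+½ ε = trans (sym (ℚₚ.*-distribʳ-+ ε ½ ½)) (ℚₚ.*-identityˡ ε)

  +-cauchy : ∀ {x y} → IsCauchy x → IsCauchy y → IsCauchy (λ n → x n ℚ.+ y n)
  +-cauchy {x} {y} cx cy ε 0<ε
    with cx (½ ℚ.* ε) (0<½* 0<ε) | cy (½ ℚ.* ε) (0<½* 0<ε)
  ... | M , hx | N , hy = M ℕ.⊔ N , λ m n m≥ n≥ → begin
      ℚ.∣ (x m ℚ.+ y m) ℚ.- (x n ℚ.+ y n) ∣
        ≡⟨ cong ℚ.∣_∣ (solve 4 (λ a b c d → (a :+ b) :- (c :+ d) := (a :- c) :+ (b :- d))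
             refl (x m) (y m) (x n) (y n)) ⟩
      ℚ.∣ (x m ℚ.- x n) ℚ.+ (y m ℚ.- y n) ∣
        ≤⟨ ℚₚ.∣p+q∣≤∣p∣+∣q∣ (x m ℚ.- x n) (y m ℚ.- y n) ⟩
      ℚ.∣ x m ℚ.- x n ∣ ℚ.+ ℚ.∣ y m ℚ.- y n ∣
        ≤⟨ ℚₚ.+-mono-≤
             (hx m n (ℕₚ.m⊔n≤o⇒m≤o M N m≥) (ℕₚ.m⊔n≤o⇒m≤o M N n≥))
             (hy m n (ℕₚ.m⊔n≤o⇒n≤o M N m≥) (ℕₚ.m⊔n≤o⇒n≤o M N n≥)) ⟩
      ½ ℚ.* ε ℚ.+ ½ ℚ.* ε
        ≡⟨ ½+½ ε ⟩
      ε ∎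
    where
    open ℚSolver.+-*-Solver
    open ℚₚ.≤-Reasoning

  neg-cauchy : ∀ {x} → IsCauchy x → IsCauchy (λ n → ℚ.- x n)
  neg-cauchy {x} cx ε 0<ε with cx ε 0<ε
  ... | N , hx = N , λ m n m≥ n≥ → subst (ℚ._≤ ε)
    (trans (sym (ℚₚ.∣-p∣≡∣p∣ (x m ℚ.- x n)))
      (cong ℚ.∣_∣ (solve 2 (λ a b → :- (a :- b) := (:- a) :- (:- b)) refl (x m) (x n))))
    (hx m n m≥ n≥)
    where open ℚSolver.+-*-Solver

  eventually-bounded : ∀ {x} → IsCauchy x →
    ∃[ K ] ℚ.Positive K × ∃[ N ] ∀ n → N ℕ.≤ n → ℚ.∣ x n ∣ ℚ.≤ K
  eventually-bounded {x} cx with cx 1ℚ (ℚₚ.positive⁻¹ 1ℚ)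
  ... | N , hx = 1ℚ ℚ.+ ℚ.∣ x N ∣ , pos , N , λ n n≥ → begin
      ℚ.∣ x n ∣
        ≡⟨ cong ℚ.∣_∣ (solve 2 (λ a b → a := (a :- b) :+ b) refl (x n) (x N)) ⟩
      ℚ.∣ (x n ℚ.- x N) ℚ.+ x N ∣
        ≤⟨ ℚₚ.∣p+q∣≤∣p∣+∣q∣ (x n ℚ.- x N) (x N) ⟩
      ℚ.∣ x n ℚ.- x N ∣ ℚ.+ ℚ.∣ x N ∣
        ≤⟨ ℚₚ.+-monoˡ-≤ ℚ.∣ x N ∣ (hx n N n≥ ℕₚ.≤-refl) ⟩
      1ℚ ℚ.+ ℚ.∣ x N ∣ ∎
    where
    open ℚSolver.+-*-Solver
    open ℚₚ.≤-Reasoning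
    pos : ℚ.Positive (1ℚ ℚ.+ ℚ.∣ x N ∣)
    pos = subst ℚ.Positive (ℚₚ.+-comm ℚ.∣ x N ∣ 1ℚ)
      (ℚₚ.nonNeg+pos⇒pos ℚ.∣ x N ∣ {{ℚₚ.∣-∣-nonNeg (x N)}} 1ℚ)

  quotient : ∀ K → ℚ.Positive K → ∀ δ → 0ℚ ℚ.< δ →
    ∃[ η ] 0ℚ ℚ.< η × K ℚ.* η ≡ δ
  quotient K K>0 δ 0<δ = ℚ.1/ K ℚ.* δ
    , ℚₚ.positive⁻¹ _ {{ℚₚ.pos*pos⇒pos (ℚ.1/ K) {{ℚₚ.1/pos⇒pos K}} δ {{ℚ.positive 0<δ}}}}
    , trans (sym (ℚₚ.*-assoc K (ℚ.1/ K) δ))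
        (trans (cong (ℚ._* δ) (ℚₚ.*-inverseʳ K)) (ℚₚ.*-identityˡ δ))
    where
    instance
      K⁺ = K>0
      K≠0 = ℚₚ.pos⇒nonZero K

  ∣*∣-bound : ∀ {p q K η} → ℚ.Positive K → ℚ.∣ p ∣ ℚ.≤ K → ℚ.∣ q ∣ ℚ.≤ η →
    ℚ.∣ p ℚ.* q ∣ ℚ.≤ K ℚ.* η
  ∣*∣-bound {p} {q} {K} {η} K>0 p≤K q≤η = begin
      ℚ.∣ p ℚ.* q ∣          ≡⟨ ℚₚ.∣p*q∣≡∣p∣*∣q∣ p q ⟩
      ℚ.∣ p ∣ ℚ.* ℚ.∣ q ∣    ≤⟨ ℚₚ.*-monoʳ-≤-nonNeg ℚ.∣ q ∣ {{ℚₚ.∣-∣-nonNeg q}} p≤K ⟩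
      K ℚ.* ℚ.∣ q ∣          ≤⟨ ℚₚ.*-monoˡ-≤-nonNeg K {{ℚₚ.pos⇒nonNeg K {{K>0}}}} q≤η ⟩
      K ℚ.* η ∎
    where open ℚₚ.≤-Reasoning

  *-difference : ∀ a b c d → a ℚ.* b ℚ.- c ℚ.* d ≡ a ℚ.* (b ℚ.- d) ℚ.+ d ℚ.* (a ℚ.- c)
  *-difference = solve 4 (λ a b c d → a :* b :- c :* d := a :* (b :- d) :+ d :* (a :- c)) refl
    where open ℚSolver.+-*-Solver

  *-difference-bound : ∀ {K L η θ} ε a b c d → ℚ.Positive K → ℚ.Positive L →
    K ℚ.* η ≡ ½ ℚ.* ε → L ℚ.* θ ≡ ½ ℚ.* ε →
    ℚ.∣ a ∣ ℚ.≤ K → ℚ.∣ d ∣ ℚ.≤ L → ℚ.∣ b ℚ.- d ∣ ℚ.≤ η → ℚ.∣ a ℚ.- c ∣ ℚ.≤ θ →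
    ℚ.∣ a ℚ.* b ℚ.- c ℚ.* d ∣ ℚ.≤ ε
  *-difference-bound {K} {L} {η} {θ} ε a b c d K>0 L>0 Kη Lθ a≤K d≤L b-d≤η a-c≤θ = begin
      ℚ.∣ a ℚ.* b ℚ.- c ℚ.* d ∣
        ≡⟨ cong ℚ.∣_∣ (*-difference a b c d) ⟩
      ℚ.∣ a ℚ.* (b ℚ.- d) ℚ.+ d ℚ.* (a ℚ.- c) ∣
        ≤⟨ ℚₚ.∣p+q∣≤∣p∣+∣q∣ (a ℚ.* (b ℚ.- d)) (d ℚ.* (a ℚ.- c)) ⟩
      ℚ.∣ a ℚ.* (b ℚ.- d) ∣ ℚ.+ ℚ.∣ d ℚ.* (a ℚ.- c) ∣
        ≤⟨ ℚₚ.+-mono-≤ (∣*∣-bound {a} {b ℚ.- d} K>0 a≤K b-d≤η)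
                       (∣*∣-bound {d} {a ℚ.- c} L>0 d≤L a-c≤θ) ⟩
      K ℚ.* η ℚ.+ L ℚ.* θ
        ≡⟨ cong₂ ℚ._+_ Kη Lθ ⟩
      ½ ℚ.* ε ℚ.+ ½ ℚ.* ε
        ≡⟨ ½+½ ε ⟩
      ε ∎
    where open ℚₚ.≤-Reasoning

  *-cauchy : ∀ {x y} → IsCauchy x → IsCauchy y → IsCauchy (λ n → x n ℚ.* y n)
  *-cauchy {x} {y} cx cy ε 0<ε =
    let K , K>0 , A , bx = eventually-bounded cx
        L , L>0 , B , by = eventually-bounded cy
        η , 0<η , Kη = quotient K K>0 (½ ℚ.* ε) (0<½* 0<ε)
        θ , 0<θ , Lθ = quotient L L>0 (½ ℚ.* ε) (0<½* 0<ε)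
        M , hy = cy η 0<η
        N , hx = cx θ 0<θ
    in (A ℕ.⊔ B) ℕ.⊔ (M ℕ.⊔ N) , λ m n m≥ n≥ →
      let m≥AB = ℕₚ.m⊔n≤o⇒m≤o (A ℕ.⊔ B) (M ℕ.⊔ N) m≥
          n≥AB = ℕₚ.m⊔n≤o⇒m≤o (A ℕ.⊔ B) (M ℕ.⊔ N) n≥
          m≥MN = ℕₚ.m⊔n≤o⇒n≤o (A ℕ.⊔ B) (M ℕ.⊔ N) m≥
          n≥MN = ℕₚ.m⊔n≤o⇒n≤o (A ℕ.⊔ B) (M ℕ.⊔ N) n≥
      in *-difference-bound ε (x m) (y m) (x n) (y n) K>0 L>0 Kη Lθ
        (bx m (ℕₚ.m⊔n≤o⇒m≤o A B m≥AB))
        (by n (ℕₚ.m⊔n≤o⇒n≤o A B n≥AB))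
        (hy m n (ℕₚ.m⊔n≤o⇒m≤o M N m≥MN) (ℕₚ.m⊔n≤o⇒m≤o M N n≥MN))
        (hx m n (ℕₚ.m⊔n≤o⇒n≤o M N m≥MN) (ℕₚ.m⊔n≤o⇒n≤o M N n≥MN))

fromℚ : ℚ → ℝ
fromℚ q = mkℝ (λ _ → q) λ ε 0<ε → 0 , λ _ _ _ _ →
  subst (ℚ._≤ ε) (sym (cong ℚ.∣_∣ (ℚₚ.+-inverseʳ q))) (ℚₚ.<⇒≤ 0<ε)

fromℤ : ℤ → ℝ
fromℤ n = fromℚ (n ℚ./ 1)

infixl 6 _+ℝ_ _-ℝ_
infixl 7 _*ℝ_
infix  8 -ℝ_

_+ℝ_ : ℝ → ℝ → ℝ
x +ℝ y = mkℝ (λ n → seq x n ℚ.+ seq y n) (+-cauchy {seq x} {seq y} (cauchy x) (cauchy y))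

-ℝ_ : ℝ → ℝ
-ℝ x = mkℝ (λ n → ℚ.- seq x n) (neg-cauchy {seq x} (cauchy x))

_-ℝ_ : ℝ → ℝ → ℝ
x -ℝ y = x +ℝ (-ℝ y)

_*ℝ_ : ℝ → ℝ → ℝ
x *ℝ y = mkℝ (λ n → seq x n ℚ.* seq y n) (*-cauchy {seq x} {seq y} (cauchy x) (cauchy y))

+ℝ-rawMonoid : RawMonoid 0ℓ 0ℓ
+ℝ-rawMonoid = record { _≈_ = _≈ℝ_ ; _∙_ = _+ℝ_ ; ε = fromℤ 0ℤ }

open RawMonoidDefs +ℝ-rawMonoid public using () renaming (sum to sumℝ)
open RawMonoidDefs ℤ.+-0-rawMonoid public using () renaming (sum to sumℤ)
open RawMonoidDefs ℕ.+-0-rawMonoid public using () renaming (sum to sumℕ)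

------------------------------------------------------------------------
-- Congruences, and families indexed by ℤ/tℤ

infix 4 _≡_[mod_]

_≡_[mod_] : ℤ → ℤ → ℕ → Set
a ≡ b [mod t ] = + t ∣ a ℤ.- b

-- Families (xᵢ), i ∈ ℤ/tℤ, are stored on the residues 0, …, t − 1;
-- x ⟦ i ⟧ is the entry at the class of an arbitrary integer i.
infix 9 _⟦_⟧

_⟦_⟧ : ∀ {A : Set} {t} .{{_ : NonZero t}} → Vector A t → ℤ → A
_⟦_⟧ {t = t} x i = x (fromℕ< (n%ℕd<d i t))

idx : ∀ {t} → Fin t → ℤ
idx i = + toℕ i

infix 4 _≋_

_≋_ : ∀ {t} → Rel (Vector ℝ t) 0ℓ
x ≋ y = ∀ i → x i ≈ℝ y i

------------------------------------------------------------------------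
-- Maps between subsets

-- f maps P into Q, and the restriction f : P → Q is a bijection
-- with respect to the given equalities.
BijectionOn : {A B : Set} → Rel A 0ℓ → Rel B 0ℓ → (A → B) → Pred A 0ℓ → Pred B 0ℓ → Set
BijectionOn _≈₁_ _≈₂_ f P Q =
  Σ[ f-maps ∈ (∀ {x} → P x → Q (f x)) ]
    IsBijection {A = ∃ P} (_≈₁_ on proj₁) {B = ∃ Q} (_≈₂_ on proj₁) (map f f-maps)

AffineOn : ∀ {t u} → Pred (Vector ℝ t) 0ℓ → (Vector ℝ t → Vector ℝ u) → Set
AffineOn P f = ∀ r x y → P x → P y →
  f (λ i → (fromℤ 1ℤ -ℝ r) *ℝ x i +ℝ r *ℝ y i)
    ≋ (λ i → (fromℤ 1ℤ -ℝ r) *ℝ f x i +ℝ r *ℝ f y i)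

------------------------------------------------------------------------
-- Partitions

-- Rows, columns and parts are indexed from 0: part r is λ_{r+1}.
record Partition : Set where
  field
    part       : ℕ → ℕ
    decreasing : ∀ r → part (suc r) ℕ.≤ part r
    finite-sum : ∃[ S ] ∃[ N ] ∀ n → N ℕ.≤ n → sumℕ {n} (λ i → part (toℕ i)) ≡ S
open Partition public

infix 4 _≈ₚ_

_≈ₚ_ : Rel Partition 0ℓ
p ≈ₚ q = ∀ r → part p r ≡ part q r

support : Partition → ℕ
support p = proj₁ (proj₂ (finite-sum p))

private
  sumℕ-last : ∀ (f : ℕ → ℕ) n →
    sumℕ {suc n} (λ i → f (toℕ i)) ≡ sumℕ {n} (λ i → f (toℕ i)) ℕ.+ f n
  sumℕ-last f zero    = ℕₚ.+-comm (f 0) 0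
  sumℕ-last f (suc n) = trans (cong (f 0 ℕ.+_) (sumℕ-last (λ i → f (suc i)) n))
    (sym (ℕₚ.+-assoc (f 0) _ (f (suc n))))

part≡0 : ∀ p r → support p ℕ.≤ r → part p r ≡ 0
part≡0 p r N≤r = let S , N , total = finite-sum p in
  ℕₚ.+-cancelˡ-≡ S (part p r) 0 (trans
    (cong (ℕ._+ part p r) (sym (total r N≤r)))
    (trans (sym (sumℕ-last (part p) r))
      (trans (total (suc r) (ℕₚ.m≤n⇒m≤1+n N≤r)) (sym (ℕₚ.+-identityʳ S)))))

-- The number of r with c < part r; by part≡0 every such r is below
-- support p, so counting there counts them all.
conjugate : Partition → ℕ → ℕ
conjugate p c = length (filter (λ r → c ℕₚ.<? part p r) (upTo (support p)))

-- 1 + (λᵣ − r) + (λ̄_c − c), for the box in row suc r and column suc c.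
hook : Partition → ℕ → ℕ → ℤ
hook p r c = 1ℤ ℤ.+ (+ part p r ℤ.- + suc r) ℤ.+ (+ conjugate p c ℤ.- + suc c)

Core : ℕ → Pred Partition 0ℓ
Core t p = ∀ r c → c ℕ.< part p r → ¬ (hook p r c ≡ + t)

betaNumber : Partition → ℕ → ℤ
betaNumber p r = + part p r ℤ.- + suc r

BetaSet : Partition → Pred ℤ 0ℓ
BetaSet p b = ∃[ r ] b ≡ betaNumber p r

IsMaximum : Pred ℤ 0ℓ → ℤ → Set
IsMaximum P m = P m × (∀ b → P b → b ℤ.≤ m)

private
  least : ∀ {P : Pred ℕ 0ℓ} → Decidable P → ∀ n → P n →
    ∃[ m ] P m × (∀ j → j ℕ.< m → ¬ P j)
  least P? zero Pn = 0 , Pn , λ _ ()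
  least P? (suc n) Pn with P? 0
  ... | yes P0 = 0 , P0 , λ _ ()
  ... | no ¬P0 with least (λ j → P? (suc j)) n Pn
  ... | m , Pm , min = suc m , Pm , λ where
    zero    _         → ¬P0
    (suc j) (s≤s j<m) → min j j<m

  part-antitone : ∀ p {q r} → q ℕ.≤ r → part p r ℕ.≤ part p q
  part-antitone p q≤r = go (ℕₚ.≤⇒≤′ q≤r)
    where
    go : ∀ {q r} → q ℕ.≤′ r → part p r ℕ.≤ part p q
    go ℕ.≤′-refl       = ℕₚ.≤-refl
    go (ℕ.≤′-step q≤r) = ℕₚ.≤-trans (decreasing p _) (go q≤r)

  beta-antitone : ∀ p {q r} → q ℕ.≤ r → betaNumber p r ℤ.≤ betaNumber p q
  beta-antitone p q≤r = ℤₚ.+-mono-≤ (ℤ.+≤+ (part-antitone p q≤r))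
    (ℤₚ.neg-mono-≤ (ℤ.+≤+ (s≤s q≤r)))

  beta-hits-class : ∀ t .{{_ : NonZero t}} p i → ∃[ r ] betaNumber p r ≡ i [mod t ]
  beta-hits-class t p i = r , divides q eq
    where
    open ℤSolver.+-*-Solver
    N = support p
    a = ℤ.- (+ suc N) ℤ.- i
    q = a ℤ./ℕ t
    r = N ℕ.+ a ℤ.%ℕ t
    eq : betaNumber p r ℤ.- i ≡ q ℤ.* + t
    eq = trans
      (cong (λ v → + v ℤ.- + suc r ℤ.- i) (part≡0 p r (ℕₚ.m≤m+n N _)))
      (trans
        (solve 3 (λ n w j → con 0ℤ :- (con 1ℤ :+ (n :+ w)) :- j := (:- (con 1ℤ :+ n) :- j) :- w)
          refl (+ N) (+ (a ℤ.%ℕ t)) i)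
        (trans (cong (ℤ._- + (a ℤ.%ℕ t)) (a≡a%ℕn+[a/ℕn]*n a t))
          (solve 2 (λ w v → (w :+ v) :- w := v) refl (+ (a ℤ.%ℕ t)) (q ℤ.* + t))))

maxBeta : ∀ t .{{_ : NonZero t}} p i →
  ∃[ m ] IsMaximum (BetaSet p ∩ (_≡ i [mod t ])) m
maxBeta t p i
  with least (λ r → + t ∣? betaNumber p r ℤ.- i) _ (proj₂ (beta-hits-class t p i))
... | r , r-hits , r-least = betaNumber p r , ((r , refl) , r-hits) , λ where
  _ ((q , refl) , q-hits) → beta-antitone p
    (ℕₚ.≮⇒≥ (λ q<r → r-least q q<r q-hits))

aCoord : ∀ t .{{_ : NonZero t}} → Partition → ℤ → ℤ
aCoord t p i = + t ℤ.+ proj₁ (maxBeta t p i)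

aPoint : ∀ t .{{_ : NonZero t}} → Partition → Vector ℝ t
aPoint t p i = fromℤ (aCoord t p (idx i))

------------------------------------------------------------------------
-- The two coordinate systems

-- (s + 1)(t − 1)/2; the division is exact when s and t are coprime.
shift : ℕ → ℕ → ℕ
shift s t = (suc s ℕ.* (t ℕ.∸ 1)) ℕ./ 2

module _ (s t : ℕ) .{{_ : NonZero t}} where

  private
    k : ℤ
    k = + shift s t

  toZ : Vector ℝ t → Vector ℝ t
  toZ a j = fromℚ (1ℤ ℚ./ t) *ℝ
    (a ⟦ + s ℤ.* idx j ℤ.+ k ⟧ -ℝ (a ⟦ + s ℤ.* (idx j ℤ.+ 1ℤ) ℤ.+ k ⟧ -ℝ fromℤ (+ s)))

  InverseFormula : Vector ℝ t → Vector ℝ t → Set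
  InverseFormula a z = ∀ (ℓ : Fin t) →
    a ⟦ k ℤ.+ idx ℓ ℤ.* + s ⟧ -ℝ fromℚ half
      ≈ℝ sumℝ (λ (j : Fin t) → fromℚ (half ℚ.- idx j ℚ./ 1) *ℝ z ⟦ idx j ℤ.+ idx ℓ ⟧)
    where
    half : ℚ
    half = (+ t ℤ.- 1ℤ) ℚ./ 2

  HyperplaneA : Pred (Vector ℝ t) 0ℓ
  HyperplaneA a = sumℝ a ≈ℝ fromℤ (+ (t C 2))

  HyperplaneZ : Pred (Vector ℝ t) 0ℓ
  HyperplaneZ z = sumℝ z ≈ℝ fromℤ (+ s)

  SimplexA : Pred (Vector ℝ t) 0ℓ
  SimplexA a = HyperplaneA a × (∀ i → a ⟦ idx i ℤ.+ + s ⟧ -ℝ fromℤ (+ s) ≤ℝ a i)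

  SimplexZ : Pred (Vector ℝ t) 0ℓ
  SimplexZ z = HyperplaneZ z × (∀ j → fromℤ 0ℤ ≤ℝ z j)

  LatticeA : Pred (Vector ℝ t) 0ℓ
  LatticeA a = Σ[ n ∈ Vector ℤ t ] a ≋ (λ i → fromℤ (n i)) × (∀ i → n i ≡ idx i [mod t ])

  LatticeZ : Pred (Vector ℝ t) 0ℓ
  LatticeZ z = Σ[ n ∈ Vector ℤ t ] z ≋ (λ i → fromℤ (n i)) × sumℤ (λ i → idx i ℤ.* n i) ≡ 0ℤ [mod t ]

  A : Pred (Vector ℝ t) 0ℓ
  A = SimplexA ∩ LatticeA

  TD : Pred (Vector ℝ t) 0ℓ
  TD = SimplexZ ∩ LatticeZ

{-# OPTIONS --safe #-}

-- Listing the coordinates as b_ℓ = a_{k+ℓs} turns z into q (b_j − b_{j+1} + s) with q = 1/t.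
-- Abel summation on the cycle gives Σ_j (h − j)(x_{j+ℓ} − x_{j+ℓ+1}) = t x_ℓ − Σ x with
-- h = (t − 1)/2, and since Σ_j (h − j) = 0 this one identity inverts the change of variables in
-- both directions; on integer points it reads b_ℓ = k − Σ_j j z_{j+ℓ}, because k = h (s + 1).
--
-- The numbers c − λ̄_c form the complement of the beta-set B, and a hook length is the difference
-- of an element of B and one of its complement; so λ is a t-core iff B − t ⊆ B, that is, iff B
-- consists of the b below the coordinate of their class.  Removing the largest element of such a
-- set lowers one coordinate by t; after sufficiently many removals only {b : b < −tL} remains,
-- which yields Σ a = C(t,2) + t c when the r-th largest element is eventually c − r.  Hence
-- Σ a = C(t,2) says exactly that the set is the beta-set of a partition.

module Submission where

open import Defs
open import Algebra.Bundles using (AbelianGroup; Ring)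
import Algebra.Properties.CommutativeMonoid.Sum as CommutativeMonoidSum
import Algebra.Properties.Group as GroupProperties
import Algebra.Properties.Semiring.Sum as SemiringSum
open import Data.Fin.Base using (Fin; toℕ; fromℕ<; zero; suc)
open import Data.Fin.Permutation using (Permutation; permutation)
import Data.Fin.Properties as Finₚ
open import Data.Integer.Base as ℤ using (ℤ; +_; -[1+_]; 0ℤ; 1ℤ)
open import Data.Integer.Divisibility.Signed
  using (_∣_; divides; ∣⇒∣ᵤ; ∣m∣n⇒∣m+n; ∣m∣n⇒∣m-n; ∣n⇒∣m*n; module _∣_)
open import Data.Integer.DivMod using (n%ℕd<d; a≡a%ℕn+[a/ℕn]*n)
import Data.Integer.Properties as ℤₚ
open import Data.Integer.Tactic.RingSolver using (solve-∀)
open import Data.List.Base using (length; filter; []; applyUpTo)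
open import Data.List.Properties using (filter-reject)
open import Data.Nat.Base as ℕ using (ℕ; zero; suc; _*_; _∸_; NonZero; z≤n; s≤s)
open import Data.Nat.Combinatorics using (_C_; nCk+nC[k+1]≡[n+1]C[k+1]; nC1≡n)
open import Data.Nat.Coprimality as Coprimality using (Coprime; coprime-Bézout)
import Data.Nat.Divisibility as ℕ∣
import Data.Nat.DivMod as ℕ/
open import Data.Nat.GCD using (module Bézout)
import Data.Nat.Properties as ℕₚ
open import Data.Product.Base using (∃; ∃-syntax; _×_; _,_; proj₁; proj₂)
open import Data.Rational.Base as ℚ using (ℚ; 0ℚ; 1ℚ; ½; mkℚ)
import Data.Rational.Properties as ℚₚ
import Data.Rational.Solver as ℚSolver
import Data.Rational.Unnormalised.Base as ℚᵘ
import Data.Rational.Unnormalised.Properties as ℚᵘₚ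
open import Data.Sum.Base using (_⊎_; inj₁; inj₂)
open import Data.Vec.Functional using (Vector)
open import Function.Base using (_on_)
open import Function.Bundles using (_⇔_; mk⇔)
open import Function.Structures using (IsBijection)
open import Level using (0ℓ)
open import Relation.Binary.Core using (Rel)
open import Relation.Binary.Definitions using (tri<; tri≈; tri>)
open import Relation.Binary.PropositionalEquality
open import Relation.Binary.Structures using (IsEquivalence)
open import Relation.Nullary using (¬_; Dec; yes; no; contradiction)
open import Relation.Unary using (Pred; _∩_; Decidable)

open import Algebra.Definitions.RawMonoid ℚ.+-0-rawMonoid using () renaming (sum to sumℚ)
module Sumℚ = CommutativeMonoidSum ℚₚ.+-0-commutativeMonoid
module SumSemiringℚ = SemiringSum (Ring.semiring ℚₚ.+-*-ring)
module ℤ+ = GroupProperties (AbelianGroup.group ℤₚ.+-0-abelianGroup)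
open ℚSolver.+-*-Solver using (solve; con; _:=_; _:+_; _:*_; _:-_; :-_)

-- The algebra of the change of variables is exact for the rational entries at each index of the
-- Cauchy sequences; limits enter only through hypotheses about reals, namely the hyperplane
-- equations, `toZ s t a ≋ z`, the inverse formula and the inequalities.
--
-- Every other bijection is a restriction of the one between the hyperplanes or of the one for
-- t-cores, so only side conditions have to be matched. The number t z_j is the slack of the simplex
-- inequality at i = s j + k. Once a is integral, integrality of z says that a_i - i modulo t does
-- not change under i ↦ i + s, hence is the same for all i; the congruence on Σ j z_j says that it
-- vanishes at i = k. For a t-core with beta-set B, the inequality at i says that B - s ⊆ B holds on
-- the elements of class i + s.
--
-- The obstacle on the partition side is normalisation. A set bounded above, closed under
-- subtracting t and meeting every class can be listed decreasingly, but its r-th element may settle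
-- at c - r with c ≠ 0, and then it is no beta-set. The offset c has to be read off from the
-- finitely many coordinates although the set is infinite.

-- Congruences

-- A record, unlike _≡_[mod_], lets both sides be inferred from a proof.
infix 4 _≅_[_]

record _≅_[_] (a b : ℤ) (t : ℕ) : Set where
  constructor mod
  field unmod : a ≡ b [mod t ]
open _≅_[_] public

mod-reflexive : ∀ {t a b} → a ≡ b → a ≅ b [ t ]
mod-reflexive {t} {a} refl = mod (divides 0ℤ (trans (ℤₚ.+-inverseʳ a) (sym (ℤₚ.*-zeroˡ (+ t)))))

mod-refl : ∀ {t a} → a ≅ a [ t ]
mod-refl = mod-reflexive refl

mod-sym : ∀ {t a b} → a ≅ b [ t ] → b ≅ a [ t ]
mod-sym {t} {a} {b} (mod (divides q e)) =
  mod (divides (ℤ.- q) (trans (lemma a b) (trans (cong ℤ.-_ e) (ℤₚ.neg-distribˡ-* q (+ t)))))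
  where
  lemma : ∀ a b → b ℤ.- a ≡ ℤ.- (a ℤ.- b)
  lemma = solve-∀

mod-trans : ∀ {t a b c} → a ≅ b [ t ] → b ≅ c [ t ] → a ≅ c [ t ]
mod-trans {t} {a} {b} {c} (mod p) (mod q) = mod (subst (+ t ∣_) (lemma a b c) (∣m∣n⇒∣m+n p q))
  where
  lemma : ∀ a b c → (a ℤ.- b) ℤ.+ (b ℤ.- c) ≡ a ℤ.- c
  lemma = solve-∀

mod-+ : ∀ {t a b c d} → a ≅ b [ t ] → c ≅ d [ t ] → a ℤ.+ c ≅ b ℤ.+ d [ t ]
mod-+ {t} {a} {b} {c} {d} (mod p) (mod q) = mod (subst (+ t ∣_) (lemma a b c d) (∣m∣n⇒∣m+n p q))
  where
  lemma : ∀ a b c d → (a ℤ.- b) ℤ.+ (c ℤ.- d) ≡ (a ℤ.+ c) ℤ.- (b ℤ.+ d)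
  lemma = solve-∀

mod-- : ∀ {t a b c d} → a ≅ b [ t ] → c ≅ d [ t ] → a ℤ.- c ≅ b ℤ.- d [ t ]
mod-- {t} {a} {b} {c} {d} (mod p) (mod q) = mod (subst (+ t ∣_) (lemma a b c d) (∣m∣n⇒∣m-n p q))
  where
  lemma : ∀ a b c d → (a ℤ.- b) ℤ.- (c ℤ.- d) ≡ (a ℤ.- c) ℤ.- (b ℤ.- d)
  lemma = solve-∀

mod-*ˡ : ∀ {t a b} c → a ≅ b [ t ] → c ℤ.* a ≅ c ℤ.* b [ t ]
mod-*ˡ {t} {a} {b} c (mod p) = mod (subst (+ t ∣_) (lemma a b c) (∣n⇒∣m*n c p))
  where
  lemma : ∀ a b c → c ℤ.* (a ℤ.- b) ≡ c ℤ.* a ℤ.- c ℤ.* b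
  lemma = solve-∀

minus-modulus : ∀ {t} a → a ℤ.- + t ≅ a [ t ]
minus-modulus {t} a = mod (divides (ℤ.- 1ℤ) (lemma a (+ t)))
  where
  lemma : ∀ a t → a ℤ.- t ℤ.- a ≡ (ℤ.- 1ℤ) ℤ.* t
  lemma = solve-∀

residue : ∀ t .{{_ : NonZero t}} → ℤ → Fin t
residue t i = fromℕ< (n%ℕd<d i t)

idx-residue : ∀ t .{{_ : NonZero t}} i → idx (residue t i) ≅ i [ t ]
idx-residue t i = mod-sym (mod (divides (i ℤ./ℕ t) (trans
  (cong₂ ℤ._-_ (a≡a%ℕn+[a/ℕn]*n i t) (cong +_ (Finₚ.toℕ-fromℕ< (n%ℕd<d i t))))
  (lemma (+ (i ℤ.%ℕ t)) (i ℤ./ℕ t ℤ.* + t)))))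
  where
  lemma : ∀ a b → (a ℤ.+ b) ℤ.- a ≡ b
  lemma = solve-∀

idx-injective-mod : ∀ {t} {i j : Fin t} → idx i ≅ idx j [ t ] → i ≡ j
idx-injective-mod {t} {i} {j} p = Finₚ.toℕ-injective (ℤₚ.+-injective
  (ℤₚ.i-j≡0⇒i≡j (idx i) (idx j) (ℤₚ.∣i∣≡0⇒i≡0 (small _ ∣i-j∣<t (∣⇒∣ᵤ (unmod p))))))
  where
  small : ∀ n → n ℕ.< t → t ℕ∣.∣ n → n ≡ 0
  small zero    _   _   = refl
  small (suc n) n<t t∣n = contradiction t∣n (ℕ∣.>⇒∤ n<t)
  ∣i-j∣<t : ℤ.∣ idx i ℤ.- idx j ∣ ℕ.< t
  ∣i-j∣<t = subst (λ d → ℤ.∣ d ∣ ℕ.< t) (sym (ℤₚ.m-n≡m⊖n (toℕ i) (toℕ j)))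
    (ℕₚ.≤-<-trans (ℤₚ.∣m⊝n∣≤m⊔n (toℕ i) (toℕ j))
      (ℕₚ.⊔-lub (Finₚ.toℕ<n i) (Finₚ.toℕ<n j)))

module _ {t : ℕ} .{{_ : NonZero t}} where

  residue-cong : ∀ {i j} → i ≅ j [ t ] → residue t i ≡ residue t j
  residue-cong {i} {j} p = idx-injective-mod
    (mod-trans (idx-residue t i) (mod-trans p (mod-sym (idx-residue t j))))

  residue-idx : ∀ (i : Fin t) → residue t (idx i) ≡ i
  residue-idx i = idx-injective-mod (idx-residue t (idx i))

  ⟦⟧-cong : ∀ {A : Set} (x : Vector A t) {i j} → i ≅ j [ t ] → x ⟦ i ⟧ ≡ x ⟦ j ⟧
  ⟦⟧-cong x p = cong x (residue-cong p)

  ⟦idx⟧ : ∀ {A : Set} (x : Vector A t) i → x ⟦ idx i ⟧ ≡ x i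
  ⟦idx⟧ x i = cong x (residue-idx i)

  -- The inverse map is i ↦ v (i - c). Sums over the cycle are reindexed by it, with u = 1 for
  -- rotations and u = s for the walk in steps of s.
  affine : ∀ u v c → u ℤ.* v ≅ 1ℤ [ t ] → Permutation t t
  affine u v c uv≡1 = permutation
    (λ j → residue t (u ℤ.* idx j ℤ.+ c))
    (λ i → residue t (v ℤ.* (idx i ℤ.- c)))
    (λ i → idx-injective-mod (mod-trans (idx-residue t _)
      (mod-trans (mod-+ (mod-*ˡ u (idx-residue t _)) (mod-refl {a = c})) (right (idx i)))))
    (λ j → idx-injective-mod (mod-trans (idx-residue t _)
      (mod-trans (mod-*ˡ v (mod-- (idx-residue t (u ℤ.* idx j ℤ.+ c)) (mod-refl {a = c}))) (left (idx j)))))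
    where
    scaled : ∀ i → i ℤ.* (u ℤ.* v) ≅ i [ t ]
    scaled i = mod-trans (mod-*ˡ i uv≡1) (mod-reflexive (ℤₚ.*-identityʳ i))
    right : ∀ i → u ℤ.* (v ℤ.* (i ℤ.- c)) ℤ.+ c ≅ i [ t ]
    right i = mod-trans (mod-reflexive (lemma u v (i ℤ.- c) c))
      (mod-trans (mod-+ (scaled (i ℤ.- c)) (mod-refl {a = c})) (mod-reflexive (lemma′ i c)))
      where
      lemma : ∀ u v i c → u ℤ.* (v ℤ.* i) ℤ.+ c ≡ i ℤ.* (u ℤ.* v) ℤ.+ c
      lemma = solve-∀
      lemma′ : ∀ i c → i ℤ.- c ℤ.+ c ≡ i
      lemma′ = solve-∀
    left : ∀ j → v ℤ.* (u ℤ.* j ℤ.+ c ℤ.- c) ≅ j [ t ]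
    left j = mod-trans (mod-reflexive (lemma u v j c)) (scaled j)
      where
      lemma : ∀ u v j c → v ℤ.* (u ℤ.* j ℤ.+ c ℤ.- c) ≡ j ℤ.* (u ℤ.* v)
      lemma = solve-∀

coprime-inverse : ∀ s t → Coprime s t → ∃[ v ] + s ℤ.* v ≅ 1ℤ [ t ]
coprime-inverse s t cop with coprime-Bézout cop
... | Bézout.+- x y e = + x , mod (divides (+ y) (trans
    (cong (λ n → n ℤ.- 1ℤ) (trans (ℤₚ.*-comm (+ s) (+ x)) (trans (sym (ℤₚ.pos-* x s)) (trans (cong +_ (sym e)) (trans (ℤₚ.pos-+ 1 (y ℕ.* t)) (cong (λ n → 1ℤ ℤ.+ n) (ℤₚ.pos-* y t)))))))
    (lemma (+ y ℤ.* + t))))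
  where
  lemma : ∀ a → 1ℤ ℤ.+ a ℤ.- 1ℤ ≡ a
  lemma = solve-∀
-- Bézout coefficients are natural numbers; here 1 + x s = y t, so the inverse of s is -x.
... | Bézout.-+ x y e = ℤ.- + x , mod (divides (ℤ.- + y) (trans (lemma (+ s) (+ x)) (trans
    (cong ℤ.-_ (trans (cong (λ n → 1ℤ ℤ.+ n) (sym (ℤₚ.pos-* x s))) (trans (sym (ℤₚ.pos-+ 1 (x ℕ.* s))) (trans (cong +_ e) (ℤₚ.pos-* y t)))))
    (ℤₚ.neg-distribˡ-* (+ y) (+ t)))))
  where
  lemma : ∀ s x → s ℤ.* (ℤ.- x) ℤ.- 1ℤ ≡ ℤ.- (1ℤ ℤ.+ x ℤ.* s)
  lemma = solve-∀

-- Limits of rational sequences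

ι : ℤ → ℚ
ι n = n ℚ./ 1

private
  -- The fraction `n / 1` is normalised by a gcd that does not compute for a variable n; this is the
  -- same number already in lowest terms.
  integer : ℤ → ℚ
  integer n = mkℚ n 0 (Coprimality.sym (Coprimality.1-coprimeTo ℤ.∣ n ∣))

  ι≡integer : ∀ n → ι n ≡ integer n
  ι≡integer n = ℚₚ.↥p/↧p≡p (integer n)

ι-injective : ∀ {m n} → ι m ≡ ι n → m ≡ n
ι-injective {m} {n} e = cong ℚ.↥_ (trans (sym (ι≡integer m)) (trans e (ι≡integer n)))

ι-+ : ∀ m n → ι (m ℤ.+ n) ≡ ι m ℚ.+ ι n
ι-+ m n = sym (trans (cong₂ ℚ._+_ (ι≡integer m) (ι≡integer n))
  (cong₂ (λ a b → ι (a ℤ.+ b)) (ℤₚ.*-identityʳ m) (ℤₚ.*-identityʳ n)))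

ι-* : ∀ m n → ι (m ℤ.* n) ≡ ι m ℚ.* ι n
ι-* m n = sym (cong₂ ℚ._*_ (ι≡integer m) (ι≡integer n))

ι-neg : ∀ n → ι (ℤ.- n) ≡ ℚ.- ι n
ι-neg n = trans (ι≡integer (ℤ.- n)) (trans (lemma n) (cong ℚ.-_ (sym (ι≡integer n))))
  where
  lemma : ∀ n → integer (ℤ.- n) ≡ ℚ.- integer n
  lemma (+ zero)  = ℚₚ.mkℚ-cong refl refl
  lemma (+ suc n) = ℚₚ.mkℚ-cong refl refl
  lemma -[1+ n ]  = ℚₚ.mkℚ-cong refl refl

ι-- : ∀ m n → ι (m ℤ.- n) ≡ ι m ℚ.- ι n
ι-- m n = trans (ι-+ m (ℤ.- n)) (cong (λ q → ι m ℚ.+ q) (ι-neg n))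

ι-/ : ∀ n d .{{_ : NonZero d}} → ι (+ d) ℚ.* (n ℚ./ d) ≡ ι n
ι-/ n (suc d) = ℚₚ.toℚᵘ-injective (begin-equality
  ℚ.toℚᵘ (ι (+ suc d) ℚ.* (n ℚ./ suc d))
    ≃⟨ ℚₚ.toℚᵘ-homo-* (ι (+ suc d)) (n ℚ./ suc d) ⟩
  ℚ.toℚᵘ (ι (+ suc d)) ℚᵘ.* ℚ.toℚᵘ (n ℚ./ suc d)
    ≃⟨ ℚᵘₚ.*-cong (ℚₚ.toℚᵘ-fromℚᵘ (ℚᵘ.mkℚᵘ (+ suc d) 0)) (ℚₚ.toℚᵘ-fromℚᵘ (ℚᵘ.mkℚᵘ n d)) ⟩
  ℚᵘ.mkℚᵘ (+ suc d) 0 ℚᵘ.* ℚᵘ.mkℚᵘ n d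
    ≃⟨ ℚᵘ.*≡* (trans (ℤₚ.*-identityʳ (+ suc d ℤ.* n)) (trans (ℤₚ.*-comm (+ suc d) n)
         (cong (λ e → n ℤ.* + e) (sym (ℕₚ.*-identityˡ (suc d)))))) ⟩
  ℚᵘ.mkℚᵘ n 0
    ≃⟨ ℚₚ.toℚᵘ-fromℚᵘ (ℚᵘ.mkℚᵘ n 0) ⟨
  ℚ.toℚᵘ (ι n) ∎)
  where open ℚᵘₚ.≤-Reasoning

private
  0<½* : ∀ {ε} → 0ℚ ℚ.< ε → 0ℚ ℚ.< ½ ℚ.* ε
  0<½* {ε} 0<ε = ℚₚ.positive⁻¹ _ {{ℚₚ.pos*pos⇒pos ½ ε {{ℚ.positive 0<ε}}}}

  ½+½ : ∀ ε → ½ ℚ.* ε ℚ.+ ½ ℚ.* ε ≡ ε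
  ½+½ ε = trans (sym (ℚₚ.*-distribʳ-+ ε ½ ½)) (ℚₚ.*-identityˡ ε)

-- Limits are compared on the underlying sequences: a conversion check between two
-- reals would also unfold their Cauchy proofs.  (The record lets both sides be inferred.)
infix 4 _≃_

record _≃_ (f g : ℕ → ℚ) : Set where
  constructor lim
  field unlim : ∀ ε → 0ℚ ℚ.< ε → ∃[ N ] ∀ n → N ℕ.≤ n → ℚ.∣ f n ℚ.- g n ∣ ℚ.≤ ε
open _≃_ public

pointwise : ∀ {f g} → (∀ n → f n ≡ g n) → f ≃ g
pointwise {f} {g} f≡g = lim λ ε 0<ε → 0 , λ n _ → subst (ℚ._≤ ε)
  (sym (trans (cong (λ q → ℚ.∣ q ℚ.- g n ∣) (f≡g n)) (cong ℚ.∣_∣ (ℚₚ.+-inverseʳ (g n)))))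
  (ℚₚ.<⇒≤ 0<ε)

≃-refl : ∀ {f} → f ≃ f
≃-refl = pointwise λ _ → refl

≃-sym : ∀ {f g} → f ≃ g → g ≃ f
≃-sym {f} {g} (lim f≃g) = lim λ ε 0<ε → let N , close = f≃g ε 0<ε in N , λ n N≤n →
  subst (ℚ._≤ ε) (trans (sym (ℚₚ.∣-p∣≡∣p∣ (f n ℚ.- g n)))
    (cong ℚ.∣_∣ (solve 2 (λ a b → :- (a :- b) := b :- a) refl (f n) (g n))))
    (close n N≤n)

private
  ∣+∣-bound : ∀ {ε} p q r → r ≡ p ℚ.+ q → ℚ.∣ p ∣ ℚ.≤ ½ ℚ.* ε → ℚ.∣ q ∣ ℚ.≤ ½ ℚ.* ε → ℚ.∣ r ∣ ℚ.≤ ε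
  ∣+∣-bound {ε} p q _ refl p≤ q≤ = ℚₚ.≤-trans (ℚₚ.∣p+q∣≤∣p∣+∣q∣ p q)
    (subst (ℚ.∣ p ∣ ℚ.+ ℚ.∣ q ∣ ℚ.≤_) (½+½ ε) (ℚₚ.+-mono-≤ p≤ q≤))

≃-trans : ∀ {f g h} → f ≃ g → g ≃ h → f ≃ h
≃-trans {f} {g} {h} (lim f≃g) (lim g≃h) = lim λ ε 0<ε →
  let M , close = f≃g (½ ℚ.* ε) (0<½* 0<ε)
      N , close′ = g≃h (½ ℚ.* ε) (0<½* 0<ε)
  in M ℕ.⊔ N , λ n n≥ → ∣+∣-bound (f n ℚ.- g n) (g n ℚ.- h n) _
    (solve 3 (λ a b c → a :- c := (a :- b) :+ (b :- c)) refl (f n) (g n) (h n))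
    (close n (ℕₚ.m⊔n≤o⇒m≤o M N n≥)) (close′ n (ℕₚ.m⊔n≤o⇒n≤o M N n≥))

module ≃-Reasoning where

  infixr 2 _≃⟨_⟩_
  infix  3 _∎≃

  _≃⟨_⟩_ : ∀ f {g h} → f ≃ g → g ≃ h → f ≃ h
  f ≃⟨ f≃g ⟩ g≃h = ≃-trans f≃g g≃h

  _∎≃ : ∀ f → f ≃ f
  f ∎≃ = ≃-refl

+-cong : ∀ {f f′ g g′} → f ≃ f′ → g ≃ g′ → (λ n → f n ℚ.+ g n) ≃ (λ n → f′ n ℚ.+ g′ n)
+-cong {f} {f′} {g} {g′} (lim f≃) (lim g≃) = lim λ ε 0<ε →
  let M , close = f≃ (½ ℚ.* ε) (0<½* 0<ε)
      N , close′ = g≃ (½ ℚ.* ε) (0<½* 0<ε)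
  in M ℕ.⊔ N , λ n n≥ → ∣+∣-bound (f n ℚ.- f′ n) (g n ℚ.- g′ n) _
    (solve 4 (λ a b c d → (a :+ c) :- (b :+ d) := (a :- b) :+ (c :- d)) refl
      (f n) (f′ n) (g n) (g′ n))
    (close n (ℕₚ.m⊔n≤o⇒m≤o M N n≥)) (close′ n (ℕₚ.m⊔n≤o⇒n≤o M N n≥))

*-congˡ : ∀ q {f g} → f ≃ g → (λ n → q ℚ.* f n) ≃ (λ n → q ℚ.* g n)
*-congˡ q {f} {g} (lim f≃g) = lim λ ε 0<ε →
  let instance _ = ℚ.positive 0<ε
      N , close = f≃g (ℚ.1/ K ℚ.* ε) (ℚₚ.positive⁻¹ _ {{ℚₚ.pos*pos⇒pos (ℚ.1/ K) ε}})
  in N , λ n N≤n → begin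
    ℚ.∣ q ℚ.* f n ℚ.- q ℚ.* g n ∣
      ≡⟨ cong ℚ.∣_∣ (solve 3 (λ q a b → q :* a :- q :* b := q :* (a :- b)) refl q (f n) (g n)) ⟩
    ℚ.∣ q ℚ.* (f n ℚ.- g n) ∣
      ≡⟨ ℚₚ.∣p*q∣≡∣p∣*∣q∣ q (f n ℚ.- g n) ⟩
    ℚ.∣ q ∣ ℚ.* ℚ.∣ f n ℚ.- g n ∣
      ≤⟨ ℚₚ.*-monoʳ-≤-nonNeg ℚ.∣ f n ℚ.- g n ∣ {{ℚₚ.∣-∣-nonNeg (f n ℚ.- g n)}} ∣q∣≤K ⟩
    K ℚ.* ℚ.∣ f n ℚ.- g n ∣
      ≤⟨ ℚₚ.*-monoˡ-≤-nonNeg K {{ℚₚ.pos⇒nonNeg K}} (close n N≤n) ⟩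
    K ℚ.* (ℚ.1/ K ℚ.* ε)
      ≡⟨ trans (sym (ℚₚ.*-assoc K (ℚ.1/ K) ε)) (trans (cong (ℚ._* ε) (ℚₚ.*-inverseʳ K)) (ℚₚ.*-identityˡ ε)) ⟩
    ε ∎
  where
  open ℚₚ.≤-Reasoning
  K : ℚ
  -- The added 1 keeps K positive when q = 0, so that the tolerance ε / K makes sense.
  K = ℚ.∣ q ∣ ℚ.+ 1ℚ
  instance
    K⁺ : ℚ.Positive K
    K⁺ = ℚₚ.nonNeg+pos⇒pos ℚ.∣ q ∣ {{ℚₚ.∣-∣-nonNeg q}} 1ℚ
    K≢0 : ℚ.NonZero K
    K≢0 = ℚₚ.pos⇒nonZero K
    1/K⁺ : ℚ.Positive (ℚ.1/ K)
    1/K⁺ = ℚₚ.1/pos⇒pos K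
  ∣q∣≤K : ℚ.∣ q ∣ ℚ.≤ K
  ∣q∣≤K = ℚₚ.≤-trans (ℚₚ.≤-reflexive (sym (ℚₚ.+-identityʳ ℚ.∣ q ∣))) (ℚₚ.+-monoʳ-≤ ℚ.∣ q ∣ (ℚₚ.nonNegative⁻¹ 1ℚ))

neg-cong : ∀ {f g} → f ≃ g → (λ n → ℚ.- f n) ≃ (λ n → ℚ.- g n)
neg-cong {f} {g} f≃g = ≃-trans (pointwise (λ n → lemma (f n)))
  (≃-trans (*-congˡ (ℚ.- 1ℚ) f≃g) (pointwise (λ n → sym (lemma (g n)))))
  where
  lemma : ∀ p → ℚ.- p ≡ ℚ.- 1ℚ ℚ.* p
  lemma p = trans (cong ℚ.-_ (sym (ℚₚ.*-identityˡ p))) (ℚₚ.neg-distribˡ-* 1ℚ p)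

-- Turns statements about real sums into rational identities at each index, which `pointwise`
-- carries back to limits.
seq-sum : ∀ {k} (x : Vector ℝ k) n → seq (sumℝ x) n ≡ sumℚ (λ i → seq (x i) n)
seq-sum {zero}  x n = refl
seq-sum {suc k} x n = cong (λ q → seq (x zero) n ℚ.+ q) (seq-sum (λ i → x (suc i)) n)

sum-cong : ∀ {k} {f g : Vector (ℕ → ℚ) k} → (∀ i → f i ≃ g i) → (λ n → sumℚ (λ i → f i n)) ≃ (λ n → sumℚ (λ i → g i n))
sum-cong {zero}  f≃g = ≃-refl
sum-cong {suc k} f≃g = +-cong (f≃g zero) (sum-cong (λ i → f≃g (suc i)))

-- If p and q differed, half their distance would be a tolerance that they violate. Equations
-- between integers are recovered in this way from equations between reals.
constant-injective : ∀ {p q} → (λ _ → p) ≃ (λ _ → q) → p ≡ q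
constant-injective {p} {q} (lim p≃q) with p ℚₚ.≟ q
... | yes p≡q = p≡q
... | no  p≢q = contradiction (ℚₚ.<-≤-trans ½d<d (proj₂ (p≃q (½ ℚ.* d) (0<½* 0<d)) _ ℕₚ.≤-refl)) (ℚₚ.<-irrefl refl)
  where
  d = ℚ.∣ p ℚ.- q ∣
  d≢0 : ¬ 0ℚ ≡ d
  d≢0 0≡d = p≢q (trans (solve 2 (λ a b → a := (a :- b) :+ b) refl p q)
    (trans (cong (ℚ._+ q) (ℚₚ.∣p∣≡0⇒p≡0 (p ℚ.- q) (sym 0≡d))) (ℚₚ.+-identityˡ q)))
  0<d : 0ℚ ℚ.< d
  0<d = ℚₚ.≰⇒> λ d≤0 → d≢0 (ℚₚ.≤-antisym (ℚₚ.0≤∣p∣ (p ℚ.- q)) d≤0)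
  ½d<d : ½ ℚ.* d ℚ.< d
  ½d<d = subst (½ ℚ.* d ℚ.<_) (½+½ d) (subst (ℚ._< ½ ℚ.* d ℚ.+ ½ ℚ.* d) (ℚₚ.+-identityʳ (½ ℚ.* d)) (ℚₚ.+-monoʳ-< (½ ℚ.* d) (0<½* 0<d)))

-- Inequalities between limits

infix 4 _≲_

_≲_ : (f g : ℕ → ℚ) → Set
f ≲ g = ∀ ε → 0ℚ ℚ.< ε → ∃[ N ] ∀ n → N ℕ.≤ n → f n ℚ.≤ g n ℚ.+ ε

≲-trans : ∀ {f g h} → f ≲ g → g ≲ h → f ≲ h
≲-trans {f} {g} {h} f≲g g≲h ε 0<ε =
  let M , below = f≲g (½ ℚ.* ε) (0<½* 0<ε)
      N , below′ = g≲h (½ ℚ.* ε) (0<½* 0<ε)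
  in M ℕ.⊔ N , λ n n≥ → begin
    f n                               ≤⟨ below n (ℕₚ.m⊔n≤o⇒m≤o M N n≥) ⟩
    g n ℚ.+ ½ ℚ.* ε                   ≤⟨ ℚₚ.+-monoˡ-≤ (½ ℚ.* ε) (below′ n (ℕₚ.m⊔n≤o⇒n≤o M N n≥)) ⟩
    h n ℚ.+ ½ ℚ.* ε ℚ.+ ½ ℚ.* ε       ≡⟨ ℚₚ.+-assoc (h n) (½ ℚ.* ε) (½ ℚ.* ε) ⟩
    h n ℚ.+ (½ ℚ.* ε ℚ.+ ½ ℚ.* ε)     ≡⟨ cong (λ q → h n ℚ.+ q) (½+½ ε) ⟩
    h n ℚ.+ ε ∎
  where open ℚₚ.≤-Reasoning

≃⇒≲ : ∀ {f g} → f ≃ g → f ≲ g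
≃⇒≲ {f} {g} (lim f≃g) ε 0<ε = let N , close = f≃g ε 0<ε in N , λ n N≤n → begin
  f n                      ≡⟨ solve 2 (λ a b → a := b :+ (a :- b)) refl (f n) (g n) ⟩
  g n ℚ.+ (f n ℚ.- g n)    ≤⟨ ℚₚ.+-monoʳ-≤ (g n) (ℚₚ.≤-trans (p≤∣p∣ (f n ℚ.- g n)) (close n N≤n)) ⟩
  g n ℚ.+ ε ∎
  where
  open ℚₚ.≤-Reasoning
  p≤∣p∣ : ∀ p → p ℚ.≤ ℚ.∣ p ∣
  p≤∣p∣ p with ℚₚ.≤-total 0ℚ p
  ... | inj₁ 0≤p = ℚₚ.≤-reflexive (sym (ℚₚ.0≤p⇒∣p∣≡p 0≤p))
  ... | inj₂ p≤0 = ℚₚ.≤-trans p≤0 (ℚₚ.0≤∣p∣ p)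

constant-≲ : ∀ {p q} → p ℚ.≤ q → (λ _ → p) ≲ (λ _ → q)
constant-≲ {p} {q} p≤q ε 0<ε = 0 , λ _ _ → ℚₚ.≤-trans p≤q
  (ℚₚ.≤-trans (ℚₚ.≤-reflexive (sym (ℚₚ.+-identityʳ q))) (ℚₚ.+-monoʳ-≤ q (ℚₚ.<⇒≤ 0<ε)))

constant-≲⁻¹ : ∀ {p q} → (λ _ → p) ≲ (λ _ → q) → p ℚ.≤ q
constant-≲⁻¹ {p} {q} p≲q = ℚₚ.≮⇒≥ λ q<p →
  let d = p ℚ.- q
      0<d = subst (ℚ._< d) (ℚₚ.+-inverseʳ q) (ℚₚ.+-monoˡ-< (ℚ.- q) q<p)
      ½d = ½ ℚ.* d
      N , below = p≲q ½d (0<½* 0<d)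
      q+½d<p : q ℚ.+ ½d ℚ.< p
      q+½d<p = subst (q ℚ.+ ½d ℚ.<_)
        (trans (ℚₚ.+-assoc q ½d ½d) (trans (cong (λ x → q ℚ.+ x) (½+½ d)) (solve 2 (λ a b → b :+ (a :- b) := a) refl p q)))
        (subst (ℚ._< q ℚ.+ ½d ℚ.+ ½d) (ℚₚ.+-identityʳ (q ℚ.+ ½d)) (ℚₚ.+-monoʳ-< (q ℚ.+ ½d) (0<½* 0<d)))
  in ℚₚ.<-irrefl refl (ℚₚ.<-≤-trans q+½d<p (below N ℕₚ.≤-refl))

ι-mono : ∀ {m n} → m ℤ.≤ n → ι m ℚ.≤ ι n
ι-mono {m} {n} m≤n = subst₂ ℚ._≤_ (sym (ι≡integer m)) (sym (ι≡integer n))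
  (ℚ.*≤* (subst₂ ℤ._≤_ (sym (ℤₚ.*-identityʳ m)) (sym (ℤₚ.*-identityʳ n)) m≤n))

ι-cancel-≤ : ∀ {m n} → ι m ℚ.≤ ι n → m ℤ.≤ n
ι-cancel-≤ {m} {n} p = subst₂ ℤ._≤_ (ℤₚ.*-identityʳ m) (ℤₚ.*-identityʳ n)
  (ℚₚ.drop-*≤* (subst₂ ℚ._≤_ (ι≡integer m) (ι≡integer n) p))

module _ (q T : ℚ) .{{_ : ℚ.Positive q}} .{{_ : ℚ.Positive T}} (qT≡1 : q ℚ.* T ≡ 1ℚ) {f g : ℕ → ℚ} where

  open ℚₚ.≤-Reasoning

  0≤scaled-difference : f ≲ g → (λ _ → 0ℚ) ≲ (λ n → q ℚ.* (g n ℚ.- f n))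
  0≤scaled-difference f≲g ε 0<ε =
    let instance _ = ℚ.positive 0<ε
        -- Multiplication by q turns the tolerance T ε into ε.
        N , below = f≲g (T ℚ.* ε) (ℚₚ.positive⁻¹ _ {{ℚₚ.pos*pos⇒pos T ε}})
    in N , λ n N≤n → begin
      0ℚ                                  ≡⟨ ℚₚ.*-zeroʳ q ⟨
      q ℚ.* 0ℚ                            ≡⟨ cong (q ℚ.*_) (ℚₚ.+-inverseʳ (f n)) ⟨
      q ℚ.* (f n ℚ.- f n)
        ≤⟨ ℚₚ.*-monoˡ-≤-nonNeg q {{ℚₚ.pos⇒nonNeg q}} (ℚₚ.+-monoˡ-≤ (ℚ.- f n) (below n N≤n)) ⟩
      q ℚ.* (g n ℚ.+ T ℚ.* ε ℚ.- f n)
        ≡⟨ solve 5 (λ q T ε a b → q :* (b :+ T :* ε :- a) := q :* (b :- a) :+ (q :* T) :* ε) refl q T ε (f n) (g n) ⟩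
      q ℚ.* (g n ℚ.- f n) ℚ.+ (q ℚ.* T) ℚ.* ε
        ≡⟨ cong (λ p → q ℚ.* (g n ℚ.- f n) ℚ.+ p) (trans (cong (ℚ._* ε) qT≡1) (ℚₚ.*-identityˡ ε)) ⟩
      q ℚ.* (g n ℚ.- f n) ℚ.+ ε ∎

  scaled-difference⁻¹ : (λ _ → 0ℚ) ≲ (λ n → q ℚ.* (g n ℚ.- f n)) → f ≲ g
  scaled-difference⁻¹ 0≤ ε 0<ε =
    let instance _ = ℚ.positive 0<ε
        N , below = 0≤ (q ℚ.* ε) (ℚₚ.positive⁻¹ _ {{ℚₚ.pos*pos⇒pos q ε}})
    in N , λ n N≤n → begin
      f n                             ≡⟨ solve 2 (λ a T → a := T :* con 0ℚ :+ a) refl (f n) T ⟩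
      T ℚ.* 0ℚ ℚ.+ f n
        ≤⟨ ℚₚ.+-monoˡ-≤ (f n) (ℚₚ.*-monoˡ-≤-nonNeg T {{ℚₚ.pos⇒nonNeg T}} (below n N≤n)) ⟩
      T ℚ.* (q ℚ.* (g n ℚ.- f n) ℚ.+ q ℚ.* ε) ℚ.+ f n
        ≡⟨ solve 5 (λ q T ε a b → T :* (q :* (b :- a) :+ q :* ε) :+ a := (q :* T) :* (b :- a :+ ε) :+ a) refl q T ε (f n) (g n) ⟩
      (q ℚ.* T) ℚ.* (g n ℚ.- f n ℚ.+ ε) ℚ.+ f n
        ≡⟨ cong (λ p → p ℚ.* (g n ℚ.- f n ℚ.+ ε) ℚ.+ f n) qT≡1 ⟩
      1ℚ ℚ.* (g n ℚ.- f n ℚ.+ ε) ℚ.+ f n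
        ≡⟨ solve 3 (λ ε a b → con 1ℚ :* (b :- a :+ ε) :+ a := b :+ ε) refl ε (f n) (g n) ⟩
      g n ℚ.+ ε ∎

-- Summation

ι-sum : ∀ {n} (m : Vector ℤ n) → ι (sumℤ m) ≡ sumℚ {n} (λ i → ι (m i))
ι-sum {zero}  m = refl
ι-sum {suc n} m = trans (ι-+ (m zero) (sumℤ {n} (λ i → m (suc i))))
  (cong (λ x → ι (m zero) ℚ.+ x) (ι-sum {n} (λ i → m (suc i))))

sumℤ-cong : ∀ {n} {f g : Vector ℤ n} → (∀ i → f i ≡ g i) → sumℤ f ≡ sumℤ g
sumℤ-cong {zero}  f≗g = refl
sumℤ-cong {suc n} f≗g = cong₂ ℤ._+_ (f≗g zero) (sumℤ-cong (λ i → f≗g (suc i)))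

ι-suc : ∀ n → ι (+ suc n) ≡ 1ℚ ℚ.+ ι (+ n)
ι-suc n = ι-+ 1ℤ (+ n)

-- Induction on n for all c at once: once the first term is split off, the weight c - (i + 1) of the
-- others is (c - 1) - i.
abel : ∀ n c (w : ℕ → ℚ) →
  sumℚ {n} (λ i → (c ℚ.- ι (idx i)) ℚ.* (w (toℕ i) ℚ.- w (suc (toℕ i)))) ℚ.+ (c ℚ.- ι (+ n)) ℚ.* w n
    ≡ c ℚ.* w 0 ℚ.- sumℚ {n} (λ i → w (suc (toℕ i)))
abel zero    c w = solve 2 (λ c w → con 0ℚ :+ (c :- con 0ℚ) :* w := c :* w :- con 0ℚ) refl c (w 0)
abel (suc n) c w = begin
  (c ℚ.- 0ℚ) ℚ.* (w 0 ℚ.- w 1) ℚ.+ sumℚ {n} tail ℚ.+ (c ℚ.- ι (+ suc n)) ℚ.* w (suc n)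
    ≡⟨ cong₂ (λ x y → (c ℚ.- 0ℚ) ℚ.* (w 0 ℚ.- w 1) ℚ.+ x ℚ.+ y ℚ.* w (suc n))
         (Sumℚ.sum-cong-≗ {n} (λ i → cong (ℚ._* (w (suc (toℕ i)) ℚ.- w (suc (suc (toℕ i))))) (shift-weight (toℕ i))))
         (shift-weight n) ⟩
  (c ℚ.- 0ℚ) ℚ.* (w 0 ℚ.- w 1) ℚ.+ sumℚ {n} tail′ ℚ.+ (c ℚ.- 1ℚ ℚ.- ι (+ n)) ℚ.* w (suc n)
    ≡⟨ solve 5 (λ c w₀ w₁ x y → (c :- con 0ℚ) :* (w₀ :- w₁) :+ x :+ y := c :* w₀ :- c :* w₁ :+ (x :+ y))
         refl c (w 0) (w 1) (sumℚ {n} tail′) _ ⟩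
  c ℚ.* w 0 ℚ.- c ℚ.* w 1 ℚ.+ (sumℚ {n} tail′ ℚ.+ (c ℚ.- 1ℚ ℚ.- ι (+ n)) ℚ.* w (suc n))
    ≡⟨ cong (λ x → c ℚ.* w 0 ℚ.- c ℚ.* w 1 ℚ.+ x) (abel n (c ℚ.- 1ℚ) (λ i → w (suc i))) ⟩
  c ℚ.* w 0 ℚ.- c ℚ.* w 1 ℚ.+ ((c ℚ.- 1ℚ) ℚ.* w 1 ℚ.- rest)
    ≡⟨ solve 4 (λ c w₀ w₁ x → c :* w₀ :- c :* w₁ :+ ((c :- con 1ℚ) :* w₁ :- x) := c :* w₀ :- (w₁ :+ x))
         refl c (w 0) (w 1) rest ⟩
  c ℚ.* w 0 ℚ.- (w 1 ℚ.+ rest) ∎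
  where
  open ≡-Reasoning
  tail tail′ : Fin n → ℚ
  tail  i = (c ℚ.- ι (+ suc (toℕ i))) ℚ.* (w (suc (toℕ i)) ℚ.- w (suc (suc (toℕ i))))
  tail′ i = (c ℚ.- 1ℚ ℚ.- ι (idx i)) ℚ.* (w (suc (toℕ i)) ℚ.- w (suc (suc (toℕ i))))
  rest = sumℚ {n} (λ i → w (suc (suc (toℕ i))))
  shift-weight : ∀ i → c ℚ.- ι (+ suc i) ≡ c ℚ.- 1ℚ ℚ.- ι (+ i)
  shift-weight i = trans (cong (λ x → c ℚ.- x) (ι-suc i))
    (solve 2 (λ c x → c :- (con 1ℚ :+ x) := c :- con 1ℚ :- x) refl c (ι (+ i)))

-- The arithmetic series, doubled so that the induction needs no division.
sum-ramp : ∀ n c → ι (+ 2) ℚ.* sumℚ {n} (λ i → c ℚ.- ι (idx i)) ≡ ι (+ n) ℚ.* (ι (+ 2) ℚ.* c ℚ.- ι (+ n) ℚ.+ 1ℚ)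
sum-ramp zero    c = solve 1 (λ c → con (ι (+ 2)) :* con 0ℚ := con 0ℚ :* (con (ι (+ 2)) :* c :- con 0ℚ :+ con 1ℚ)) refl c
sum-ramp (suc n) c = begin
  ι (+ 2) ℚ.* (c ℚ.- 0ℚ ℚ.+ sumℚ {n} (λ i → c ℚ.- ι (+ suc (toℕ i))))
    ≡⟨ cong (λ x → ι (+ 2) ℚ.* (c ℚ.- 0ℚ ℚ.+ x)) (Sumℚ.sum-cong-≗ {n} (λ i → shift-weight (toℕ i))) ⟩
  ι (+ 2) ℚ.* (c ℚ.- 0ℚ ℚ.+ rest)
    ≡⟨ solve 2 (λ c x → con (ι (+ 2)) :* (c :- con 0ℚ :+ x) := con (ι (+ 2)) :* c :+ con (ι (+ 2)) :* x) refl c rest ⟩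
  ι (+ 2) ℚ.* c ℚ.+ ι (+ 2) ℚ.* rest
    ≡⟨ cong (λ x → ι (+ 2) ℚ.* c ℚ.+ x) (sum-ramp n (c ℚ.- 1ℚ)) ⟩
  ι (+ 2) ℚ.* c ℚ.+ ι (+ n) ℚ.* (ι (+ 2) ℚ.* (c ℚ.- 1ℚ) ℚ.- ι (+ n) ℚ.+ 1ℚ)
    ≡⟨ solve 2 (λ c m → con (ι (+ 2)) :* c :+ m :* (con (ι (+ 2)) :* (c :- con 1ℚ) :- m :+ con 1ℚ)
         := (con 1ℚ :+ m) :* (con (ι (+ 2)) :* c :- (con 1ℚ :+ m) :+ con 1ℚ)) refl c (ι (+ n)) ⟩
  (1ℚ ℚ.+ ι (+ n)) ℚ.* (ι (+ 2) ℚ.* c ℚ.- (1ℚ ℚ.+ ι (+ n)) ℚ.+ 1ℚ)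
    ≡⟨ cong (λ x → x ℚ.* (ι (+ 2) ℚ.* c ℚ.- x ℚ.+ 1ℚ)) (sym (ι-suc n)) ⟩
  ι (+ suc n) ℚ.* (ι (+ 2) ℚ.* c ℚ.- ι (+ suc n) ℚ.+ 1ℚ) ∎
  where
  open ≡-Reasoning
  rest = sumℚ {n} (λ i → c ℚ.- 1ℚ ℚ.- ι (idx i))
  shift-weight : ∀ i → c ℚ.- ι (+ suc i) ≡ c ℚ.- 1ℚ ℚ.- ι (+ i)
  shift-weight i = trans (cong (λ x → c ℚ.- x) (ι-suc i))
    (solve 2 (λ c x → c :- (con 1ℚ :+ x) := c :- con 1ℚ :- x) refl c (ι (+ i)))

sum-- : ∀ {n} (f g : Vector ℚ n) → sumℚ f ℚ.- sumℚ g ≡ sumℚ {n} (λ i → f i ℚ.- g i)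
sum-- {zero}  f g = refl
sum-- {suc n} f g = trans
  (solve 4 (λ a b c d → (a :+ b) :- (c :+ d) := (a :- c) :+ (b :- d)) refl
    (f zero) (sumℚ {n} (λ i → f (suc i))) (g zero) (sumℚ {n} (λ i → g (suc i))))
  (cong (λ x → f zero ℚ.- g zero ℚ.+ x) (sum-- {n} (λ i → f (suc i)) (λ i → g (suc i))))

-- The inverse formula as an identity on the cycle of length t

module Cyclic (t : ℕ) .{{_ : NonZero t}} where

  open ≡-Reasoning

  T h q : ℚ
  T = ι (+ t)
  h = (+ t ℤ.- 1ℤ) ℚ./ 2
  q = 1ℤ ℚ./ t

  qT≡1 : q ℚ.* T ≡ 1ℚ
  qT≡1 = trans (ℚₚ.*-comm q T) (ι-/ 1ℤ t)

  ι[t∸1]≡T-1 : ι (+ (t ℕ.∸ 1)) ≡ T ℚ.- 1ℚ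
  ι[t∸1]≡T-1 = trans (cong ι (lemma t)) (ι-- (+ t) 1ℤ)
    where
    lemma : ∀ t .{{_ : NonZero t}} → + (t ℕ.∸ 1) ≡ + t ℤ.- 1ℤ
    lemma (suc t) = refl

  2h≡T-1 : ι (+ 2) ℚ.* h ≡ T ℚ.- 1ℚ
  2h≡T-1 = trans (ι-/ (+ t ℤ.- 1ℤ) 2) (ι-- (+ t) 1ℤ)

  2≢0-cancel : ∀ {x y} → ι (+ 2) ℚ.* x ≡ ι (+ 2) ℚ.* y → x ≡ y
  2≢0-cancel {x} {y} e = trans (halve x) (trans (cong (½ ℚ.*_) e) (sym (halve y)))
    where
    halve : ∀ x → x ≡ ½ ℚ.* (ι (+ 2) ℚ.* x)
    halve = solve 1 (λ x → x := con ½ :* (con (ι (+ 2)) :* x)) refl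

  -- `h` is the mean of the residues 0, ..., t - 1.
  sum-centred : sumℚ {t} (λ j → h ℚ.- ι (idx j)) ≡ 0ℚ
  sum-centred = 2≢0-cancel (begin
    ι (+ 2) ℚ.* sumℚ {t} (λ j → h ℚ.- ι (idx j))  ≡⟨ sum-ramp t h ⟩
    T ℚ.* (ι (+ 2) ℚ.* h ℚ.- T ℚ.+ 1ℚ)            ≡⟨ cong (λ x → T ℚ.* (x ℚ.- T ℚ.+ 1ℚ)) 2h≡T-1 ⟩
    T ℚ.* (T ℚ.- 1ℚ ℚ.- T ℚ.+ 1ℚ)
      ≡⟨ solve 1 (λ T → T :* (T :- con 1ℚ :- T :+ con 1ℚ) := con (ι (+ 2)) :* con 0ℚ) refl T ⟩
    ι (+ 2) ℚ.* 0ℚ ∎)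

  sum-affine : ∀ {u v} c → u ℤ.* v ≅ 1ℤ [ t ] → (x : Vector ℚ t) →
    sumℚ {t} (λ j → x ⟦ u ℤ.* idx j ℤ.+ c ⟧) ≡ sumℚ x
  sum-affine {u} {v} c uv≡1 x = sym (Sumℚ.sum-permute x (affine u v c uv≡1))

  sum-shift : ∀ c (x : Vector ℚ t) → sumℚ {t} (λ j → x ⟦ idx j ℤ.+ c ⟧) ≡ sumℚ x
  sum-shift c x = trans
    (Sumℚ.sum-cong-≗ {t} λ j → cong (λ i → x ⟦ i ℤ.+ c ⟧) (sym (ℤₚ.*-identityˡ (idx j))))
    (sum-affine {1ℤ} {1ℤ} c mod-refl x)

  -- In `abel` with c = h the boundary term is (h - T) w_t, and w_t = w_0 by periodicity; moved
  -- across, it leaves h - (h - T) = T as the coefficient of x_ℓ.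
  cyclic-abel : ∀ (x : Vector ℚ t) ℓ →
    sumℚ {t} (λ j → (h ℚ.- ι (idx j)) ℚ.* (x ⟦ idx j ℤ.+ ℓ ⟧ ℚ.- x ⟦ idx j ℤ.+ (ℓ ℤ.+ 1ℤ) ⟧))
      ≡ T ℚ.* x ⟦ ℓ ⟧ ℚ.- sumℚ x
  cyclic-abel x ℓ = begin
    σ                                                ≡⟨ solve 2 (λ s y → s := s :+ y :- y) refl σ ((h ℚ.- T) ℚ.* w t) ⟩
    σ ℚ.+ (h ℚ.- T) ℚ.* w t ℚ.- (h ℚ.- T) ℚ.* w t    ≡⟨ cong₂ (λ a b → a ℚ.- (h ℚ.- T) ℚ.* b) summed (⟦⟧-cong x wrap) ⟩
    h ℚ.* x ⟦ ℓ ⟧ ℚ.- sumℚ x ℚ.- (h ℚ.- T) ℚ.* x ⟦ ℓ ⟧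
      ≡⟨ solve 4 (λ h T y s → h :* y :- s :- (h :- T) :* y := T :* y :- s) refl h T (x ⟦ ℓ ⟧) (sumℚ x) ⟩
    T ℚ.* x ⟦ ℓ ⟧ ℚ.- sumℚ x ∎
    where
    w : ℕ → ℚ
    w i = x ⟦ + i ℤ.+ ℓ ⟧
    σ = sumℚ {t} (λ j → (h ℚ.- ι (idx j)) ℚ.* (x ⟦ idx j ℤ.+ ℓ ⟧ ℚ.- x ⟦ idx j ℤ.+ (ℓ ℤ.+ 1ℤ) ⟧))
    next : ∀ i → w (suc i) ≡ x ⟦ + i ℤ.+ (ℓ ℤ.+ 1ℤ) ⟧
    next i = cong (λ j → x ⟦ j ⟧) (lemma (+ i) ℓ)
      where
      lemma : ∀ i ℓ → (1ℤ ℤ.+ i) ℤ.+ ℓ ≡ i ℤ.+ (ℓ ℤ.+ 1ℤ)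
      lemma = solve-∀
    wrap : + t ℤ.+ ℓ ≅ ℓ [ t ]
    wrap = mod (divides 1ℤ (lemma (+ t) ℓ))
      where
      lemma : ∀ t ℓ → t ℤ.+ ℓ ℤ.- ℓ ≡ 1ℤ ℤ.* t
      lemma = solve-∀
    summed : σ ℚ.+ (h ℚ.- T) ℚ.* w t ≡ h ℚ.* x ⟦ ℓ ⟧ ℚ.- sumℚ x
    summed = begin
      σ ℚ.+ (h ℚ.- T) ℚ.* w t
        ≡⟨ cong (λ a → a ℚ.+ (h ℚ.- T) ℚ.* w t) (Sumℚ.sum-cong-≗ {t} λ j →
             cong (λ y → (h ℚ.- ι (idx j)) ℚ.* (w (toℕ j) ℚ.- y)) (sym (next (toℕ j)))) ⟩
      _ ≡⟨ abel t h w ⟩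
      h ℚ.* w 0 ℚ.- sumℚ {t} (λ i → w (suc (toℕ i)))
        ≡⟨ cong₂ (λ i s → h ℚ.* x ⟦ i ⟧ ℚ.- s) (ℤₚ.+-identityˡ ℓ)
             (trans (Sumℚ.sum-cong-≗ {t} λ j → next (toℕ j)) (sum-shift (ℓ ℤ.+ 1ℤ) x)) ⟩
      h ℚ.* x ⟦ ℓ ⟧ ℚ.- sumℚ x ∎

  -- The right-hand side of `InverseFormula`, for rational entries and an arbitrary integer ℓ.
  F : Vector ℚ t → ℤ → ℚ
  F z ℓ = sumℚ {t} (λ j → (h ℚ.- ι (idx j)) ℚ.* z ⟦ idx j ℤ.+ ℓ ⟧)

  -- Summand by summand this is `cyclic-abel`. It shows that `toZ` undoes the inverse formula: when
  -- Σ z = s, the subtracted sum cancels against the s in the change of variables.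
  F-difference : ∀ z ℓ → F z ℓ ℚ.- F z (ℓ ℤ.+ 1ℤ) ≡ T ℚ.* z ⟦ ℓ ⟧ ℚ.- sumℚ z
  F-difference z ℓ = trans (sum-- {t} (λ j → (h ℚ.- ι (idx j)) ℚ.* z ⟦ idx j ℤ.+ ℓ ⟧) _) (trans
    (Sumℚ.sum-cong-≗ {t} λ j → solve 3 (λ c x y → c :* x :- c :* y := c :* (x :- y)) refl
      (h ℚ.- ι (idx j)) (z ⟦ idx j ℤ.+ ℓ ⟧) (z ⟦ idx j ℤ.+ (ℓ ℤ.+ 1ℤ) ⟧))
    (cyclic-abel z ℓ))

  F-cong-mod : ∀ z {ℓ ℓ′} → ℓ ≅ ℓ′ [ t ] → F z ℓ ≡ F z ℓ′
  F-cong-mod z ℓ≡ℓ′ = Sumℚ.sum-cong-≗ {t} λ j →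
    cong (λ x → (h ℚ.- ι (idx j)) ℚ.* x) (⟦⟧-cong z (mod-+ (mod-refl {a = idx j}) ℓ≡ℓ′))

  -- After the two sums are exchanged, each inner sum is Σ z whatever j is, so the centred weights
  -- cancel. Points given by the inverse formula therefore have coordinates of mean h.
  sum-F : ∀ z → sumℚ {t} (λ ℓ → F z (idx ℓ)) ≡ 0ℚ
  sum-F z = begin
    sumℚ {t} (λ ℓ → F z (idx ℓ))
      ≡⟨ Sumℚ.∑-comm {t} {t} (λ ℓ j → (h ℚ.- ι (idx j)) ℚ.* z ⟦ idx j ℤ.+ idx ℓ ⟧) ⟩
    sumℚ {t} (λ j → sumℚ {t} (λ ℓ → (h ℚ.- ι (idx j)) ℚ.* z ⟦ idx j ℤ.+ idx ℓ ⟧))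
      ≡⟨ Sumℚ.sum-cong-≗ {t} (λ j → trans
           (sym (SumSemiringℚ.*-distribˡ-sum {t} (h ℚ.- ι (idx j)) (λ ℓ → z ⟦ idx j ℤ.+ idx ℓ ⟧)))
           (cong (λ x → (h ℚ.- ι (idx j)) ℚ.* x) (trans
             (Sumℚ.sum-cong-≗ {t} λ ℓ → cong (λ i → z ⟦ i ⟧) (ℤₚ.+-comm (idx j) (idx ℓ)))
             (sum-shift (idx j) z)))) ⟩
    sumℚ {t} (λ j → (h ℚ.- ι (idx j)) ℚ.* sumℚ z)
      ≡⟨ SumSemiringℚ.*-distribʳ-sum {t} (sumℚ z) (λ j → h ℚ.- ι (idx j)) ⟨
    sumℚ {t} (λ j → h ℚ.- ι (idx j)) ℚ.* sumℚ z ≡⟨ cong (ℚ._* sumℚ z) sum-centred ⟩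
    0ℚ ℚ.* sumℚ z                               ≡⟨ ℚₚ.*-zeroˡ (sumℚ z) ⟩
    0ℚ ∎

  -- The composite in the other order. The constant S meets weights of total zero and disappears;
  -- the rest is q times `cyclic-abel`.
  F-weights : ∀ (x : Vector ℚ t) S ℓ →
    F (λ j → q ℚ.* (x ⟦ idx j ⟧ ℚ.- (x ⟦ idx j ℤ.+ 1ℤ ⟧ ℚ.- S))) ℓ ≡ x ⟦ ℓ ⟧ ℚ.- q ℚ.* sumℚ x
  F-weights x S ℓ = begin
    F (λ j → q ℚ.* (x ⟦ idx j ⟧ ℚ.- (x ⟦ idx j ℤ.+ 1ℤ ⟧ ℚ.- S))) ℓ
      ≡⟨ Sumℚ.sum-cong-≗ {t} (λ j → trans
           (cong₂ (λ a b → (h ℚ.- ι (idx j)) ℚ.* (q ℚ.* (a ℚ.- (b ℚ.- S))))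
             (⟦⟧-cong x (idx-residue t (idx j ℤ.+ ℓ)))
             (⟦⟧-cong x (mod-trans (mod-+ (idx-residue t (idx j ℤ.+ ℓ)) (mod-refl {a = 1ℤ})) (mod-reflexive (ℤₚ.+-assoc (idx j) ℓ 1ℤ)))))
           (solve 5 (λ c q a b S → c :* (q :* (a :- (b :- S))) := q :* (c :* (a :- b)) :+ c :* (q :* S)) refl
             (h ℚ.- ι (idx j)) q (x ⟦ idx j ℤ.+ ℓ ⟧) (x ⟦ idx j ℤ.+ (ℓ ℤ.+ 1ℤ) ⟧) S)) ⟩
    sumℚ {t} (λ j → q ℚ.* α j ℚ.+ (h ℚ.- ι (idx j)) ℚ.* (q ℚ.* S))
      ≡⟨ Sumℚ.∑-distrib-+ {t} (λ j → q ℚ.* α j) _ ⟩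
    sumℚ {t} (λ j → q ℚ.* α j) ℚ.+ sumℚ {t} (λ j → (h ℚ.- ι (idx j)) ℚ.* (q ℚ.* S))
      ≡⟨ cong₂ ℚ._+_ (sym (SumSemiringℚ.*-distribˡ-sum {t} q α))
           (sym (SumSemiringℚ.*-distribʳ-sum {t} (q ℚ.* S) (λ j → h ℚ.- ι (idx j)))) ⟩
    q ℚ.* sumℚ {t} α ℚ.+ sumℚ {t} (λ j → h ℚ.- ι (idx j)) ℚ.* (q ℚ.* S)
      ≡⟨ cong₂ (λ a b → q ℚ.* a ℚ.+ b ℚ.* (q ℚ.* S)) (cyclic-abel x ℓ) sum-centred ⟩
    q ℚ.* (T ℚ.* x ⟦ ℓ ⟧ ℚ.- sumℚ x) ℚ.+ 0ℚ ℚ.* (q ℚ.* S)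
      ≡⟨ solve 5 (λ q T y s S → q :* (T :* y :- s) :+ con 0ℚ :* (q :* S) := (q :* T) :* y :- q :* s) refl q T (x ⟦ ℓ ⟧) (sumℚ x) S ⟩
    (q ℚ.* T) ℚ.* x ⟦ ℓ ⟧ ℚ.- q ℚ.* sumℚ x
      ≡⟨ cong (λ a → a ℚ.- q ℚ.* sumℚ x) (trans (cong (ℚ._* x ⟦ ℓ ⟧) qT≡1) (ℚₚ.*-identityˡ (x ⟦ ℓ ⟧))) ⟩
    x ⟦ ℓ ⟧ ℚ.- q ℚ.* sumℚ x ∎
    where
    α : Fin t → ℚ
    α j = (h ℚ.- ι (idx j)) ℚ.* (x ⟦ idx j ℤ.+ ℓ ⟧ ℚ.- x ⟦ idx j ℤ.+ (ℓ ℤ.+ 1ℤ) ⟧)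

  sum-constant : ∀ n x → sumℚ {n} (λ _ → x) ≡ ι (+ n) ℚ.* x
  sum-constant zero    x = sym (ℚₚ.*-zeroˡ x)
  sum-constant (suc n) x = trans (cong (λ y → x ℚ.+ y) (sum-constant n x))
    (trans (solve 2 (λ m x → x :+ m :* x := (con 1ℚ :+ m) :* x) refl (ι (+ n)) x)
      (cong (ℚ._* x) (sym (ι-suc n))))

  -- The differences of consecutive entries cancel around the cycle and leave t copies of q S.
  sum-weights : ∀ (x : Vector ℚ t) S →
    sumℚ {t} (λ j → q ℚ.* (x ⟦ idx j ⟧ ℚ.- (x ⟦ idx j ℤ.+ 1ℤ ⟧ ℚ.- S))) ≡ S
  sum-weights x S = begin
    sumℚ {t} (λ j → q ℚ.* (x ⟦ idx j ⟧ ℚ.- (x ⟦ idx j ℤ.+ 1ℤ ⟧ ℚ.- S)))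
      ≡⟨ Sumℚ.sum-cong-≗ {t} (λ j → trans
           (solve 4 (λ q a b S → q :* (a :- (b :- S)) := q :* a :+ (:- q :* b :+ q :* S)) refl
             q (x ⟦ idx j ⟧) (x ⟦ idx j ℤ.+ 1ℤ ⟧) S)
           (cong (λ y → q ℚ.* y ℚ.+ (ℚ.- q ℚ.* x ⟦ idx j ℤ.+ 1ℤ ⟧ ℚ.+ q ℚ.* S)) (⟦idx⟧ x j))) ⟩
    sumℚ {t} (λ j → q ℚ.* x j ℚ.+ (ℚ.- q ℚ.* x ⟦ idx j ℤ.+ 1ℤ ⟧ ℚ.+ q ℚ.* S))
      ≡⟨ trans (Sumℚ.∑-distrib-+ {t} (λ j → q ℚ.* x j) _)
           (cong (λ y → sumℚ {t} (λ j → q ℚ.* x j) ℚ.+ y) (Sumℚ.∑-distrib-+ {t} (λ j → ℚ.- q ℚ.* x ⟦ idx j ℤ.+ 1ℤ ⟧) _)) ⟩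
    sumℚ {t} (λ j → q ℚ.* x j) ℚ.+ (sumℚ {t} (λ j → ℚ.- q ℚ.* x ⟦ idx j ℤ.+ 1ℤ ⟧) ℚ.+ sumℚ {t} (λ _ → q ℚ.* S))
      ≡⟨ cong₂ ℚ._+_ (sym (SumSemiringℚ.*-distribˡ-sum {t} q x)) (cong₂ ℚ._+_
           (trans (sym (SumSemiringℚ.*-distribˡ-sum {t} (ℚ.- q) (λ j → x ⟦ idx j ℤ.+ 1ℤ ⟧)))
             (cong (λ y → ℚ.- q ℚ.* y) (sum-shift 1ℤ x)))
           (sum-constant t (q ℚ.* S))) ⟩
    q ℚ.* sumℚ x ℚ.+ (ℚ.- q ℚ.* sumℚ x ℚ.+ T ℚ.* (q ℚ.* S))
      ≡⟨ solve 4 (λ q T s S → q :* s :+ (:- q :* s :+ T :* (q :* S)) := (q :* T) :* S) refl q T (sumℚ x) S ⟩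
    (q ℚ.* T) ℚ.* S ≡⟨ trans (cong (ℚ._* S) qT≡1) (ℚₚ.*-identityˡ S) ⟩
    S ∎

-- The change of variables

module _ {A B : Set} {_≈₁_ : Rel A 0ℓ} {_≈₂_ : Rel B 0ℓ}
  (eq₁ : IsEquivalence _≈₁_) (eq₂ : IsEquivalence _≈₂_) where

  private
    module E₁ = IsEquivalence eq₁
    module E₂ = IsEquivalence eq₂

    on-equivalence : ∀ {D : Set} {_≈_ : Rel D 0ℓ} {P : Pred D 0ℓ} → IsEquivalence _≈_ →
      IsEquivalence {A = ∃ P} (_≈_ on proj₁)
    on-equivalence e = record { refl = E.refl ; sym = E.sym ; trans = E.trans }
      where module E = IsEquivalence e

  bijectionOn : ∀ {f : A → B} {P : Pred A 0ℓ} {Q : Pred B 0ℓ} →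
    (∀ {x y} → P x → P y → x ≈₁ y → f x ≈₂ f y) →
    (∀ {x} → P x → Q (f x)) →
    (∀ {x y} → P x → P y → f x ≈₂ f y → x ≈₁ y) →
    (∀ {y} → Q y → ∃[ x ] P x × f x ≈₂ y) →
    BijectionOn _≈₁_ _≈₂_ f P Q
  bijectionOn f-cong f-maps f-inj f-surj = f-maps , record
    { isInjection = record
      { isCongruent = record
        { cong           = λ {x} {y} → f-cong (proj₂ x) (proj₂ y)
        ; isEquivalence₁ = on-equivalence eq₁
        ; isEquivalence₂ = on-equivalence eq₂
        }
      ; injective = λ {x} {y} → f-inj (proj₂ x) (proj₂ y)
      }
    ; surjective = λ (y , Qy) → let x , Px , fx≈y = f-surj Qy in
        (x , Px) , λ {z} z≈x → E₂.trans (f-cong (proj₂ z) Px z≈x) fx≈y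
    }

  -- Injectivity is inherited, and surjectivity onto Q′ only needs the preimage already found in P
  -- to lie in P′. The condition is stated for `f x ≈₂ y` with y in Q′, so Q′ need not be shown
  -- invariant under `_≈₂_`.
  restrict : ∀ {f : A → B} {P P′ : Pred A 0ℓ} {Q Q′ : Pred B 0ℓ} →
    BijectionOn _≈₁_ _≈₂_ f P Q →
    (∀ {x} → P′ x → P x) → (∀ {y} → Q′ y → Q y) →
    (∀ {x} → P′ x → Q′ (f x)) →
    (∀ {x y} → P x → f x ≈₂ y → Q′ y → P′ x) →
    BijectionOn _≈₁_ _≈₂_ f P′ Q′
  restrict (_ , bij) P′⊆P Q′⊆Q maps reflects = bijectionOn
    (λ p p′ → Bij.cong {x = _ , P′⊆P p} {y = _ , P′⊆P p′})
    maps
    (λ p p′ → Bij.injective {x = _ , P′⊆P p} {y = _ , P′⊆P p′})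
    (λ q → let (x , p) , fx = Bij.surjective (_ , Q′⊆Q q) in
      x , reflects p (fx {x , p} E₁.refl) q , fx {x , p} E₁.refl)
    where module Bij = IsBijection bij

≋-equivalence : ∀ {t} → IsEquivalence (_≋_ {t})
≋-equivalence = record
  { refl  = λ {x} i → unlim (≃-refl {seq (x i)})
  ; sym   = λ {x} {y} p i → unlim (≃-sym {seq (x i)} {seq (y i)} (lim (p i)))
  ; trans = λ {x} {y} {z} p q i → unlim (≃-trans {seq (x i)} {seq (y i)} {seq (z i)} (lim (p i)) (lim (q i)))
  }

2*nC2 : ∀ n → 2 ℕ.* (n C 2) ≡ n ℕ.* (n ℕ.∸ 1)
2*nC2 zero          = refl
2*nC2 (suc zero)    = refl
2*nC2 (suc (suc n)) = begin
  2 ℕ.* (suc (suc n) C 2)                     ≡⟨ cong (2 ℕ.*_) (sym (nCk+nC[k+1]≡[n+1]C[k+1] (suc n) 1)) ⟩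
  2 ℕ.* ((suc n C 1) ℕ.+ (suc n C 2))         ≡⟨ ℕₚ.*-distribˡ-+ 2 (suc n C 1) (suc n C 2) ⟩
  2 ℕ.* (suc n C 1) ℕ.+ 2 ℕ.* (suc n C 2)     ≡⟨ cong₂ (λ a b → 2 ℕ.* a ℕ.+ b) (nC1≡n (suc n)) (2*nC2 (suc n)) ⟩
  2 ℕ.* suc n ℕ.+ suc n ℕ.* n                 ≡⟨ cong (ℕ._+ suc n ℕ.* n) (ℕₚ.*-comm 2 (suc n)) ⟩
  suc n ℕ.* 2 ℕ.+ suc n ℕ.* n                 ≡⟨ sym (ℕₚ.*-distribˡ-+ (suc n) 2 n) ⟩
  suc n ℕ.* suc (suc n)                       ≡⟨ ℕₚ.*-comm (suc n) (suc (suc n)) ⟩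
  suc (suc n) ℕ.* suc n ∎
  where open ≡-Reasoning

-- If s + 1 and t - 1 were both odd, 2 would divide both s and t.
2*shift : ∀ s t .{{_ : NonZero t}} → Coprime s t → 2 ℕ.* shift s t ≡ suc s ℕ.* (t ℕ.∸ 1)
2*shift s (suc t) cop = ℕ/.m*[n/m]≡n (even s t cop)
  where
  parity : ∀ n → 2 ℕ∣.∣ n ⊎ 2 ℕ∣.∣ suc n
  parity zero    = inj₁ (ℕ∣.divides 0 refl)
  parity (suc n) with parity n
  ... | inj₁ 2∣n = inj₂ (ℕ∣.∣m∣n⇒∣m+n (ℕ∣.∣-refl {2}) 2∣n)
  ... | inj₂ 2∣1+n = inj₁ 2∣1+n
  even : ∀ s t → Coprime s (suc t) → 2 ℕ∣.∣ suc s ℕ.* t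
  even s t cop with parity t | parity s
  ... | inj₁ 2∣t   | _          = ℕ∣.∣n⇒∣m*n (suc s) 2∣t
  ... | inj₂ _     | inj₂ 2∣1+s = ℕ∣.∣m⇒∣m*n t 2∣1+s
  ... | inj₂ 2∣1+t | inj₁ 2∣s   with cop (2∣s , 2∣1+t)
  ... | ()

≈ℝ-sum : ∀ {k} (x : ℝ) (f : Vector ℝ k) → x ≈ℝ sumℝ f → seq x ≃ (λ n → sumℚ {k} (λ i → seq (f i) n))
≈ℝ-sum x f x≈ = ≃-trans {g = seq (sumℝ f)} (lim x≈) (pointwise (seq-sum f))

≈ℝ-sum⁻¹ : ∀ {k} (x : ℝ) (f : Vector ℝ k) → seq x ≃ (λ n → sumℚ {k} (λ i → seq (f i) n)) → x ≈ℝ sumℝ f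
≈ℝ-sum⁻¹ x f x≃ = unlim (≃-trans {g = λ n → sumℚ (λ i → seq (f i) n)} {seq (sumℝ f)} x≃ (pointwise λ n → sym (seq-sum f n)))

module Coordinates (s t : ℕ) .{{_ : NonZero t}} (cop : Coprime s t) where

  open Cyclic t

  k v : ℤ
  k = + shift s t
  v = proj₁ (coprime-inverse s t cop)

  sv≡1 : + s ℤ.* v ≅ 1ℤ [ t ]
  sv≡1 = proj₂ (coprime-inverse s t cop)

  S : ℚ
  S = ι (+ s)

  -- The class ℓ(i) with k + ℓ(i) s ≡ i.
  position : ℤ → ℤ
  position i = v ℤ.* (i ℤ.- k)

  at-position : ∀ i → + s ℤ.* position i ℤ.+ k ≅ i [ t ]
  at-position i = mod-trans (mod-reflexive (regroup (+ s) v i k))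
    (mod-trans (mod-+ (mod-*ˡ (i ℤ.- k) sv≡1) (mod-refl {a = k})) (mod-reflexive (cancel i k)))
    where
    regroup : ∀ s v i k → s ℤ.* (v ℤ.* (i ℤ.- k)) ℤ.+ k ≡ (i ℤ.- k) ℤ.* (s ℤ.* v) ℤ.+ k
    regroup = solve-∀
    cancel : ∀ i k → (i ℤ.- k) ℤ.* 1ℤ ℤ.+ k ≡ i
    cancel = solve-∀

  position-of : ∀ ℓ → position (+ s ℤ.* ℓ ℤ.+ k) ≅ ℓ [ t ]
  position-of ℓ = mod-trans (mod-reflexive (regroup (+ s) v ℓ k))
    (mod-trans (mod-*ˡ ℓ sv≡1) (mod-reflexive (ℤₚ.*-identityʳ ℓ)))
    where
    regroup : ∀ s v ℓ k → v ℤ.* (s ℤ.* ℓ ℤ.+ k ℤ.- k) ≡ ℓ ℤ.* (s ℤ.* v)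
    regroup = solve-∀

  along-cong : ∀ {i j} → i ≅ j [ t ] → + s ℤ.* i ℤ.+ k ≅ + s ℤ.* j ℤ.+ k [ t ]
  along-cong p = mod-+ (mod-*ˡ (+ s) p) (mod-refl {a = k})

  along : ∀ {A : Set} → Vector A t → Vector A t
  along a j = a ⟦ + s ℤ.* idx j ℤ.+ k ⟧

  along-⟦⟧ : ∀ {A : Set} (a : Vector A t) i → along a ⟦ i ⟧ ≡ a ⟦ + s ℤ.* i ℤ.+ k ⟧
  along-⟦⟧ a i = ⟦⟧-cong a (along-cong (idx-residue t i))

  at : Vector ℝ t → ℕ → Vector ℚ t
  at a n i = seq (a i) n

  sum-along : ∀ x → sumℚ {t} (along x) ≡ sumℚ x
  sum-along x = sum-affine {+ s} {v} k sv≡1 x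

  toZ-along : ∀ a j n → seq (toZ s t a j) n ≡
    q ℚ.* (along (at a n) ⟦ idx j ⟧ ℚ.- (along (at a n) ⟦ idx j ℤ.+ 1ℤ ⟧ ℚ.- S))
  toZ-along a j n = cong₂ (λ x y → q ℚ.* (x ℚ.- (y ℚ.- S)))
    (sym (along-⟦⟧ (at a n) (idx j))) (sym (along-⟦⟧ (at a n) (idx j ℤ.+ 1ℤ)))

  -- The A-hyperplane thus consists of the points whose coordinates have mean h, the constant
  -- subtracted in the inverse formula.
  T*h≡C : T ℚ.* h ≡ ι (+ (t C 2))
  T*h≡C = 2≢0-cancel (begin
    ι (+ 2) ℚ.* (T ℚ.* h)         ≡⟨ solve 3 (λ a T h → a :* (T :* h) := T :* (a :* h)) refl (ι (+ 2)) T h ⟩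
    T ℚ.* (ι (+ 2) ℚ.* h)         ≡⟨ cong (T ℚ.*_) 2h≡T-1 ⟩
    T ℚ.* (T ℚ.- 1ℚ)              ≡⟨ cong (T ℚ.*_) (sym ι[t∸1]≡T-1) ⟩
    T ℚ.* ι (+ (t ℕ.∸ 1))         ≡⟨ sym (trans (cong ι (ℤₚ.pos-* t (t ℕ.∸ 1))) (ι-* (+ t) (+ (t ℕ.∸ 1)))) ⟩
    ι (+ (t ℕ.* (t ℕ.∸ 1)))       ≡⟨ cong (λ n → ι (+ n)) (sym (2*nC2 t)) ⟩
    ι (+ (2 ℕ.* (t C 2)))         ≡⟨ trans (cong ι (ℤₚ.pos-* 2 (t C 2))) (ι-* (+ 2) (+ (t C 2))) ⟩
    ι (+ 2) ℚ.* ι (+ (t C 2)) ∎)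
    where open ≡-Reasoning

  q*C≡h : q ℚ.* ι (+ (t C 2)) ≡ h
  q*C≡h = trans (cong (q ℚ.*_) (sym T*h≡C)) (trans (sym (ℚₚ.*-assoc q T h))
    (trans (cong (ℚ._* h) qT≡1) (ℚₚ.*-identityˡ h)))

  F-cong : ∀ {x y : ℕ → Vector ℚ t} → (∀ j → (λ n → x n j) ≃ (λ n → y n j)) →
    ∀ ℓ → (λ n → F (x n) ℓ) ≃ (λ n → F (y n) ℓ)
  F-cong x≃y ℓ = sum-cong {t} λ j → *-congˡ (h ℚ.- ι (idx j)) (x≃y (residue t (idx j ℤ.+ ℓ)))

  inverse-index : ∀ ℓ → k ℤ.+ ℓ ℤ.* + s ≡ + s ℤ.* ℓ ℤ.+ k
  inverse-index ℓ = lemma k ℓ (+ s)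
    where
    lemma : ∀ k ℓ s → k ℤ.+ ℓ ℤ.* s ≡ s ℤ.* ℓ ℤ.+ k
    lemma = solve-∀

  inverse-formula : ∀ a z → HyperplaneA s t a → toZ s t a ≋ z → InverseFormula s t a z
  inverse-formula a z Σa≈C toZa≋z ℓ = ≈ℝ-sum⁻¹ {t} (a ⟦ k ℤ.+ idx ℓ ℤ.* + s ⟧ -ℝ fromℚ h) _ (
    (λ n → seq (a ⟦ k ℤ.+ idx ℓ ℤ.* + s ⟧) n ℚ.- h)
      ≃⟨ pointwise (λ n → cong₂ (λ x y → x ℚ.- y)
           (trans (cong (λ i → at a n ⟦ i ⟧) (inverse-index (idx ℓ))) (sym (along-⟦⟧ (at a n) (idx ℓ)))) (sym q*C≡h)) ⟩
    (λ n → along (at a n) ⟦ idx ℓ ⟧ ℚ.- q ℚ.* ι (+ (t C 2)))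
      -- The hyperplane equation is spent here: h, as q times C(t,2), is traded for q times the
      -- actual coordinate sum, after which `F-weights` applies exactly at each index.
      ≃⟨ +-cong {f = λ n → along (at a n) ⟦ idx ℓ ⟧} ≃-refl (neg-cong (*-congˡ q (≃-sym {f = seq (sumℝ a)} (lim Σa≈C)))) ⟩
    (λ n → along (at a n) ⟦ idx ℓ ⟧ ℚ.- q ℚ.* seq (sumℝ a) n)
      ≃⟨ pointwise (λ n → cong (λ x → along (at a n) ⟦ idx ℓ ⟧ ℚ.- q ℚ.* x)
           (trans (seq-sum a n) (sym (sum-along (at a n))))) ⟩
    (λ n → along (at a n) ⟦ idx ℓ ⟧ ℚ.- q ℚ.* sumℚ (along (at a n)))
      ≃⟨ pointwise (λ n → sym (F-weights (along (at a n)) S (idx ℓ))) ⟩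
    (λ n → F (λ j → q ℚ.* (along (at a n) ⟦ idx j ⟧ ℚ.- (along (at a n) ⟦ idx j ℤ.+ 1ℤ ⟧ ℚ.- S))) (idx ℓ))
      ≃⟨ F-cong (λ j → ≃-trans (pointwise (λ n → sym (toZ-along a j n))) (lim (toZa≋z j))) (idx ℓ) ⟩
    (λ n → F (at z n) (idx ℓ)) ∎≃)
    where open ≃-Reasoning

  solved : ∀ a z → InverseFormula s t a z → ∀ i → (λ n → along (at a n) ⟦ i ⟧) ≃ (λ n → F (at z n) i ℚ.+ h)
  solved a z formula i =
    (λ n → along (at a n) ⟦ i ⟧)
      ≃⟨ pointwise (λ n → trans (cong (λ j → at a n ⟦ j ⟧) (sym (inverse-index (idx ℓ))))
           (solve 2 (λ x h → x := (x :- h) :+ h) refl (at a n ⟦ k ℤ.+ idx ℓ ℤ.* + s ⟧) h)) ⟩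
    (λ n → (at a n ⟦ k ℤ.+ idx ℓ ℤ.* + s ⟧ ℚ.- h) ℚ.+ h)
      ≃⟨ +-cong (≈ℝ-sum {t} (a ⟦ k ℤ.+ idx ℓ ℤ.* + s ⟧ -ℝ fromℚ h) _ (formula ℓ)) (≃-refl {f = λ _ → h}) ⟩
    (λ n → F (at z n) (idx ℓ) ℚ.+ h)
      ≃⟨ pointwise (λ n → cong (ℚ._+ h) (F-cong-mod (at z n) (idx-residue t i))) ⟩
    (λ n → F (at z n) i ℚ.+ h) ∎≃
    where
    open ≃-Reasoning
    ℓ = residue t i

  from-inverse-formula : ∀ a z → HyperplaneZ s t z → InverseFormula s t a z →
    HyperplaneA s t a × toZ s t a ≋ z
  from-inverse-formula a z Σz≈s formula = unlim hyperplane , λ j → unlim (coordinate j)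
    where
    open ≃-Reasoning
    hyperplane : seq (sumℝ a) ≃ (λ _ → ι (+ (t C 2)))
    hyperplane =
      seq (sumℝ a)
        ≃⟨ pointwise (λ n → trans (seq-sum a n) (sym (sum-along (at a n)))) ⟩
      (λ n → sumℚ (along (at a n)))
        ≃⟨ pointwise (λ n → Sumℚ.sum-cong-≗ {t} λ j → sym (⟦idx⟧ (along (at a n)) j)) ⟩
      (λ n → sumℚ {t} (λ j → along (at a n) ⟦ idx j ⟧))
        ≃⟨ sum-cong {t} (λ j → solved a z formula (idx j)) ⟩
      (λ n → sumℚ {t} (λ j → F (at z n) (idx j) ℚ.+ h))
        ≃⟨ pointwise (λ n → trans (Sumℚ.∑-distrib-+ {t} (λ j → F (at z n) (idx j)) (λ _ → h))
             (trans (cong₂ ℚ._+_ (sum-F (at z n)) (sum-constant t h)) (trans (ℚₚ.+-identityˡ (T ℚ.* h)) T*h≡C))) ⟩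
      (λ _ → ι (+ (t C 2))) ∎≃
    coordinate : ∀ j → seq (toZ s t a j) ≃ seq (z j)
    coordinate j =
      seq (toZ s t a j)
        ≃⟨ pointwise (toZ-along a j) ⟩
      (λ n → q ℚ.* (along (at a n) ⟦ idx j ⟧ ℚ.- (along (at a n) ⟦ idx j ℤ.+ 1ℤ ⟧ ℚ.- S)))
        ≃⟨ *-congˡ q (+-cong (solved a z formula (idx j)) (neg-cong (+-cong (solved a z formula (idx j ℤ.+ 1ℤ)) (≃-refl {f = λ _ → ℚ.- S})))) ⟩
      (λ n → q ℚ.* ((F (at z n) (idx j) ℚ.+ h) ℚ.- ((F (at z n) (idx j ℤ.+ 1ℤ) ℚ.+ h) ℚ.- S)))
        ≃⟨ pointwise (λ n → cong (q ℚ.*_) (trans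
             (solve 4 (λ x y h S → (x :+ h) :- ((y :+ h) :- S) := (x :- y) :+ S) refl
               (F (at z n) (idx j)) (F (at z n) (idx j ℤ.+ 1ℤ)) h S)
             (cong (ℚ._+ S) (trans (F-difference (at z n) (idx j)) (cong₂ (λ x y → T ℚ.* x ℚ.- y) (⟦idx⟧ (at z n) j) (sym (seq-sum z n))))))) ⟩
      (λ n → q ℚ.* ((T ℚ.* seq (z j) n ℚ.- seq (sumℝ z) n) ℚ.+ S))
        -- The equation Σ z = s makes the sum left over by `F-difference` cancel against `S`.
        ≃⟨ *-congˡ q (+-cong (+-cong (≃-refl {f = λ n → T ℚ.* seq (z j) n}) (neg-cong {f = seq (sumℝ z)} (lim Σz≈s))) (≃-refl {f = λ _ → S})) ⟩
      (λ n → q ℚ.* ((T ℚ.* seq (z j) n ℚ.- S) ℚ.+ S))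
        ≃⟨ pointwise (λ n → trans (solve 4 (λ q T S x → q :* ((T :* x :- S) :+ S) := (q :* T) :* x) refl q T S (seq (z j) n))
             (trans (cong (ℚ._* seq (z j) n) qT≡1) (ℚₚ.*-identityˡ (seq (z j) n)))) ⟩
      seq (z j) ∎≃

  toZ-cong : ∀ {a b} → a ≋ b → toZ s t a ≋ toZ s t b
  toZ-cong {a} {b} a≋b j = unlim (*-congˡ q (+-cong
    (lim {seq (a ⟦ i ⟧)} {seq (b ⟦ i ⟧)} (a≋b (residue t i)))
    (neg-cong (+-cong (lim {seq (a ⟦ i′ ⟧)} {seq (b ⟦ i′ ⟧)} (a≋b (residue t i′))) (≃-refl {λ _ → ℚ.- S})))))
    where
    i i′ : ℤ
    i  = + s ℤ.* idx j ℤ.+ k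
    i′ = + s ℤ.* (idx j ℤ.+ 1ℤ) ℤ.+ k

  toZ-hyperplane : ∀ a → HyperplaneZ s t (toZ s t a)
  toZ-hyperplane a = unlim (pointwise {seq (sumℝ (toZ s t a))} λ n → trans (seq-sum (toZ s t a) n)
    (trans (Sumℚ.sum-cong-≗ {t} λ j → toZ-along a j n) (sum-weights (along (at a n)) S)))

  determined : ∀ a b z → InverseFormula s t a z → InverseFormula s t b z → a ≋ b
  determined a b z formula formula′ i = unlim {seq (a i)} {seq (b i)} (
    seq (a i)
      ≃⟨ pointwise (along-position a) ⟩
    (λ n → along (at a n) ⟦ position (idx i) ⟧)
      ≃⟨ solved a z formula (position (idx i)) ⟩
    (λ n → F (at z n) (position (idx i)) ℚ.+ h)
      ≃⟨ ≃-sym (solved b z formula′ (position (idx i))) ⟩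
    (λ n → along (at b n) ⟦ position (idx i) ⟧)
      ≃⟨ pointwise (λ n → sym (along-position b n)) ⟩
    seq (b i) ∎≃)
    where
    open ≃-Reasoning
    along-position : ∀ a n → seq (a i) n ≡ along (at a n) ⟦ position (idx i) ⟧
    along-position a n = sym (trans (along-⟦⟧ (at a n) (position (idx i)))
      (trans (⟦⟧-cong (at a n) (at-position (idx i))) (⟦idx⟧ (at a n) i)))

  abstract

    -- The inverse formula solved for the coordinate of class i, which is class k + ℓ s for ℓ =
    -- `position (idx i)`. Only its entries, as given by `seq-fromZ`, are used.
    fromZ : Vector ℝ t → Vector ℝ t
    fromZ z i = sumℝ {t} (λ j → fromℚ (h ℚ.- ι (idx j)) *ℝ z ⟦ idx j ℤ.+ position (idx i) ⟧) +ℝ fromℚ h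

    seq-fromZ : ∀ z i n → seq (fromZ z i) n ≡ F (at z n) (position (idx i)) ℚ.+ h
    seq-fromZ z i n = cong (ℚ._+ h) (seq-sum {t} _ n)

  fromZ-formula : ∀ z → InverseFormula s t (fromZ z) z
  fromZ-formula z ℓ = ≈ℝ-sum⁻¹ {t} (fromZ z ⟦ k ℤ.+ idx ℓ ℤ.* + s ⟧ -ℝ fromℚ h) _
    (pointwise λ n → trans (cong (ℚ._- h) (seq-fromZ z i n))
      (trans (solve 2 (λ x h → x :+ h :- h := x) refl (F (at z n) (position (idx i))) h)
        (F-cong-mod (at z n) back)))
    where
    i : Fin t
    i = residue t (k ℤ.+ idx ℓ ℤ.* + s)
    back : position (idx i) ≅ idx ℓ [ t ]
    back = mod-trans (mod-*ˡ v (mod-- (mod-trans (idx-residue t (k ℤ.+ idx ℓ ℤ.* + s)) (mod-reflexive (inverse-index (idx ℓ)))) (mod-refl {a = k})))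
      (position-of (idx ℓ))

  bijection-hyperplanes : BijectionOn _≋_ _≋_ (toZ s t) (HyperplaneA s t) (HyperplaneZ s t)
  bijection-hyperplanes = bijectionOn ≋-equivalence ≋-equivalence {toZ s t} {HyperplaneA s t} {HyperplaneZ s t}
    (λ {a} {b} _ _ → toZ-cong {a} {b})
    (λ {a} _ → toZ-hyperplane a)
    (λ {a} {b} pa pb e → determined a b (toZ s t b) (inverse-formula a (toZ s t b) pa e)
      (inverse-formula b (toZ s t b) pb (IsEquivalence.refl ≋-equivalence {toZ s t b})))
    (λ {z} pz → fromZ z , from-inverse-formula (fromZ z) z pz (fromZ-formula z))

  inverse : ∀ a z → HyperplaneZ s t z → (HyperplaneA s t a × toZ s t a ≋ z) ⇔ InverseFormula s t a z
  inverse a z pz = mk⇔ (λ (pa , e) → inverse-formula a z pa e) (from-inverse-formula a z pz)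

  affine-toZ : AffineOn (HyperplaneA s t) (toZ s t)
  affine-toZ r x y _ _ j = unlim (pointwise λ n →
    solve 7 (λ q r a b c d S →
      q :* (((con 1ℚ :- r) :* a :+ r :* b) :- (((con 1ℚ :- r) :* c :+ r :* d) :- S))
        := (con 1ℚ :- r) :* (q :* (a :- (c :- S))) :+ r :* (q :* (b :- (d :- S)))) refl
      q (seq r n) (seq (x ⟦ i ⟧) n) (seq (y ⟦ i ⟧) n) (seq (x ⟦ i′ ⟧) n) (seq (y ⟦ i′ ⟧) n) S)
    where
    i i′ : ℤ
    i  = + s ℤ.* idx j ℤ.+ k
    i′ = + s ℤ.* (idx j ℤ.+ 1ℤ) ℤ.+ k

  private
    instance
      q⁺ : ℚ.Positive q
      q⁺ = ℚₚ.normalize-pos 1 t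
      T⁺ : ℚ.Positive T
      T⁺ = ℚₚ.normalize-pos t 1

  -- The simplices

  next-index : ∀ i → + s ℤ.* i ℤ.+ k ℤ.+ + s ≡ + s ℤ.* (i ℤ.+ 1ℤ) ℤ.+ k
  next-index i = lemma (+ s) i k
    where
    lemma : ∀ s i k → s ℤ.* i ℤ.+ k ℤ.+ s ≡ s ℤ.* (i ℤ.+ 1ℤ) ℤ.+ k
    lemma = solve-∀

  -- With i = s j + k one has i + s = s (j + 1) + k, so z_j is q times the slack of the inequality
  -- at i.
  simplex-maps : ∀ a → SimplexA s t a → SimplexZ s t (toZ s t a)
  simplex-maps a (pa , inequalities) = toZ-hyperplane a , λ j →
    let i = residue t (+ s ℤ.* idx j ℤ.+ k)
        next = mod-trans (mod-+ (idx-residue t (+ s ℤ.* idx j ℤ.+ k)) (mod-refl {a = + s})) (mod-reflexive (next-index (idx j)))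
    in 0≤scaled-difference q T qT≡1
      {λ n → seq (a ⟦ + s ℤ.* (idx j ℤ.+ 1ℤ) ℤ.+ k ⟧) n ℚ.- S} {seq (a i)}
      (subst (λ x → (λ n → seq x n ℚ.- S) ≲ seq (a i)) (⟦⟧-cong a next) (inequalities i))

  simplex-reflects : ∀ a z → HyperplaneA s t a → toZ s t a ≋ z → SimplexZ s t z → SimplexA s t a
  simplex-reflects a z pa toZa≋z (_ , nonneg) = pa , λ i →
    let j = residue t (position (idx i))
        at-j : + s ℤ.* idx j ℤ.+ k ≅ idx i [ t ]
        at-j = mod-trans (along-cong (idx-residue t (position (idx i)))) (at-position (idx i))
        at-j+1 : + s ℤ.* (idx j ℤ.+ 1ℤ) ℤ.+ k ≅ idx i ℤ.+ + s [ t ]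
        at-j+1 = mod-trans (mod-reflexive (sym (next-index (idx j)))) (mod-+ at-j (mod-refl {a = + s}))
    in subst₂ (λ x y → (λ n → seq x n ℚ.- S) ≲ seq y) (⟦⟧-cong a at-j+1) (trans (⟦⟧-cong a at-j) (⟦idx⟧ a i))
      (scaled-difference⁻¹ q T qT≡1
        {λ n → seq (a ⟦ + s ℤ.* (idx j ℤ.+ 1ℤ) ℤ.+ k ⟧) n ℚ.- S} {seq (a ⟦ + s ℤ.* idx j ℤ.+ k ⟧)}
        (≲-trans {λ _ → 0ℚ} {seq (z j)} {seq (toZ s t a j)} (nonneg j) (≃⇒≲ (≃-sym {seq (toZ s t a j)} (lim (toZa≋z j))))))

  bijection-simplices : BijectionOn _≋_ _≋_ (toZ s t) (SimplexA s t) (SimplexZ s t)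
  bijection-simplices = restrict ≋-equivalence ≋-equivalence
    {toZ s t} {HyperplaneA s t} {SimplexA s t} {HyperplaneZ s t} {SimplexZ s t} bijection-hyperplanes proj₁ proj₁
    (λ {a} → simplex-maps a) (λ {a} {z} → simplex-reflects a z)

  -- Integer points and congruences

  -- The integer point with coordinates m has entry corner m ℓ at the class k + ℓ s.
  corner : Vector ℤ t → ℤ → ℤ
  corner m ℓ = k ℤ.- sumℤ {t} (λ j → idx j ℤ.* m ⟦ idx j ℤ.+ ℓ ⟧)

  corner-cong : ∀ m {ℓ ℓ′} → ℓ ≅ ℓ′ [ t ] → corner m ℓ ≡ corner m ℓ′
  corner-cong m p = cong (λ x → k ℤ.- x) (sumℤ-cong {t} λ j →
    cong (λ x → idx j ℤ.* x) (⟦⟧-cong m (mod-+ (mod-refl {a = idx j}) p)))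

  ιk≡h*[1+S] : ι k ≡ h ℚ.* (1ℚ ℚ.+ S)
  ιk≡h*[1+S] = 2≢0-cancel (begin
    ι (+ 2) ℚ.* ι k                      ≡⟨ trans (sym (ι-* (+ 2) k)) (cong ι (sym (ℤₚ.pos-* 2 (shift s t)))) ⟩
    ι (+ (2 ℕ.* shift s t))              ≡⟨ cong (λ n → ι (+ n)) (2*shift s t cop) ⟩
    ι (+ (suc s ℕ.* (t ℕ.∸ 1)))          ≡⟨ trans (cong ι (ℤₚ.pos-* (suc s) (t ℕ.∸ 1))) (ι-* (+ suc s) (+ (t ℕ.∸ 1))) ⟩
    ι (+ suc s) ℚ.* ι (+ (t ℕ.∸ 1))      ≡⟨ cong₂ ℚ._*_ (ι-suc s) (trans ι[t∸1]≡T-1 (sym 2h≡T-1)) ⟩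
    (1ℚ ℚ.+ S) ℚ.* (ι (+ 2) ℚ.* h)       ≡⟨ solve 3 (λ a h S → (con 1ℚ :+ S) :* (a :* h) := a :* (h :* (con 1ℚ :+ S))) refl (ι (+ 2)) h S ⟩
    ι (+ 2) ℚ.* (h ℚ.* (1ℚ ℚ.+ S)) ∎)
    where open ≡-Reasoning

  -- The constant part of the weights contributes h Σ m = h S; together with the added h this is h
  -- (1 + S) = k, so the possible halves disappear.
  F-integer : ∀ m → sumℚ {t} (λ j → ι (m j)) ≡ S → ∀ ℓ → F (λ j → ι (m j)) ℓ ℚ.+ h ≡ ι (corner m ℓ)
  F-integer m Σm≡S ℓ = begin
    F (λ j → ι (m j)) ℓ ℚ.+ h
      ≡⟨ cong (ℚ._+ h) (Sumℚ.sum-cong-≗ {t} λ j → trans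
           (solve 3 (λ h c x → (h :- c) :* x := h :* x :- c :* x) refl h (ι (idx j)) (ι (m ⟦ idx j ℤ.+ ℓ ⟧)))
           (cong (λ x → h ℚ.* ι (m ⟦ idx j ℤ.+ ℓ ⟧) ℚ.- x) (sym (ι-* (idx j) (m ⟦ idx j ℤ.+ ℓ ⟧))))) ⟩
    sumℚ {t} (λ j → h ℚ.* x j ℚ.- ι (y j)) ℚ.+ h
      ≡⟨ cong (ℚ._+ h) (sym (sum-- {t} (λ j → h ℚ.* x j) (λ j → ι (y j)))) ⟩
    sumℚ {t} (λ j → h ℚ.* x j) ℚ.- sumℚ {t} (λ j → ι (y j)) ℚ.+ h
      ≡⟨ cong₂ (λ a b → a ℚ.- b ℚ.+ h) (trans (sym (SumSemiringℚ.*-distribˡ-sum {t} h x))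
           (cong (h ℚ.*_) (trans (sum-shift ℓ (λ j → ι (m j))) Σm≡S))) (sym (ι-sum {t} y)) ⟩
    h ℚ.* S ℚ.- ι (sumℤ {t} y) ℚ.+ h
      ≡⟨ solve 3 (λ h S y → h :* S :- y :+ h := h :* (con 1ℚ :+ S) :- y) refl h S (ι (sumℤ {t} y)) ⟩
    h ℚ.* (1ℚ ℚ.+ S) ℚ.- ι (sumℤ {t} y)
      ≡⟨ trans (cong (ℚ._- ι (sumℤ {t} y)) (sym ιk≡h*[1+S])) (sym (ι-- k (sumℤ {t} y))) ⟩
    ι (corner m ℓ) ∎
    where
    open ≡-Reasoning
    x : Fin t → ℚ
    x j = ι (m ⟦ idx j ℤ.+ ℓ ⟧)
    y : Fin t → ℤ
    y j = idx j ℤ.* m ⟦ idx j ℤ.+ ℓ ⟧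

  integer-values : ∀ a z m → HyperplaneZ s t z → z ≋ (λ j → fromℤ (m j)) → InverseFormula s t a z →
    ∀ ℓ → (λ n → along (at a n) ⟦ ℓ ⟧) ≃ (λ _ → ι (corner m ℓ))
  integer-values a z m pz z≋m formula ℓ =
    (λ n → along (at a n) ⟦ ℓ ⟧)          ≃⟨ solved a z formula ℓ ⟩
    (λ n → F (at z n) ℓ ℚ.+ h)            ≃⟨ +-cong (F-cong {λ n → at z n} {λ _ j → ι (m j)} (λ j → lim (z≋m j)) ℓ) (≃-refl {λ _ → h}) ⟩
    (λ _ → F (λ j → ι (m j)) ℓ ℚ.+ h)     ≃⟨ pointwise (λ _ → F-integer m Σm≡S ℓ) ⟩
    (λ _ → ι (corner m ℓ)) ∎≃
    where
    open ≃-Reasoning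
    Σm≡S : sumℚ {t} (λ j → ι (m j)) ≡ S
    Σm≡S = constant-injective (
      (λ _ → sumℚ {t} (λ j → ι (m j)))    ≃⟨ ≃-sym (sum-cong {t} {λ j → seq (z j)} (λ j → lim (z≋m j))) ⟩
      (λ n → sumℚ {t} (λ j → seq (z j) n)) ≃⟨ pointwise (λ n → sym (seq-sum z n)) ⟩
      seq (sumℝ z)                         ≃⟨ lim pz ⟩
      (λ _ → S) ∎≃)

  -- Because of this value, the congruence in `LatticeZ` says exactly that the coordinate of class k
  -- is congruent to k.
  corner-zero : ∀ m → corner m 0ℤ ≡ k ℤ.- sumℤ {t} (λ j → idx j ℤ.* m j)
  corner-zero m = cong (λ x → k ℤ.- x) (sumℤ-cong {t} λ j → cong (λ x → idx j ℤ.* x)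
    (trans (cong (λ i → m ⟦ i ⟧) (ℤₚ.+-identityʳ (idx j))) (⟦idx⟧ m j)))

  lattice-maps : ∀ a → HyperplaneA s t a → LatticeA s t a → LatticeZ s t (toZ s t a)
  lattice-maps a pa (n , a≋n , n≡) = m , (λ j → unlim (toZa≃m j)) , unmod Σ≡0
    where
    open ≃-Reasoning
    entry : ∀ i → n ⟦ i ⟧ ≅ i [ t ]
    entry i = mod-trans (mod (n≡ (residue t i))) (idx-residue t i)
    numerator : Fin t → ℤ
    numerator j = n ⟦ + s ℤ.* idx j ℤ.+ k ⟧ ℤ.- (n ⟦ + s ℤ.* (idx j ℤ.+ 1ℤ) ℤ.+ k ⟧ ℤ.- + s)
    -- Each entry is congruent to its own class, and (s j + k) - (s (j + 1) + k - s) = 0.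
    divisible : ∀ j → numerator j ≅ 0ℤ [ t ]
    divisible j = mod-trans (mod-- (entry (+ s ℤ.* idx j ℤ.+ k)) (mod-- (entry (+ s ℤ.* (idx j ℤ.+ 1ℤ) ℤ.+ k)) (mod-refl {a = + s})))
      (mod-reflexive (lemma (+ s) (idx j) k))
      where
      lemma : ∀ s j k → s ℤ.* j ℤ.+ k ℤ.- (s ℤ.* (j ℤ.+ 1ℤ) ℤ.+ k ℤ.- s) ≡ 0ℤ
      lemma = solve-∀
    m : Vector ℤ t
    m j = _∣_.quotient (unmod (divisible j))
    numerator≡ : ∀ j → numerator j ≡ m j ℤ.* + t
    numerator≡ j = trans (sym (ℤₚ.+-identityʳ (numerator j))) (_∣_.equality (unmod (divisible j)))
    scaled : ∀ j → q ℚ.* (ι (n ⟦ + s ℤ.* idx j ℤ.+ k ⟧) ℚ.- (ι (n ⟦ + s ℤ.* (idx j ℤ.+ 1ℤ) ℤ.+ k ⟧) ℚ.- S)) ≡ ι (m j)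
    scaled j = trans (cong (q ℚ.*_) (trans (sym (trans (ι-- x (y ℤ.- + s)) (cong (λ w → ι x ℚ.- w) (ι-- y (+ s)))))
        (trans (cong ι (numerator≡ j)) (ι-* (m j) (+ t)))))
      (trans (solve 3 (λ q m T → q :* (m :* T) := (q :* T) :* m) refl q (ι (m j)) T)
        (trans (cong (ℚ._* ι (m j)) qT≡1) (ℚₚ.*-identityˡ (ι (m j)))))
      where
      x y : ℤ
      x = n ⟦ + s ℤ.* idx j ℤ.+ k ⟧
      y = n ⟦ + s ℤ.* (idx j ℤ.+ 1ℤ) ℤ.+ k ⟧
    toZa≃m : ∀ j → seq (toZ s t a j) ≃ (λ _ → ι (m j))
    toZa≃m j =
      (λ n → q ℚ.* (seq (a ⟦ i ⟧) n ℚ.- (seq (a ⟦ i′ ⟧) n ℚ.- S)))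
        ≃⟨ *-congˡ q (+-cong (lim {seq (a ⟦ i ⟧)} (a≋n (residue t i)))
             (neg-cong (+-cong (lim {seq (a ⟦ i′ ⟧)} (a≋n (residue t i′))) (≃-refl {λ _ → ℚ.- S})))) ⟩
      (λ _ → q ℚ.* (ι (n ⟦ i ⟧) ℚ.- (ι (n ⟦ i′ ⟧) ℚ.- S)))
        ≃⟨ pointwise (λ _ → scaled j) ⟩
      (λ _ → ι (m j)) ∎≃
      where
      i i′ : ℤ
      i  = + s ℤ.* idx j ℤ.+ k
      i′ = + s ℤ.* (idx j ℤ.+ 1ℤ) ℤ.+ k
    formula : InverseFormula s t a (toZ s t a)
    formula = inverse-formula a (toZ s t a) pa (IsEquivalence.refl ≋-equivalence {toZ s t a})
    -- The coordinate of class k is k - Σ j m_j; its congruence to k is what gives `Σ≡0`.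
    origin : n ⟦ + s ℤ.* 0ℤ ℤ.+ k ⟧ ≡ corner m 0ℤ
    origin = ι-injective (constant-injective (
      (λ _ → ι (n ⟦ + s ℤ.* 0ℤ ℤ.+ k ⟧))
        ≃⟨ ≃-sym (lim {seq (a ⟦ + s ℤ.* 0ℤ ℤ.+ k ⟧)} (a≋n (residue t (+ s ℤ.* 0ℤ ℤ.+ k)))) ⟩
      seq (a ⟦ + s ℤ.* 0ℤ ℤ.+ k ⟧)
        ≃⟨ pointwise (λ n → sym (along-⟦⟧ (at a n) 0ℤ)) ⟩
      (λ n → along (at a n) ⟦ 0ℤ ⟧)
        ≃⟨ integer-values a (toZ s t a) m (toZ-hyperplane a) (λ j → unlim (toZa≃m j)) formula 0ℤ ⟩
      (λ _ → ι (corner m 0ℤ)) ∎≃))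
    Σ≡0 : sumℤ {t} (λ j → idx j ℤ.* m j) ≅ 0ℤ [ t ]
    Σ≡0 = mod-trans (mod-reflexive (trans (solve-for k (sumℤ {t} (λ j → idx j ℤ.* m j)))
        (cong (λ x → k ℤ.- x) (sym (trans origin (corner-zero m))))))
      (mod-trans (mod-- (mod-refl {a = k}) (entry (+ s ℤ.* 0ℤ ℤ.+ k))) (mod-reflexive (cancel (+ s) k)))
      where
      solve-for : ∀ k x → x ≡ k ℤ.- (k ℤ.- x)
      solve-for = solve-∀
      cancel : ∀ s k → k ℤ.- (s ℤ.* 0ℤ ℤ.+ k) ≡ 0ℤ
      cancel = solve-∀

  -- The hypothesis on Σ j m_j settles class k. Integrality of the m_j carries the congruence along
  -- each step of s, and such steps reach every class because s is invertible modulo t.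
  lattice-reflects : ∀ a z → HyperplaneA s t a → toZ s t a ≋ z → HyperplaneZ s t z → LatticeZ s t z → LatticeA s t a
  lattice-reflects a z pa toZa≋z pz (m , z≋m , Σ≡0) = n , (λ i → unlim (a≃n i)) , λ i → unmod (n≡ i)
    where
    open ≃-Reasoning
    values : ∀ ℓ → (λ n → along (at a n) ⟦ ℓ ⟧) ≃ (λ _ → ι (corner m ℓ))
    values = integer-values a z m pz z≋m (inverse-formula a z pa toZa≋z)
    ℓ : Fin t → Fin t
    ℓ i = residue t (position (idx i))
    n : Vector ℤ t
    n i = corner m (idx (ℓ i))
    at-ℓ : ∀ i → + s ℤ.* idx (ℓ i) ℤ.+ k ≅ idx i [ t ]
    at-ℓ i = mod-trans (along-cong (idx-residue t (position (idx i)))) (at-position (idx i))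
    a≃n : ∀ i → seq (a i) ≃ (λ _ → ι (n i))
    a≃n i =
      seq (a i)                                  ≃⟨ pointwise (λ n → sym (trans (along-⟦⟧ (at a n) (idx (ℓ i)))
                                                      (trans (⟦⟧-cong (at a n) (at-ℓ i)) (⟦idx⟧ (at a n) i)))) ⟩
      (λ n → along (at a n) ⟦ idx (ℓ i) ⟧)       ≃⟨ values (idx (ℓ i)) ⟩
      (λ _ → ι (n i)) ∎≃
    -- The definition of z_j multiplied by t, read back in the integers; modulo t it says that
    -- consecutive corners differ by s.
    step : ∀ j → + t ℤ.* m j ≡ corner m (idx j) ℤ.- (corner m (idx j ℤ.+ 1ℤ) ℤ.- + s)
    step j = ι-injective (trans (trans (ι-* (+ t) (m j)) (trans (cong (T ℚ.*_) (constant-injective scaled))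
        (trans (solve 3 (λ T q x → T :* (q :* x) := (q :* T) :* x) refl T q d) (trans (cong (ℚ._* d) qT≡1) (ℚₚ.*-identityˡ d)))))
      (sym (trans (ι-- x (y ℤ.- + s)) (cong (λ w → ι x ℚ.- w) (ι-- y (+ s))))))
      where
      x y : ℤ
      x = corner m (idx j)
      y = corner m (idx j ℤ.+ 1ℤ)
      d : ℚ
      d = ι x ℚ.- (ι y ℚ.- S)
      scaled : (λ _ → ι (m j)) ≃ (λ _ → q ℚ.* (ι x ℚ.- (ι y ℚ.- S)))
      scaled =
        (λ _ → ι (m j))     ≃⟨ ≃-sym {seq (z j)} (lim (z≋m j)) ⟩
        seq (z j)           ≃⟨ ≃-sym {seq (toZ s t a j)} (lim (toZa≋z j)) ⟩
        seq (toZ s t a j)   ≃⟨ pointwise (toZ-along a j) ⟩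
        (λ n → q ℚ.* (along (at a n) ⟦ idx j ⟧ ℚ.- (along (at a n) ⟦ idx j ℤ.+ 1ℤ ⟧ ℚ.- S)))
          ≃⟨ *-congˡ q (+-cong (values (idx j)) (neg-cong (+-cong (values (idx j ℤ.+ 1ℤ)) (≃-refl {λ _ → ℚ.- S})))) ⟩
        (λ _ → q ℚ.* (ι x ℚ.- (ι y ℚ.- S))) ∎≃
    step-mod : ∀ i → corner m (i ℤ.+ 1ℤ) ≅ corner m i ℤ.+ + s [ t ]
    step-mod i = mod-trans (mod-reflexive (corner-cong m (mod-+ (mod-sym (idx-residue t i)) (mod-refl {a = 1ℤ}))))
      (mod-trans (mod (divides (ℤ.- m j) (rearrange (corner m (idx j)) (corner m (idx j ℤ.+ 1ℤ)) (+ s) (+ t) (m j) (step j))))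
        (mod-reflexive (cong (λ x → x ℤ.+ + s) (corner-cong m (idx-residue t i)))))
      where
      j : Fin t
      j = residue t i
      lemma : ∀ x y s → y ℤ.- (x ℤ.+ s) ≡ ℤ.- (x ℤ.- (y ℤ.- s))
      lemma = solve-∀
      lemma′ : ∀ t m → ℤ.- (t ℤ.* m) ≡ (ℤ.- m) ℤ.* t
      lemma′ = solve-∀
      rearrange : ∀ x y s t m → t ℤ.* m ≡ x ℤ.- (y ℤ.- s) → y ℤ.- (x ℤ.+ s) ≡ (ℤ.- m) ℤ.* t
      rearrange x y s t m e = trans (lemma x y s) (trans (cong ℤ.-_ (sym e)) (lemma′ t m))
    -- Induction over natural p is enough, since `ℓ i` is a residue.
    corner-mod : ∀ p → corner m (+ p) ≅ + s ℤ.* + p ℤ.+ k [ t ]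
    corner-mod zero = mod-trans (mod-reflexive (corner-zero m))
      (mod-trans (mod-- (mod-refl {a = k}) (mod {sumℤ {t} (λ j → idx j ℤ.* m j)} {0ℤ} Σ≡0)) (mod-reflexive (lemma k (+ s))))
      where
      lemma : ∀ k s → k ℤ.- 0ℤ ≡ s ℤ.* 0ℤ ℤ.+ k
      lemma = solve-∀
    corner-mod (suc p) = mod-trans (mod-reflexive (cong (corner m) (ℤₚ.+-comm 1ℤ (+ p))))
      (mod-trans (step-mod (+ p)) (mod-trans (mod-+ (corner-mod p) (mod-refl {a = + s}))
        (mod-reflexive (trans (next-index (+ p)) (cong (λ x → + s ℤ.* x ℤ.+ k) (ℤₚ.+-comm (+ p) 1ℤ))))))
    n≡ : ∀ i → n i ≅ idx i [ t ]
    n≡ i = mod-trans (corner-mod (toℕ (ℓ i))) (at-ℓ i)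

  bijection-lattices : BijectionOn _≋_ _≋_ (toZ s t) (HyperplaneA s t ∩ LatticeA s t) (HyperplaneZ s t ∩ LatticeZ s t)
  bijection-lattices = restrict ≋-equivalence ≋-equivalence
    {toZ s t} {HyperplaneA s t} {HyperplaneA s t ∩ LatticeA s t} {HyperplaneZ s t} {HyperplaneZ s t ∩ LatticeZ s t}
    bijection-hyperplanes proj₁ proj₁
    (λ {a} (pa , la) → toZ-hyperplane a , lattice-maps a pa la)
    (λ {a} {z} pa e (pz , lz) → pa , lattice-reflects a z pa e pz lz)

  bijection-A-TD : BijectionOn _≋_ _≋_ (toZ s t) (A s t) (TD s t)
  bijection-A-TD = restrict ≋-equivalence ≋-equivalence
    {toZ s t} {HyperplaneA s t} {A s t} {HyperplaneZ s t} {TD s t}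
    bijection-hyperplanes (λ p → proj₁ (proj₁ p)) (λ p → proj₁ (proj₁ p))
    (λ {a} (σ , la) → simplex-maps a σ , lattice-maps a (proj₁ σ) la)
    (λ {a} {z} pa e (σ , lz) → simplex-reflects a z pa e σ , lattice-reflects a z pa e (proj₁ σ) lz)

-- Beta-sets and hooks

-- Linear arithmetic: an inequality is transported along an identity between the differences.
≤-by : ∀ {a b c d} → c ℤ.≤ d → d ℤ.- c ≡ b ℤ.- a → a ℤ.≤ b
≤-by c≤d e = ℤₚ.0≤i-j⇒j≤i (subst (0ℤ ℤ.≤_) e (ℤₚ.i≤j⇒0≤j-i c≤d))

private
  1+≤ : ∀ {a b} → a ℤ.< b → a ℤ.+ 1ℤ ℤ.≤ b
  1+≤ {a} a<b = subst (ℤ._≤ _) (ℤₚ.+-comm 1ℤ a) (ℤₚ.i<j⇒suc[i]≤j a<b)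

≤-by-< : ∀ {a b c d} → c ℤ.< d → d ℤ.- c ≡ b ℤ.- a ℤ.+ 1ℤ → a ℤ.≤ b
≤-by-< {a} {b} {c} {d} c<d e = ≤-by (1+≤ c<d) (trans (lemma c d) (trans (cong (ℤ._- 1ℤ) e) (lemma′ (b ℤ.- a))))
  where
  lemma : ∀ c d → d ℤ.- (c ℤ.+ 1ℤ) ≡ d ℤ.- c ℤ.- 1ℤ
  lemma = solve-∀
  lemma′ : ∀ x → x ℤ.+ 1ℤ ℤ.- 1ℤ ≡ x
  lemma′ = solve-∀

<-by-≤ : ∀ {a b c d} → c ℤ.≤ d → d ℤ.- c ℤ.+ 1ℤ ≡ b ℤ.- a → a ℤ.< b
<-by-≤ {a} {b} {c} {d} c≤d e = ℤₚ.suc[i]≤j⇒i<j (≤-by c≤d (trans (lemma (d ℤ.- c)) (trans (cong (ℤ._- 1ℤ) e) (lemma′ a b))))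
  where
  lemma : ∀ x → x ≡ x ℤ.+ 1ℤ ℤ.- 1ℤ
  lemma = solve-∀
  lemma′ : ∀ a b → b ℤ.- a ℤ.- 1ℤ ≡ b ℤ.- (1ℤ ℤ.+ a)
  lemma′ = solve-∀

<-by : ∀ {a b c d} → c ℤ.< d → d ℤ.- c ≡ b ℤ.- a → a ℤ.< b
<-by {a} {b} {c} {d} c<d e = <-by-≤ (1+≤ c<d) (trans (lemma c d) e)
  where
  lemma : ∀ c d → d ℤ.- (c ℤ.+ 1ℤ) ℤ.+ 1ℤ ≡ d ℤ.- c
  lemma = solve-∀

i≤∣i∣ : ∀ i → i ℤ.≤ + ℤ.∣ i ∣
i≤∣i∣ (+ n)    = ℤₚ.≤-refl
i≤∣i∣ -[1+ n ] = ℤ.-≤+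

-∣i∣≤i : ∀ i → ℤ.- + ℤ.∣ i ∣ ℤ.≤ i
-∣i∣≤i (+ zero)  = ℤₚ.≤-refl
-∣i∣≤i (+ suc n) = ℤ.-≤+
-∣i∣≤i -[1+ n ]  = ℤₚ.≤-refl

module _ {P : Pred ℕ 0ℓ} (P? : Decidable P) where

  filter-none : ∀ f n → (∀ i → ¬ P (f i)) → filter P? (applyUpTo f n) ≡ []
  filter-none f zero    ¬P = refl
  filter-none f (suc n) ¬P = trans (filter-reject P? (¬P 0)) (filter-none (λ i → f (suc i)) n (λ i → ¬P (suc i)))

  private
    Downward : (ℕ → ℕ) → Set
    Downward f = ∀ {i j} → i ℕ.≤ j → P (f j) → P (f i)

    down-suc : ∀ f → Downward f → Downward (λ i → f (suc i))
    down-suc f down i≤j = down (s≤s i≤j)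

  -- The indices satisfying a downward closed predicate form an initial segment, so their number
  -- acts as a threshold. The counting in `conjugate` is of this kind, since parts decrease.
  count⇒ : ∀ f n → Downward f → ∀ r → r ℕ.< length (filter P? (applyUpTo f n)) → P (f r)
  count⇒ f (suc n) down r r< with P? (f 0)
  ... | no ¬P₀ = contradiction (subst (λ l → r ℕ.< length l)
          (filter-none (λ i → f (suc i)) n (λ i Pi → ¬P₀ (down z≤n Pi))) r<) λ ()
  count⇒ f (suc n) down zero    r<       | yes P₀ = P₀
  count⇒ f (suc n) down (suc r) (s≤s r<) | yes P₀ = count⇒ (λ i → f (suc i)) n (down-suc f down) r r<

  count⇐ : ∀ f n → Downward f → ∀ r → r ℕ.< n → P (f r) → r ℕ.< length (filter P? (applyUpTo f n))
  count⇐ f (suc n) down r r<n Pr with P? (f 0)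
  ... | no ¬P₀ = contradiction (down z≤n Pr) ¬P₀
  count⇐ f (suc n) down zero    r<n       Pr | yes P₀ = s≤s z≤n
  count⇐ f (suc n) down (suc r) (s≤s r<n) Pr | yes P₀ = s≤s (count⇐ (λ i → f (suc i)) n (down-suc f down) r r<n Pr)

antitone : ∀ p {q r} → q ℕ.≤ r → part p r ℕ.≤ part p q
antitone p q≤r = go (ℕₚ.≤⇒≤′ q≤r)
  where
  go : ∀ {q r} → q ℕ.≤′ r → part p r ℕ.≤ part p q
  go ℕ.≤′-refl       = ℕₚ.≤-refl
  go (ℕ.≤′-step q≤r) = ℕₚ.≤-trans (decreasing p _) (go q≤r)

module _ (p : Partition) where

  <conjugate⇒ : ∀ r c → r ℕ.< conjugate p c → c ℕ.< part p r
  <conjugate⇒ r c = count⇒ (λ r → c ℕₚ.<? part p r) (λ r → r) (support p)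
    (λ i≤j c<j → ℕₚ.<-≤-trans c<j (antitone p i≤j)) r

  <conjugate⇐ : ∀ r c → c ℕ.< part p r → r ℕ.< conjugate p c
  <conjugate⇐ r c c<r = count⇐ (λ r → c ℕₚ.<? part p r) (λ r → r) (support p)
    (λ i≤j c<j → ℕₚ.<-≤-trans c<j (antitone p i≤j)) r
    (ℕₚ.≰⇒> λ N≤r → contradiction (subst (c ℕ.<_) (part≡0 p r N≤r) c<r) λ ()) c<r

  gap : ℕ → ℤ
  gap c = + c ℤ.- + conjugate p c

  hook≡ : ∀ r c → hook p r c ≡ betaNumber p r ℤ.- gap c
  hook≡ r c = lemma (+ part p r) (+ r) (+ c) (+ conjugate p c)
    where
    lemma : ∀ λᵣ r c λ′ → 1ℤ ℤ.+ (λᵣ ℤ.- (1ℤ ℤ.+ r)) ℤ.+ (λ′ ℤ.- (1ℤ ℤ.+ c)) ≡ (λᵣ ℤ.- (1ℤ ℤ.+ r)) ℤ.- (c ℤ.- λ′)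
    lemma = solve-∀

  gap<beta : ∀ r c → c ℕ.< part p r → gap c ℤ.< betaNumber p r
  gap<beta r c c<r = <-by-≤ (ℤₚ.+-mono-≤ (ℤ.+≤+ c<r) (ℤ.+≤+ (<conjugate⇐ r c c<r)))
    (lemma (+ part p r) (+ r) (+ c) (+ conjugate p c))
    where
    lemma : ∀ λᵣ r c λ′ → (λᵣ ℤ.+ λ′) ℤ.- ((1ℤ ℤ.+ c) ℤ.+ (1ℤ ℤ.+ r)) ℤ.+ 1ℤ ≡ (λᵣ ℤ.- (1ℤ ℤ.+ r)) ℤ.- (c ℤ.- λ′)
    lemma = solve-∀

  beta<gap : ∀ r c → part p r ℕ.≤ c → betaNumber p r ℤ.< gap c
  beta<gap r c r≤c = <-by-≤ (ℤₚ.+-mono-≤ (ℤ.+≤+ r≤c) (ℤ.+≤+ (ℕₚ.≮⇒≥ λ r< → ℕₚ.<⇒≱ (<conjugate⇒ r c r<) r≤c)))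
    (lemma (+ part p r) (+ r) (+ c) (+ conjugate p c))
    where
    lemma : ∀ λᵣ r c λ′ → (c ℤ.+ r) ℤ.- (λᵣ ℤ.+ λ′) ℤ.+ 1ℤ ≡ (c ℤ.- λ′) ℤ.- (λᵣ ℤ.- (1ℤ ℤ.+ r))
    lemma = solve-∀

  -- The box (r, c) is either inside or outside the diagram, and in both cases the comparison of the
  -- two numbers is strict.
  gap≢beta : ∀ r c → gap c ≢ betaNumber p r
  gap≢beta r c e with c ℕₚ.<? part p r
  ... | yes c<r = ℤₚ.<⇒≢ (gap<beta r c c<r) e
  ... | no  c≮r = ℤₚ.<⇒≢ (beta<gap r c (ℕₚ.≮⇒≥ c≮r)) (sym e)

  -- The smallest r with betaNumber p r ≤ b decides.
  beta-or-gap : ∀ b → BetaSet p b ⊎ ∃[ c ] b ≡ gap c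
  -- In row `support p + ∣b∣` the part is 0, so the beta number is -(`support p` + ∣b∣ + 1) ≤ b and
  -- the search can start there, moving up.
  beta-or-gap b = search (support p ℕ.+ ℤ.∣ b ∣) (≤-by (ℤₚ.+-mono-≤ (ℤₚ.+-mono-≤ (-∣i∣≤i b) (ℤ.+≤+ (z≤n {support p}))) (ℤ.+≤+ (z≤n {1}))) eq)
    where
    eq : (b ℤ.+ + support p ℤ.+ 1ℤ) ℤ.- (ℤ.- + ℤ.∣ b ∣ ℤ.+ 0ℤ ℤ.+ 0ℤ) ≡ b ℤ.- betaNumber p (support p ℕ.+ ℤ.∣ b ∣)
    eq = trans (lemma b (+ support p) (+ ℤ.∣ b ∣))
      (cong (λ x → b ℤ.- (+ x ℤ.- + suc (support p ℕ.+ ℤ.∣ b ∣))) (sym (part≡0 p _ (ℕₚ.m≤m+n (support p) ℤ.∣ b ∣))))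
      where
      lemma : ∀ b N m → (b ℤ.+ N ℤ.+ 1ℤ) ℤ.- (ℤ.- m ℤ.+ 0ℤ ℤ.+ 0ℤ) ≡ b ℤ.- (0ℤ ℤ.- (1ℤ ℤ.+ (N ℤ.+ m)))
      lemma = solve-∀
    -- When b lies strictly between the beta numbers of rows r and r - 1, column c = b + r is met by
    -- exactly the r rows above row r, hence b = c - r is its gap. For r = 0 the upper condition is
    -- vacuous.
    gap-at : ∀ r → (∀ q → suc q ≡ r → b ℤ.< betaNumber p q) → betaNumber p r ℤ.< b → ∃[ c ] b ≡ gap c
    gap-at r above below = c , trans (lemma b (+ r)) (cong₂ ℤ._-_ (sym c≡b+r) (cong +_ (ℕₚ.≤-antisym (r≤ r refl) (ℕₚ.≮⇒≥ λ r< → ℕₚ.<⇒≱ (<conjugate⇒ r c r<) r≤c))))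
      where
      lemma : ∀ b r → b ≡ (b ℤ.+ r) ℤ.- r
      lemma = solve-∀
      c : ℕ
      c = ℤ.∣ b ℤ.+ + r ∣
      r≤b+r : + part p r ℤ.≤ b ℤ.+ + r
      r≤b+r = ≤-by-< below (lemma′ (+ part p r) (+ r) b)
        where
        lemma′ : ∀ λᵣ r b → b ℤ.- (λᵣ ℤ.- (1ℤ ℤ.+ r)) ≡ (b ℤ.+ r) ℤ.- λᵣ ℤ.+ 1ℤ
        lemma′ = solve-∀
      c≡b+r : + c ≡ b ℤ.+ + r
      c≡b+r = ℤₚ.0≤i⇒+∣i∣≡i (ℤₚ.≤-trans (ℤ.+≤+ z≤n) r≤b+r)
      r≤c : part p r ℕ.≤ c
      r≤c = ℤₚ.drop‿+≤+ (subst (+ part p r ℤ.≤_) (sym c≡b+r) r≤b+r)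
      r≤ : ∀ r′ → r′ ≡ r → r′ ℕ.≤ conjugate p c
      r≤ zero    _ = z≤n
      r≤ (suc q) e = <conjugate⇐ q c (ℤₚ.drop‿+<+ (subst (ℤ._< + part p q) (sym c≡b+r)
        (<-by (above q e) (trans (lemma′ (+ part p q) (+ q) b) (cong (λ x → + part p q ℤ.- (b ℤ.+ + x)) e)))))
        where
        lemma′ : ∀ x q b → (x ℤ.- (1ℤ ℤ.+ q)) ℤ.- b ≡ x ℤ.- (b ℤ.+ (1ℤ ℤ.+ q))
        lemma′ = solve-∀
    search : ∀ r → betaNumber p r ℤ.≤ b → BetaSet p b ⊎ ∃[ c ] b ≡ gap c
    search r r≤b with betaNumber p r ℤₚ.≟ b
    ... | yes e = inj₁ (r , sym e)
    search zero r≤b | no r≢b = inj₂ (gap-at zero (λ _ ()) (ℤₚ.≤∧≢⇒< r≤b r≢b))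
    search (suc r) r≤b | no r≢b with betaNumber p r ℤₚ.≤? b
    ... | yes q≤b = search r q≤b
    ... | no  q≰b = inj₂ (gap-at (suc r) (λ { _ refl → ℤₚ.≰⇒> q≰b }) (ℤₚ.≤∧≢⇒< r≤b r≢b))

-- Cores as closed beta-sets

ClosedUnder : ℕ → Pred ℤ 0ℓ → Set
ClosedUnder t B = ∀ b → B b → B (b ℤ.- + t)

core⇒closed : ∀ t .{{_ : NonZero t}} p → Core t p → ClosedUnder t (BetaSet p)
core⇒closed t p core b (r , refl) with beta-or-gap p (betaNumber p r ℤ.- + t)
... | inj₁ beta      = beta
... | inj₂ (c , gap≡) = contradiction (trans (hook≡ p r c) (trans (cong (λ x → betaNumber p r ℤ.- x) (sym gap≡)) (lemma (betaNumber p r) (+ t))))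
  -- The box lies in the diagram: outside it the gap would exceed the beta number, whereas it is t
  -- below it.
  (core r c (ℕₚ.≰⇒> λ r≤c → ℤₚ.<⇒≱ (beta<gap p r c r≤c) (subst (ℤ._≤ betaNumber p r) gap≡ (ℤₚ.i-j≤i (betaNumber p r) (+ t)))))
  where
  lemma : ∀ b t → b ℤ.- (b ℤ.- t) ≡ t
  lemma = solve-∀

closed⇒core : ∀ t p → ClosedUnder t (BetaSet p) → Core t p
closed⇒core t p closed r c _ hook≡t =
  let q , e = closed (betaNumber p r) (r , refl)
  in gap≢beta p q c (trans (trans (lemma (betaNumber p r) (gap p c)) (cong (λ x → betaNumber p r ℤ.- x) (trans (sym (hook≡ p r c)) hook≡t))) e)
  where
  lemma : ∀ b g → g ≡ b ℤ.- (b ℤ.- g)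
  lemma = solve-∀

beta-decreasing : ∀ p r → betaNumber p (suc r) ℤ.< betaNumber p r
beta-decreasing p r = <-by-≤ (ℤ.+≤+ (decreasing p r)) (lemma (+ part p r) (+ part p (suc r)) (+ r))
  where
  lemma : ∀ x y r → (x ℤ.- y) ℤ.+ 1ℤ ≡ (x ℤ.- (1ℤ ℤ.+ r)) ℤ.- (y ℤ.- (1ℤ ℤ.+ (1ℤ ℤ.+ r)))
  lemma = solve-∀

multiple-above : ∀ {t a b} → a ≅ b [ t ] → b ℤ.≤ a → ∃[ n ] a ≡ b ℤ.+ + n ℤ.* + t
multiple-above {t} {a} {b} (mod (divides (+ n) e)) _ = n , trans (lemma a b) (cong (λ x → b ℤ.+ x) e)
  where
  lemma : ∀ a b → a ≡ b ℤ.+ (a ℤ.- b)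
  lemma = solve-∀
-- A negative quotient gives a ≤ b, hence a = b and the multiple is 0.
multiple-above {t} {a} {b} (mod (divides -[1+ n ] e)) b≤a = 0 , trans
  (ℤₚ.≤-antisym (≤-by (ℤ.+≤+ (z≤n {suc n ℕ.* t})) (trans (cong (λ x → x ℤ.- 0ℤ) (trans (ℤₚ.pos-* (suc n) t) (lemma (+ n) (+ t))))
      (trans (cong (λ x → ℤ.- x ℤ.- 0ℤ) (sym e)) (lemma′ a b)))) b≤a)
  (lemma″ b (+ t))
  where
  lemma : ∀ n t → (1ℤ ℤ.+ n) ℤ.* t ≡ ℤ.- ((ℤ.- (1ℤ ℤ.+ n)) ℤ.* t)
  lemma = solve-∀
  lemma′ : ∀ a b → ℤ.- (a ℤ.- b) ℤ.- 0ℤ ≡ b ℤ.- a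
  lemma′ = solve-∀
  lemma″ : ∀ b t → b ≡ b ℤ.+ 0ℤ ℤ.* t
  lemma″ = solve-∀

<⇒+t≤ : ∀ {t a b} → b ℤ.< a → b ≅ a [ t ] → b ℤ.+ + t ℤ.≤ a
<⇒+t≤ {t} {a} {b} b<a b≅a with multiple-above (mod-sym b≅a) (ℤₚ.<⇒≤ b<a)
... | zero  , e = contradiction (sym (trans e (lemma b (+ t)))) (ℤₚ.<⇒≢ b<a)
  where
  lemma : ∀ b t → b ℤ.+ 0ℤ ℤ.* t ≡ b
  lemma = solve-∀
... | suc n , e = ≤-by (ℤ.+≤+ (z≤n {n ℕ.* t})) (trans (cong (ℤ._- 0ℤ) (ℤₚ.pos-* n t))
  (trans (lemma b (+ n) (+ t)) (cong (λ x → x ℤ.- (b ℤ.+ + t)) (sym e))))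
  where
  lemma : ∀ b n t → n ℤ.* t ℤ.- 0ℤ ≡ (b ℤ.+ (1ℤ ℤ.+ n) ℤ.* t) ℤ.- (b ℤ.+ t)
  lemma = solve-∀

-- The beta-set of the t-core with coordinates a.
Below : ∀ {t} .{{_ : NonZero t}} → Vector ℤ t → Pred ℤ 0ℓ
Below a b = b ℤ.< a ⟦ b ⟧

module _ {t : ℕ} .{{_ : NonZero t}} where

  ⟦⟧≅ : ∀ {a : Vector ℤ t} → (∀ i → a i ≅ idx i [ t ]) → ∀ b → a ⟦ b ⟧ ≅ b [ t ]
  ⟦⟧≅ a≅ b = mod-trans (a≅ (residue t b)) (idx-residue t b)

  below-closed : ∀ (a : Vector ℤ t) → ClosedUnder t (Below a)
  below-closed a b b<a = ℤₚ.≤-<-trans (ℤₚ.i-j≤i b (+ t)) (subst (b ℤ.<_) (⟦⟧-cong a (mod-sym (minus-modulus b))) b<a)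

-- The coordinates of a partition

aCoord-mod : ∀ t .{{_ : NonZero t}} p i → aCoord t p i ≅ i [ t ]
aCoord-mod t p i = mod-trans (mod (divides 1ℤ (lemma (+ t) m))) (mod (proj₂ (proj₁ (proj₂ (maxBeta t p i)))))
  where
  m = proj₁ (maxBeta t p i)
  lemma : ∀ t m → t ℤ.+ m ℤ.- m ≡ 1ℤ ℤ.* t
  lemma = solve-∀

beta⇒<aCoord : ∀ t .{{_ : NonZero t}} p {b i} → b ≅ i [ t ] → BetaSet p b → b ℤ.+ + t ℤ.≤ aCoord t p i
beta⇒<aCoord t p {b} {i} b≅i beta = subst (ℤ._≤ aCoord t p i) (ℤₚ.+-comm (+ t) b)
  (ℤₚ.+-monoʳ-≤ (+ t) (proj₂ (proj₂ (maxBeta t p i)) b (beta , unmod b≅i)))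

-- Recognises a coordinate by the two properties of a maximum, whatever search `maxBeta` performs.
aCoord-unique : ∀ t .{{_ : NonZero t}} p i x → x ≅ i [ t ] → BetaSet p (x ℤ.- + t) →
  (∀ b → b ≅ i [ t ] → BetaSet p b → b ℤ.+ + t ℤ.≤ x) → aCoord t p i ≡ x
aCoord-unique t p i x x≅i x∈ x-max = ℤₚ.≤-antisym
  (subst (ℤ._≤ x) (ℤₚ.+-comm m (+ t)) (x-max m (mod (proj₂ (proj₁ max))) (proj₁ (proj₁ max))))
  (subst (ℤ._≤ aCoord t p i) (lemma x (+ t)) (beta⇒<aCoord t p {x ℤ.- + t} {i} (mod-trans (minus-modulus x) x≅i) x∈))
  where
  m = proj₁ (maxBeta t p i)
  max = proj₂ (maxBeta t p i)
  lemma : ∀ x t → x ℤ.- t ℤ.+ t ≡ x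
  lemma = solve-∀

aCoord-cong : ∀ t .{{_ : NonZero t}} p q {i j} → i ≅ j [ t ] → (∀ b → BetaSet p b → BetaSet q b) →
  (∀ b → BetaSet q b → BetaSet p b) → aCoord t p i ≡ aCoord t q j
aCoord-cong t p q {i} {j} i≅j p⊆q q⊆p = aCoord-unique t p i (aCoord t q j)
  (mod-trans (aCoord-mod t q j) (mod-sym i≅j))
  (q⊆p _ (subst (BetaSet q) (lemma (+ t) m) (proj₁ (proj₁ (proj₂ (maxBeta t q j))))))
  (λ b b≅i b∈ → beta⇒<aCoord t q (mod-trans b≅i i≅j) (p⊆q b b∈))
  where
  m = proj₁ (maxBeta t q j)
  lemma : ∀ t m → m ≡ t ℤ.+ m ℤ.- t
  lemma = solve-∀

descend : ∀ {t B} → ClosedUnder t B → ∀ n b → B (b ℤ.+ + n ℤ.* + t) → B b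
descend {t} {B} closed zero    b b∈ = subst B (lemma b (+ t)) b∈
  where
  lemma : ∀ b t → b ℤ.+ 0ℤ ℤ.* t ≡ b
  lemma = solve-∀
descend {t} {B} closed (suc n) b b∈ = descend closed n b (subst B (lemma b (+ n) (+ t)) (closed _ b∈))
  where
  lemma : ∀ b n t → b ℤ.+ (1ℤ ℤ.+ n) ℤ.* t ℤ.- t ≡ b ℤ.+ n ℤ.* t
  lemma = solve-∀

module _ (t : ℕ) .{{_ : NonZero t}} (p : Partition) where

  -- Abstract, so that type checking never unfolds the search inside maxBeta.
  abstract

    point : Vector ℤ t
    point i = aCoord t p (idx i)

    point≡ : ∀ i → point i ≡ aCoord t p (idx i)
    point≡ i = refl

  point-aligned : ∀ i → point i ≅ idx i [ t ]
  point-aligned i = mod-trans (mod-reflexive (point≡ i)) (aCoord-mod t p (idx i))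

  point-⟦⟧ : ∀ i → point ⟦ i ⟧ ≡ aCoord t p i
  point-⟦⟧ i = trans (point≡ (residue t i)) (aCoord-cong t p p (idx-residue t i) (λ _ b∈ → b∈) (λ _ b∈ → b∈))

  beta⇒below : ∀ b → BetaSet p b → Below point b
  beta⇒below b b∈ = subst (b ℤ.<_) (sym (point-⟦⟧ b)) (ℤₚ.<-≤-trans b<b+t (beta⇒<aCoord t p (mod-refl {a = b}) b∈))
    where
    b<b+t : b ℤ.< b ℤ.+ + t
    b<b+t = <-by-≤ (ℤ.+≤+ (ℕ.>-nonZero⁻¹ t)) (lemma b (+ t))
      where
      lemma : ∀ b t → t ℤ.- 1ℤ ℤ.+ 1ℤ ≡ b ℤ.+ t ℤ.- b
      lemma = solve-∀

  -- The largest element of the class of b is its coordinate minus t and lies at or above b; closure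
  -- under subtracting t fills the class from there down to b.
  below⇒beta : Core t p → ∀ b → Below point b → BetaSet p b
  below⇒beta core b b<a =
    let n , e = multiple-above top≅b (≤-by (<⇒+t≤ b<aCoord (mod-sym (aCoord-mod t p b))) (lemma′ (aCoord t p b) b (+ t)))
    in descend (core⇒closed t p core) n b (subst (BetaSet p) (trans (lemma″ (+ t) top) e) (proj₁ (proj₁ (proj₂ (maxBeta t p b)))))
    where
    top : ℤ
    top = proj₁ (maxBeta t p b)
    b<aCoord : b ℤ.< aCoord t p b
    b<aCoord = subst (b ℤ.<_) (point-⟦⟧ b) b<a
    top≅b : aCoord t p b ℤ.- + t ≅ b [ t ]
    top≅b = mod-trans (minus-modulus (aCoord t p b)) (aCoord-mod t p b)
    lemma′ : ∀ a b t → a ℤ.- (b ℤ.+ t) ≡ (a ℤ.- t) ℤ.- b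
    lemma′ = solve-∀
    lemma″ : ∀ t m → m ≡ t ℤ.+ m ℤ.- t
    lemma″ = solve-∀

-- The charge of a beta-set

sumℤ-update : ∀ {n} (f g : Vector ℤ n) i c → (∀ j → j ≢ i → f j ≡ g j) → f i ≡ g i ℤ.+ c →
  sumℤ f ≡ sumℤ g ℤ.+ c
sumℤ-update {suc n} f g zero    c f≗g fi≡ = trans
  (cong₂ ℤ._+_ fi≡ (sumℤ-cong {n} (λ j → f≗g (suc j) λ ())))
  (lemma (g zero) c (sumℤ {n} (λ j → g (suc j))))
  where
  lemma : ∀ x c y → x ℤ.+ c ℤ.+ y ≡ x ℤ.+ y ℤ.+ c
  lemma = solve-∀
sumℤ-update {suc n} f g (suc i) c f≗g fi≡ = trans
  (cong₂ ℤ._+_ (f≗g zero λ ()) (sumℤ-update {n} (λ j → f (suc j)) (λ j → g (suc j)) i c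
    (λ j j≢i → f≗g (suc j) λ e → j≢i (Finₚ.suc-injective e)) fi≡))
  (sym (ℤₚ.+-assoc (g zero) (sumℤ {n} (λ j → g (suc j))) c))

-- The origin of C(t,2): for c = 0 and n = t these are the coordinates 0, ..., t - 1 of the set of
-- negative integers.
sumℤ-range : ∀ n c → sumℤ {n} (λ i → c ℤ.+ idx i) ≡ + n ℤ.* c ℤ.+ + (n C 2)
sumℤ-range zero    c = refl
sumℤ-range (suc n) c = begin
  c ℤ.+ 0ℤ ℤ.+ sumℤ {n} (λ i → c ℤ.+ + suc (toℕ i))
    ≡⟨ cong (λ x → c ℤ.+ 0ℤ ℤ.+ x) (sumℤ-cong {n} (λ i → sym (ℤₚ.+-assoc c 1ℤ (idx i)))) ⟩
  c ℤ.+ 0ℤ ℤ.+ sumℤ {n} (λ i → c ℤ.+ 1ℤ ℤ.+ idx i)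
    ≡⟨ cong (λ x → c ℤ.+ 0ℤ ℤ.+ x) (sumℤ-range n (c ℤ.+ 1ℤ)) ⟩
  c ℤ.+ 0ℤ ℤ.+ (+ n ℤ.* (c ℤ.+ 1ℤ) ℤ.+ + (n C 2))
    ≡⟨ lemma c (+ n) (+ (n C 2)) ⟩
  (1ℤ ℤ.+ + n) ℤ.* c ℤ.+ (+ n ℤ.+ + (n C 2))
    ≡⟨ cong (λ x → (1ℤ ℤ.+ + n) ℤ.* c ℤ.+ + x) (trans (cong (ℕ._+ (n C 2)) (sym (nC1≡n n))) (nCk+nC[k+1]≡[n+1]C[k+1] n 1)) ⟩
  + suc n ℤ.* c ℤ.+ + (suc n C 2) ∎
  where
  open ≡-Reasoning
  lemma : ∀ c n b → c ℤ.+ 0ℤ ℤ.+ (n ℤ.* (c ℤ.+ 1ℤ) ℤ.+ b) ≡ (1ℤ ℤ.+ n) ℤ.* c ℤ.+ (n ℤ.+ b)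
  lemma = solve-∀

record Enumerates (x : ℕ → ℤ) (B : Pred ℤ 0ℓ) : Set where
  field
    descending : ∀ r → x (suc r) ℤ.< x r
    sound      : ∀ r → B (x r)
    complete   : ∀ b → B b → ∃[ r ] b ≡ x r

  descending* : ∀ {q r} → q ℕ.< r → x r ℤ.< x q
  descending* q<r = go (ℕₚ.≤⇒≤′ q<r)
    where
    go : ∀ {q r} → suc q ℕ.≤′ r → x r ℤ.< x q
    go ℕ.≤′-refl         = descending _
    go (ℕ.≤′-step {n} q<n) = ℤₚ.<-trans (descending n) (go q<n)

  max : ∀ b → B b → b ℤ.≤ x 0
  max b b∈ with complete b b∈
  ... | zero  , refl = ℤₚ.≤-refl
  ... | suc r , refl = ℤₚ.<⇒≤ (descending* (s≤s z≤n))

  next-max : ∀ r b → B b → b ℤ.< x r → b ℤ.≤ x (suc r)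
  next-max r b b∈ b<xr with complete b b∈
  ... | q , refl with ℕₚ.<-cmp q (suc r)
  ... | tri< (s≤s q≤r) _ _ with ℕₚ.m≤n⇒m<n∨m≡n q≤r
  ... | inj₁ q<r  = contradiction (ℤₚ.<-trans b<xr (descending* q<r)) (ℤₚ.<-irrefl refl)
  ... | inj₂ refl = contradiction b<xr (ℤₚ.<-irrefl refl)
  next-max r b b∈ b<xr | q , refl | tri≈ _ refl _ = ℤₚ.≤-refl
  next-max r b b∈ b<xr | q , refl | tri> _ _ q>r = ℤₚ.<⇒≤ (descending* q>r)

-- Each term has to be the largest element below the preceding one.
enumeration-unique : ∀ {x y B} → Enumerates x B → Enumerates y B → ∀ r → x r ≡ y r
enumeration-unique {x} {y} X Y = go
  where
  module X = Enumerates X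
  module Y = Enumerates Y
  go : ∀ r → x r ≡ y r
  go zero    = ℤₚ.≤-antisym (Y.max (x 0) (X.sound 0)) (X.max (y 0) (Y.sound 0))
  go (suc r) = ℤₚ.≤-antisym
    (Y.next-max r (x (suc r)) (X.sound (suc r)) (subst (x (suc r) ℤ.<_) (go r) (X.descending r)))
    (X.next-max r (y (suc r)) (Y.sound (suc r)) (subst (y (suc r) ℤ.<_) (sym (go r)) (Y.descending r)))

module Charge (t : ℕ) .{{_ : NonZero t}} where

  private
    0<t : 0ℤ ℤ.< + t
    0<t = ℤ.+<+ (ℕ.>-nonZero⁻¹ t)

  Aligned : Vector ℤ t → Set
  Aligned a = ∀ i → a i ≅ idx i [ t ]

  -- Since x 0 lies t below the coordinate of its class, dropping it makes x 0 the new coordinate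
  -- there and leaves the other classes alone.
  remove-max : ∀ {x a} → Enumerates x (Below a) → Aligned a →
    ∃[ a′ ] Enumerates (λ r → x (suc r)) (Below a′) × Aligned a′ × sumℤ a ≡ sumℤ a′ ℤ.+ + t
  remove-max {x} {a} enum a≅ = a′ , enum′ , a′≅ , sumℤ-update a a′ i₀ (+ t)
    (λ j j≢i₀ → sym (a′-other j j≢i₀)) (trans (sym top) (cong (ℤ._+ + t) (sym a′-top)))
    where
    open Enumerates enum
    i₀ : Fin t
    i₀ = residue t (x 0)
    a′ : Vector ℤ t
    a′ j with j Finₚ.≟ i₀
    ... | yes _ = x 0
    ... | no  _ = a j
    a′-top : a′ i₀ ≡ x 0
    a′-top with i₀ Finₚ.≟ i₀
    ... | yes _ = refl
    ... | no  e = contradiction refl e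
    a′-other : ∀ j → j ≢ i₀ → a′ j ≡ a j
    a′-other j j≢ with j Finₚ.≟ i₀
    ... | yes e = contradiction e j≢
    ... | no  _ = refl
    -- One bound holds because x 0 < a i₀ within one class, the other because a i₀ - t belongs to
    -- the set and x 0 is its maximum.
    top : x 0 ℤ.+ + t ≡ a i₀
    top = ℤₚ.≤-antisym (<⇒+t≤ (sound 0) (mod-sym (⟦⟧≅ a≅ (x 0))))
      (≤-by (max (a i₀ ℤ.- + t) a-t∈) (lemma (x 0) (a i₀) (+ t)))
      where
      lemma : ∀ x a t → x ℤ.- (a ℤ.- t) ≡ (x ℤ.+ t) ℤ.- a
      lemma = solve-∀
      lemma′ : ∀ a t → t ℤ.- 0ℤ ≡ a ℤ.- (a ℤ.- t)
      lemma′ = solve-∀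
      a-t∈ : Below a (a i₀ ℤ.- + t)
      a-t∈ = subst (a i₀ ℤ.- + t ℤ.<_)
        (sym (⟦⟧-cong a (mod-trans (minus-modulus (a i₀)) (⟦⟧≅ a≅ (x 0)))))
        (<-by 0<t (lemma′ (a i₀) (+ t)))
    x₀<a : x 0 ℤ.< a i₀
    x₀<a = sound 0
    a′≅ : Aligned a′
    a′≅ j with j Finₚ.≟ i₀
    ... | yes refl = mod-sym (idx-residue t (x 0))
    ... | no  _    = a≅ j
    a′≤a : ∀ j → a′ j ℤ.≤ a j
    a′≤a j with j Finₚ.≟ i₀
    ... | yes refl = ℤₚ.<⇒≤ x₀<a
    ... | no  _    = ℤₚ.≤-refl
    enum′ : Enumerates (λ r → x (suc r)) (Below a′)
    enum′ = record
      { descending = λ r → descending (suc r)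
      ; sound      = sound′
      ; complete   = complete′
      }
      where
      sound′ : ∀ r → Below a′ (x (suc r))
      sound′ r with residue t (x (suc r)) Finₚ.≟ i₀
      ... | yes _ = descending* (s≤s z≤n)
      ... | no  _ = sound (suc r)
      complete′ : ∀ b → Below a′ b → ∃[ r ] b ≡ x (suc r)
      complete′ b b<a′ with complete b (ℤₚ.<-≤-trans b<a′ (a′≤a (residue t b)))
      ... | suc r , e    = r , e
      ... | zero  , refl = contradiction (subst (x 0 ℤ.<_) a′-top b<a′) (ℤₚ.<-irrefl refl)

  remove-first : ∀ M {x a} → Enumerates x (Below a) → Aligned a →
    ∃[ a′ ] Enumerates (λ r → x (M ℕ.+ r)) (Below a′) × Aligned a′ × sumℤ a ≡ sumℤ a′ ℤ.+ + M ℤ.* + t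
  remove-first zero    {x} {a} enum a≅ = a , enum , a≅ , lemma (sumℤ a) (+ t)
    where
    lemma : ∀ s t → s ≡ s ℤ.+ 0ℤ ℤ.* t
    lemma = solve-∀
  remove-first (suc M) {x} {a} enum a≅ =
    let a′ , enum′ , a′≅ , e  = remove-max enum a≅
        a″ , enum″ , a″≅ , e′ = remove-first M enum′ a′≅
    in a″ , enum″ , a″≅ , trans e (trans (cong (ℤ._+ + t) e′) (lemma (sumℤ a″) (+ M) (+ t)))
    where
    lemma : ∀ s m t → s ℤ.+ m ℤ.* t ℤ.+ t ≡ s ℤ.+ (1ℤ ℤ.+ m) ℤ.* t
    lemma = solve-∀

  -- The set consists of all integers below u = -t L. As u is a multiple of t, the least number of
  -- class i not below u is u + i.
  initial-segment : ∀ {x a} L → Enumerates x (Below a) → Aligned a →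
    (∀ r → x r ≡ ℤ.- (+ t ℤ.* L) ℤ.- + suc r) → ∀ i → a i ≡ ℤ.- (+ t ℤ.* L) ℤ.+ idx i
  initial-segment {x} {a} L enum a≅ x≡ i = ℤₚ.≤-antisym a≤e e≤a
    where
    open Enumerates enum
    u = ℤ.- (+ t ℤ.* L)
    e = u ℤ.+ idx i
    e≅i : e ≅ idx i [ t ]
    e≅i = mod (divides (ℤ.- L) (lemma (+ t) L (idx i)))
      where
      lemma : ∀ t L i → ℤ.- (t ℤ.* L) ℤ.+ i ℤ.- i ≡ (ℤ.- L) ℤ.* t
      lemma = solve-∀
    a⟦e⟧ : a ⟦ e ⟧ ≡ a i
    a⟦e⟧ = trans (⟦⟧-cong a e≅i) (⟦idx⟧ a i)
    a≤e : a i ℤ.≤ e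
    a≤e = ℤₚ.≮⇒≥ λ e<a →
      let r , e≡ = complete e (subst (e ℤ.<_) (sym a⟦e⟧) e<a)
      in ℤₚ.<⇒≢ (<-by-≤ (ℤ.+≤+ (z≤n {toℕ i ℕ.+ r})) (lemma u (idx i) (+ r))) (sym (trans e≡ (x≡ r)))
      where
      lemma : ∀ u i r → (i ℤ.+ r) ℤ.- 0ℤ ℤ.+ 1ℤ ≡ (u ℤ.+ i) ℤ.- (u ℤ.- (1ℤ ℤ.+ r))
      lemma = solve-∀
    r₀ : ℕ
    -- The element e - t = u - (t - i) has index t - i - 1, the listing starting at u - 1.
    r₀ = t ℕ.∸ suc (toℕ i)
    e-t≡ : x r₀ ≡ e ℤ.- + t
    e-t≡ = trans (x≡ r₀) (trans (lemma u (+ r₀) (idx i)) (cong (λ y → u ℤ.+ idx i ℤ.- + y) (ℕₚ.m+[n∸m]≡n (Finₚ.toℕ<n i))))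
      where
      lemma : ∀ u r i → u ℤ.- (1ℤ ℤ.+ r) ≡ u ℤ.+ i ℤ.- ((1ℤ ℤ.+ i) ℤ.+ r)
      lemma = solve-∀
    e-t≅e : e ℤ.- + t ≅ e [ t ]
    e-t≅e = minus-modulus e
    e≤a : e ℤ.≤ a i
    e≤a = subst (ℤ._≤ a i) (lemma e (+ t)) (<⇒+t≤ e-t<a (mod-trans e-t≅e (mod-trans e≅i (mod-sym (a≅ i)))))
      where
      lemma : ∀ x t → x ℤ.- t ℤ.+ t ≡ x
      lemma = solve-∀
      e-t<a : e ℤ.- + t ℤ.< a i
      e-t<a = subst (e ℤ.- + t ℤ.<_) (trans (⟦⟧-cong a e-t≅e) a⟦e⟧) (subst (Below a) e-t≡ (sound r₀))

  -- Removing M = c + t L elements leaves the integers below -t L, whose coordinates sum to C(t,2) -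
  -- t²L. Restoring the removed M t gives C(t,2) + t c, and L drops out.
  charge : ∀ {x a} N c → Enumerates x (Below a) → Aligned a →
    (∀ r → N ℕ.≤ r → x r ≡ c ℤ.- + suc r) → sumℤ a ≡ + (t C 2) ℤ.+ + t ℤ.* c
  charge {x} {a} N c enum a≅ x≡ =
    let a′ , enum′ , a′≅ , Σ≡ = remove-first M enum a≅
    in trans Σ≡ (trans (cong (ℤ._+ + M ℤ.* + t) (trans
         (sumℤ-cong {t} (initial-segment L enum′ a′≅ tail≡)) (sumℤ-range t (ℤ.- (+ t ℤ.* L)))))
       (trans (cong (λ m → + t ℤ.* ℤ.- (+ t ℤ.* L) ℤ.+ + (t C 2) ℤ.+ m ℤ.* + t) M≡) (lemma (+ t) L (+ (t C 2)) c)))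
    where
    lemma : ∀ t L b c → t ℤ.* ℤ.- (t ℤ.* L) ℤ.+ b ℤ.+ (c ℤ.+ t ℤ.* L) ℤ.* t ≡ b ℤ.+ t ℤ.* c
    lemma = solve-∀
    ℓ : ℕ
    -- Large enough for M = c + t ℓ ≥ c + ∣c∣ + N ≥ N, so the removals reach the regular part of the
    -- list.
    ℓ = N ℕ.+ ℤ.∣ c ∣
    L : ℤ
    L = + ℓ
    M : ℕ
    M = ℤ.∣ c ℤ.+ + t ℤ.* L ∣
    0≤c+∣c∣ : 0ℤ ℤ.≤ c ℤ.+ + ℤ.∣ c ∣
    0≤c+∣c∣ = nonneg c
      where
      nonneg : ∀ c → 0ℤ ℤ.≤ c ℤ.+ + ℤ.∣ c ∣
      nonneg (+ n)    = ℤ.+≤+ z≤n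
      nonneg -[1+ n ] = ℤₚ.≤-reflexive (sym (ℤₚ.+-inverseˡ (+ suc n)))
    N≤ : + N ℤ.≤ c ℤ.+ + t ℤ.* L
    N≤ = ≤-by (ℤₚ.+-mono-≤ 0≤c+∣c∣ (ℤ.+≤+ (ℕₚ.m≤n*m ℓ t)))
      (trans (lemma′ c (+ ℤ.∣ c ∣) (+ N) (+ (t ℕ.* ℓ))) (cong (λ m → c ℤ.+ m ℤ.- + N) (ℤₚ.pos-* t ℓ)))
      where
      lemma′ : ∀ c d N m → (c ℤ.+ d ℤ.+ m) ℤ.- (0ℤ ℤ.+ (N ℤ.+ d)) ≡ c ℤ.+ m ℤ.- N
      lemma′ = solve-∀
    M≡ : + M ≡ c ℤ.+ + t ℤ.* L
    M≡ = ℤₚ.0≤i⇒+∣i∣≡i (ℤₚ.≤-trans (ℤ.+≤+ z≤n) N≤)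
    N≤M : N ℕ.≤ M
    N≤M = ℤₚ.drop‿+≤+ (subst (+ N ℤ.≤_) (sym M≡) N≤)
    tail≡ : ∀ r → x (M ℕ.+ r) ≡ ℤ.- (+ t ℤ.* L) ℤ.- + suc r
    tail≡ r = trans (x≡ (M ℕ.+ r) (ℕₚ.≤-trans N≤M (ℕₚ.m≤m+n M r)))
      (trans (cong (λ m → c ℤ.- (1ℤ ℤ.+ (m ℤ.+ + r))) M≡) (lemma′ c (+ t ℤ.* L) (+ r)))
      where
      lemma′ : ∀ c y r → c ℤ.- (1ℤ ℤ.+ ((c ℤ.+ y) ℤ.+ r)) ≡ ℤ.- y ℤ.- (1ℤ ℤ.+ r)
      lemma′ = solve-∀

-- Partitions from coordinates

beta-far : ∀ p r → support p ℕ.≤ r → betaNumber p r ≡ 0ℤ ℤ.- + suc r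
beta-far p r N≤r = cong (λ x → + x ℤ.- + suc r) (part≡0 p r N≤r)

beta-enumerates : ∀ p {B} → (∀ b → BetaSet p b → B b) → (∀ b → B b → BetaSet p b) →
  Enumerates (betaNumber p) B
beta-enumerates p ⊆B B⊆ = record
  { descending = beta-decreasing p
  ; sound      = λ r → ⊆B _ (r , refl)
  ; complete   = B⊆
  }

part-determined : ∀ p q → (∀ b → BetaSet p b → BetaSet q b) → (∀ b → BetaSet q b → BetaSet p b) → p ≈ₚ q
part-determined p q p⊆q q⊆p r = ℤₚ.+-injective (ℤ+.∙-cancelʳ (ℤ.- + suc r) (+ part p r) (+ part q r)
  (enumeration-unique (beta-enumerates p (λ _ b∈ → b∈) (λ _ b∈ → b∈)) (beta-enumerates q q⊆p p⊆q) r))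

sum-vanishing : ∀ (f : ℕ → ℕ) N → (∀ r → N ℕ.≤ r → f r ≡ 0) → ∀ n → N ℕ.≤ n →
  sumℕ {n} (λ i → f (toℕ i)) ≡ sumℕ {N} (λ i → f (toℕ i))
sum-vanishing f zero    f≡0 zero    _         = refl
sum-vanishing f zero    f≡0 (suc n) _         = cong₂ ℕ._+_ (f≡0 0 z≤n)
  (sum-vanishing (λ r → f (suc r)) zero (λ r _ → f≡0 (suc r) z≤n) n z≤n)
sum-vanishing f (suc N) f≡0 (suc n) (s≤s N≤n) = cong (λ x → f 0 ℕ.+ x)
  (sum-vanishing (λ r → f (suc r)) N (λ r N≤r → f≡0 (suc r) (s≤s N≤r)) n N≤n)

least : ∀ {P : Pred ℕ 0ℓ} → Decidable P → ∀ n → P n → ∃[ m ] P m × (∀ j → P j → m ℕ.≤ j)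
least P? zero    Pn = 0 , Pn , λ _ _ → z≤n
least P? (suc n) Pn with P? 0
... | yes P0 = 0 , P0 , λ _ _ → z≤n
... | no ¬P0 with least (λ j → P? (suc j)) n Pn
... | m , Pm , min = suc m , Pm , λ where
  zero    P0 → contradiction P0 ¬P0
  (suc j) Pj → s≤s (min j Pj)

uniform-bound : ∀ {n} (a : Vector ℤ n) → ∃[ K ] ∀ i → ℤ.∣ a i ∣ ℕ.≤ K
uniform-bound {zero}  a = 0 , λ ()
uniform-bound {suc n} a = let K , a≤K = uniform-bound {n} (λ i → a (suc i)) in
  ℤ.∣ a zero ∣ ℕ.⊔ K , λ where
    zero    → ℕₚ.m≤m⊔n ℤ.∣ a zero ∣ K
    (suc i) → ℕₚ.≤-trans (a≤K i) (ℕₚ.m≤n⊔m ℤ.∣ a zero ∣ K)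

module Abacus (t : ℕ) .{{_ : NonZero t}} (a : Vector ℤ t) (a≅ : ∀ i → a i ≅ idx i [ t ]) where

  private
    K : ℕ
    K = proj₁ (uniform-bound a)

    a≤K : ∀ b → a ⟦ b ⟧ ℤ.≤ + K
    a≤K b = ℤₚ.≤-trans (i≤∣i∣ (a ⟦ b ⟧)) (ℤ.+≤+ (proj₂ (uniform-bound a) (residue t b)))

    -K≤a : ∀ b → ℤ.- + K ℤ.≤ a ⟦ b ⟧
    -K≤a b = ℤₚ.≤-trans (ℤₚ.neg-mono-≤ (ℤ.+≤+ (proj₂ (uniform-bound a) (residue t b)))) (-∣i∣≤i (a ⟦ b ⟧))

    <-K⇒below : ∀ b → b ℤ.< ℤ.- + K → Below a b
    <-K⇒below b b< = ℤₚ.<-≤-trans b< (-K≤a b)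

  Below? : ∀ b → Dec (Below a b)
  Below? b = b ℤₚ.<? a ⟦ b ⟧

  abstract

    next : ∀ y → ∃[ b ] Below a b × b ℤ.< y × (∀ b′ → Below a b′ → b′ ℤ.< y → b′ ℤ.≤ b)
    next y = let m , below , minimal = least (λ j → Below? (at j)) j₀ far in at m , below , at< m , maximal m minimal
      where
      at : ℕ → ℤ
      at j = y ℤ.- + suc j
      at< : ∀ j → at j ℤ.< y
      at< j = <-by-≤ (ℤ.+≤+ (z≤n {j})) (lemma y (+ j))
        where
        lemma : ∀ y j → j ℤ.- 0ℤ ℤ.+ 1ℤ ≡ y ℤ.- (y ℤ.- (1ℤ ℤ.+ j))
        lemma = solve-∀
      j₀ : ℕ
      -- At this depth y - (j₀ + 1) < -K, which is below every coordinate, so the search for the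
      -- next element ends.
      j₀ = ℤ.∣ y ∣ ℕ.+ K
      far : Below a (at j₀)
      far = <-K⇒below (at j₀) (<-by-≤ (i≤∣i∣ y) (lemma y (+ ℤ.∣ y ∣) (+ K)))
        where
        lemma : ∀ y n K → n ℤ.- y ℤ.+ 1ℤ ≡ ℤ.- K ℤ.- (y ℤ.- (1ℤ ℤ.+ (n ℤ.+ K)))
        lemma = solve-∀
      maximal : ∀ m → (∀ j → Below a (at j) → m ℕ.≤ j) → ∀ b′ → Below a b′ → b′ ℤ.< y → b′ ℤ.≤ at m
      maximal m minimal b′ b′<a b′<y = ≤-by (ℤ.+≤+ (minimal j (subst (Below a) at-j b′<a)))
        (trans (lemma′ y (+ m) (+ j)) (cong (λ x → at m ℤ.- x) (sym at-j)))
        where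
        lemma : ∀ y b → b ≡ y ℤ.- (1ℤ ℤ.+ (y ℤ.- b ℤ.- 1ℤ))
        lemma = solve-∀
        lemma′ : ∀ y m j → j ℤ.- m ≡ (y ℤ.- (1ℤ ℤ.+ m)) ℤ.- (y ℤ.- (1ℤ ℤ.+ j))
        lemma′ = solve-∀
        lemma″ : ∀ y b → y ℤ.- b ≡ (y ℤ.- b ℤ.- 1ℤ) ℤ.- 0ℤ ℤ.+ 1ℤ
        lemma″ = solve-∀
        j : ℕ
        j = ℤ.∣ y ℤ.- b′ ℤ.- 1ℤ ∣
        at-j : b′ ≡ at j
        at-j = trans (lemma y b′) (cong (λ x → y ℤ.- (1ℤ ℤ.+ x)) (sym (ℤₚ.0≤i⇒+∣i∣≡i {y ℤ.- b′ ℤ.- 1ℤ} (≤-by-< b′<y (lemma″ y b′)))))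

  bead : ℕ → ℤ
  -- Every element is less than its coordinate and hence less than `K`, so this is the maximum of
  -- the whole set.
  bead zero    = proj₁ (next (+ K))
  bead (suc r) = proj₁ (next (bead r))

  bead-below : ∀ r → Below a (bead r)
  bead-below zero    = proj₁ (proj₂ (next (+ K)))
  bead-below (suc r) = proj₁ (proj₂ (next (bead r)))

  bead-descending : ∀ r → bead (suc r) ℤ.< bead r
  bead-descending r = proj₁ (proj₂ (proj₂ (next (bead r))))

  bead-next : ∀ r b → Below a b → b ℤ.< bead r → b ℤ.≤ bead (suc r)
  bead-next r = proj₂ (proj₂ (proj₂ (next (bead r))))

  bead-complete : ∀ b → Below a b → ∃[ r ] b ≡ bead r
  -- The first argument of `search` bounds the distance from b to the current bead, which shrinks by
  -- at least one at each step.
  bead-complete b b<a = search ℤ.∣ bead 0 ℤ.- b ∣ 0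
    (proj₂ (proj₂ (proj₂ (next (+ K)))) b b<a (ℤₚ.<-≤-trans b<a (a≤K b)))
    (i≤∣i∣ (bead 0 ℤ.- b))
    where
    search : ∀ n r → b ℤ.≤ bead r → bead r ℤ.- b ℤ.≤ + n → ∃[ r ] b ≡ bead r
    search n r b≤ dist with b ℤₚ.≟ bead r
    ... | yes e = r , e
    search zero r b≤ dist | no b≢ = contradiction (ℤₚ.≤-antisym b≤ (≤-by dist (lemma (bead r) b))) b≢
      where
      lemma : ∀ x b → 0ℤ ℤ.- (x ℤ.- b) ≡ b ℤ.- x
      lemma = solve-∀
    search (suc n) r b≤ dist | no b≢ = search n (suc r) (bead-next r b b<a (ℤₚ.≤∧≢⇒< b≤ b≢))
      (≤-by (ℤₚ.+-mono-≤ dist (ℤₚ.i<j⇒suc[i]≤j (bead-descending r))) (lemma (bead r) (bead (suc r)) b (+ n)))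
      where
      lemma : ∀ x x′ b n → (1ℤ ℤ.+ n ℤ.+ x) ℤ.- (x ℤ.- b ℤ.+ (1ℤ ℤ.+ x′)) ≡ n ℤ.- (x′ ℤ.- b)
      lemma = solve-∀

  bead-enumerates : Enumerates bead (Below a)
  bead-enumerates = record { descending = bead-descending ; sound = bead-below ; complete = bead-complete }

  private
    -- From here downwards every integer is below all coordinates, so the beads become consecutive.
    base : ℤ
    base = ℤ.- + K ℤ.- 1ℤ

    base-hit : ∃[ N ] base ≡ bead N
    base-hit = bead-complete base (<-K⇒below base (<-by-≤ (ℤₚ.≤-refl {0ℤ}) (lemma (+ K))))
      where
      lemma : ∀ K → 0ℤ ℤ.- 0ℤ ℤ.+ 1ℤ ≡ ℤ.- K ℤ.- (ℤ.- K ℤ.- 1ℤ)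
      lemma = solve-∀

    N : ℕ
    N = proj₁ base-hit

    consecutive : ∀ j → bead (N ℕ.+ j) ≡ base ℤ.- + j
    consecutive zero    = trans (cong bead (ℕₚ.+-identityʳ N)) (trans (sym (proj₂ base-hit)) (sym (ℤₚ.+-identityʳ base)))
    consecutive (suc j) = trans (cong bead (ℕₚ.+-suc N j)) (ℤₚ.≤-antisym
      (≤-by-< (subst (bead (suc (N ℕ.+ j)) ℤ.<_) (consecutive j) (bead-descending (N ℕ.+ j))) (lemma base (+ j) (bead (suc (N ℕ.+ j)))))
      (bead-next (N ℕ.+ j) (base ℤ.- + suc j) (<-K⇒below _ (<-by-≤ (ℤ.+≤+ (z≤n {suc j})) (lemma′ (+ K) (+ suc j))))
        (subst (base ℤ.- + suc j ℤ.<_) (sym (consecutive j)) (<-by-≤ (ℤₚ.≤-refl {0ℤ}) (lemma″ base (+ j))))))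
      where
      lemma : ∀ u j x → (u ℤ.- j) ℤ.- x ≡ (u ℤ.- (1ℤ ℤ.+ j)) ℤ.- x ℤ.+ 1ℤ
      lemma = solve-∀
      lemma′ : ∀ K j → j ℤ.- 0ℤ ℤ.+ 1ℤ ≡ ℤ.- K ℤ.- (ℤ.- K ℤ.- 1ℤ ℤ.- j)
      lemma′ = solve-∀
      lemma″ : ∀ u j → 0ℤ ℤ.- 0ℤ ℤ.+ 1ℤ ≡ (u ℤ.- j) ℤ.- (u ℤ.- (1ℤ ℤ.+ j))
      lemma″ = solve-∀

    -- The offset for which bead N = `base` takes the form c - (N + 1).
    c : ℤ
    c = base ℤ.+ + suc N

    eventually : ∀ r → N ℕ.≤ r → bead r ≡ c ℤ.- + suc r
    eventually r N≤r = trans (cong bead (sym (ℕₚ.m+[n∸m]≡n N≤r))) (trans (consecutive (r ℕ.∸ N))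
      (trans (lemma base (+ N) (+ (r ℕ.∸ N))) (cong (λ x → c ℤ.- (1ℤ ℤ.+ + x)) (ℕₚ.m+[n∸m]≡n N≤r))))
      where
      lemma : ∀ u N j → u ℤ.- j ≡ u ℤ.+ (1ℤ ℤ.+ N) ℤ.- (1ℤ ℤ.+ (N ℤ.+ j))
      lemma = solve-∀

  module _ (Σa≡C : sumℤ a ≡ + (t C 2)) where

    private
      c≡0 : c ≡ 0ℤ
      c≡0 = ℤₚ.*-cancelˡ-≡ (+ t) c 0ℤ (trans (ℤ+.∙-cancelˡ (+ (t C 2)) (+ t ℤ.* c) 0ℤ
        (trans (sym (Charge.charge t N c bead-enumerates a≅ eventually)) (trans Σa≡C (sym (ℤₚ.+-identityʳ (+ (t C 2)))))))
        (sym (ℤₚ.*-zeroʳ (+ t))))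

      height : ℕ → ℤ
      height r = bead r ℤ.+ + suc r

      height-far : ∀ r → N ℕ.≤ r → height r ≡ 0ℤ
      height-far r N≤r = trans (cong (ℤ._+ + suc r) (eventually r N≤r)) (trans (lemma c (+ suc r)) c≡0)
        where
        lemma : ∀ c r → c ℤ.- r ℤ.+ r ≡ c
        lemma = solve-∀

      height-decreasing : ∀ r → height (suc r) ℤ.≤ height r
      height-decreasing r = ≤-by-< (bead-descending r) (lemma (bead r) (bead (suc r)) (+ r))
        where
        lemma : ∀ x x′ r → x ℤ.- x′ ≡ (x ℤ.+ (1ℤ ℤ.+ r)) ℤ.- (x′ ℤ.+ (1ℤ ℤ.+ (1ℤ ℤ.+ r))) ℤ.+ 1ℤ
        lemma = solve-∀

      -- The heights decrease weakly and are eventually 0.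
      height-nonneg : ∀ r → 0ℤ ℤ.≤ height r
      height-nonneg r = subst (ℤ._≤ height r) (height-far (r ℕ.+ N) (ℕₚ.m≤n+m N r)) (later N)
        where
        later : ∀ n → height (r ℕ.+ n) ℤ.≤ height r
        later zero    = ℤₚ.≤-reflexive (cong height (ℕₚ.+-identityʳ r))
        later (suc n) = ℤₚ.≤-trans (ℤₚ.≤-reflexive (cong height (ℕₚ.+-suc r n))) (ℤₚ.≤-trans (height-decreasing (r ℕ.+ n)) (later n))

      +∣height∣ : ∀ r → + ℤ.∣ height r ∣ ≡ height r
      +∣height∣ r = ℤₚ.0≤i⇒+∣i∣≡i (height-nonneg r)

    partition : Partition
    partition = record
      { part       = λ r → ℤ.∣ height r ∣
      ; decreasing = λ r → ℤₚ.drop‿+≤+ (subst₂ ℤ._≤_ (sym (+∣height∣ (suc r))) (sym (+∣height∣ r)) (height-decreasing r))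
      ; finite-sum = sumℕ {N} (λ i → ℤ.∣ height (toℕ i) ∣) , N ,
          sum-vanishing (λ r → ℤ.∣ height r ∣) N (λ r N≤r → cong ℤ.∣_∣ (height-far r N≤r))
      }

    beta≡bead : ∀ r → betaNumber partition r ≡ bead r
    beta≡bead r = trans (cong (ℤ._- + suc r) (+∣height∣ r)) (lemma (bead r) (+ suc r))
      where
      lemma : ∀ x r → x ℤ.+ r ℤ.- r ≡ x
      lemma = solve-∀

    beta⇒below-a : ∀ b → BetaSet partition b → Below a b
    beta⇒below-a b (r , e) = subst (Below a) (sym (trans e (beta≡bead r))) (bead-below r)

    below-a⇒beta : ∀ b → Below a b → BetaSet partition b
    below-a⇒beta b b<a = let r , e = bead-complete b b<a in r , trans e (sym (beta≡bead r))

    partition-core : Core t partition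
    partition-core = closed⇒core t partition λ b b∈ → below-a⇒beta _ (below-closed a b (beta⇒below-a b b∈))

    point-partition : ∀ i → point t partition i ≡ a i
    point-partition i = trans (point≡ t partition i) (aCoord-unique t partition (idx i) (a i) (a≅ i)
      (below-a⇒beta _ (subst (a i ℤ.- + t ℤ.<_) (sym (entry shifted)) (<-by (ℤ.+<+ (ℕ.>-nonZero⁻¹ t)) (lemma (a i) (+ t)))))
      (λ b b≅i b∈ → <⇒+t≤ (subst (b ℤ.<_) (entry b≅i) (beta⇒below-a b b∈)) (mod-trans b≅i (mod-sym (a≅ i)))))
      where
      entry : ∀ {b} → b ≅ idx i [ t ] → a ⟦ b ⟧ ≡ a i
      entry b≅i = trans (⟦⟧-cong a b≅i) (⟦idx⟧ a i)
      lemma : ∀ a t → t ℤ.- 0ℤ ≡ a ℤ.- (a ℤ.- t)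
      lemma = solve-∀
      shifted : a i ℤ.- + t ≅ idx i [ t ]
      shifted = mod-trans (minus-modulus (a i)) (a≅ i)

-- The hyperplane and the inequalities satisfied by cores

sum-point : ∀ t .{{_ : NonZero t}} p → Core t p → sumℤ (point t p) ≡ + (t C 2)
sum-point t p core = trans (Charge.charge t (support p) 0ℤ
  (beta-enumerates p (beta⇒below t p) (below⇒beta t p core)) (point-aligned t p) (beta-far p))
  (trans (cong (λ x → + (t C 2) ℤ.+ x) (ℤₚ.*-zeroʳ (+ t))) (ℤₚ.+-identityʳ (+ (t C 2))))

-- If m is the largest element of class i + s, then m - s is again in the beta-set and has class i,
-- so m - s + t is at most the coordinate of class i.
core⇒inequality : ∀ s t .{{_ : NonZero s}} .{{_ : NonZero t}} p → Core s p → ∀ i →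
  point t p ⟦ idx i ℤ.+ + s ⟧ ℤ.- + s ℤ.≤ point t p i
core⇒inequality s t p core j = subst₂ (λ x y → x ℤ.- + s ℤ.≤ y) (sym (point-⟦⟧ t p (idx j ℤ.+ + s))) (sym (point≡ t p j)) (≤-by
  (beta⇒<aCoord t p {m ℤ.- + s} {i} (mod-trans (mod-- (mod {m} {i ℤ.+ + s} (proj₂ (proj₁ max))) (mod-refl {a = + s})) (mod-reflexive (lemma i (+ s))))
    (core⇒closed s p core m (proj₁ (proj₁ max))))
  (lemma′ m (+ s) (+ t) (aCoord t p i)))
  where
  i = idx j
  m = proj₁ (maxBeta t p (i ℤ.+ + s))
  max = proj₂ (maxBeta t p (i ℤ.+ + s))
  lemma : ∀ i s → i ℤ.+ s ℤ.- s ≡ i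
  lemma = solve-∀
  lemma′ : ∀ m s t a → a ℤ.- (m ℤ.- s ℤ.+ t) ≡ a ℤ.- (t ℤ.+ m ℤ.- s)
  lemma′ = solve-∀

-- For a t-core, membership means lying below the coordinate of one's class. From b < a_{i+s}
-- follows b - s < a_{i+s} - s ≤ a_i, where i is the class of b - s.
inequality⇒core : ∀ s t .{{_ : NonZero t}} p → Core t p →
  (∀ i → point t p ⟦ idx i ℤ.+ + s ⟧ ℤ.- + s ℤ.≤ point t p i) → Core s p
inequality⇒core s t p core ineq = closed⇒core s p closed
  where
  closed : ClosedUnder s (BetaSet p)
  closed b b∈ = below⇒beta t p core (b ℤ.- + s) (ℤₚ.<-≤-trans b-s<top-s (ineq i))
    where
    i : Fin t
    i = residue t (b ℤ.- + s)
    lemma : ∀ b s → b ≡ b ℤ.- s ℤ.+ s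
    lemma = solve-∀
    lemma′ : ∀ b s a → a ℤ.- b ≡ (a ℤ.- s) ℤ.- (b ℤ.- s)
    lemma′ = solve-∀
    b≅ : b ≅ idx i ℤ.+ + s [ t ]
    b≅ = mod-trans (mod-reflexive (lemma b (+ s))) (mod-+ (mod-sym (idx-residue t (b ℤ.- + s))) (mod-refl {a = + s}))
    b<top : b ℤ.< point t p ⟦ idx i ℤ.+ + s ⟧
    b<top = subst (b ℤ.<_) (⟦⟧-cong (point t p) b≅) (beta⇒below t p b b∈)
    b-s<top-s : b ℤ.- + s ℤ.< point t p ⟦ idx i ℤ.+ + s ⟧ ℤ.- + s
    b-s<top-s = <-by b<top (lemma′ b (+ s) (point t p ⟦ idx i ℤ.+ + s ⟧))

-- Cores

≈ₚ-equivalence : IsEquivalence _≈ₚ_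
≈ₚ-equivalence = record
  { refl  = λ r → refl
  ; sym   = λ p r → sym (p r)
  ; trans = λ p q r → trans (p r) (q r)
  }

BetaSet-resp : ∀ {p q} → p ≈ₚ q → ∀ b → BetaSet p b → BetaSet q b
BetaSet-resp p≈q b (r , e) = r , trans e (cong (λ x → + x ℤ.- + suc r) (p≈q r))

module CoreCoordinates (s t : ℕ) .{{_ : NonZero t}} where

  aPoint-cong : ∀ {p q} → p ≈ₚ q → aPoint t p ≋ aPoint t q
  aPoint-cong {p} {q} p≈q i = unlim (pointwise λ _ → cong ι
    (aCoord-cong t p q (mod-refl {a = idx i}) (BetaSet-resp {p} {q} p≈q) (BetaSet-resp {q} {p} λ r → sym (p≈q r))))

  aPoint-injective : ∀ p q → Core t p → Core t q → aPoint t p ≋ aPoint t q → p ≈ₚ q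
  aPoint-injective p q p-core q-core e = part-determined p q (transfer p q q-core same) (transfer q p p-core (λ i → sym (same i)))
    where
    same : ∀ i → point t p i ≡ point t q i
    same i = trans (point≡ t p i) (trans (ι-injective (constant-injective (lim (e i)))) (sym (point≡ t q i)))
    transfer : ∀ p q → Core t q → (∀ i → point t p i ≡ point t q i) → ∀ b → BetaSet p b → BetaSet q b
    transfer p q q-core e b b∈ = below⇒beta t q q-core b (subst (b ℤ.<_) (e (residue t b)) (beta⇒below t p b b∈))

  aPoint-integer : ∀ p → aPoint t p ≋ (λ i → fromℤ (point t p i))
  aPoint-integer p i = unlim (pointwise {seq (aPoint t p i)} λ _ → cong ι (sym (point≡ t p i)))

  aPoint-hyperplane : ∀ p → Core t p → HyperplaneA s t (aPoint t p)
  aPoint-hyperplane p core = unlim {seq (sumℝ (aPoint t p))} (pointwise λ n → trans (seq-sum (aPoint t p) n)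
    (trans (Sumℚ.sum-cong-≗ {t} λ i → cong ι (sym (point≡ t p i))) (trans (sym (ι-sum (point t p))) (cong ι (sum-point t p core)))))

  aPoint-lattice : ∀ p → LatticeA s t (aPoint t p)
  aPoint-lattice p = point t p , aPoint-integer p , λ i → unmod (point-aligned t p i)

  aPoint-surjective : ∀ a → HyperplaneA s t a → LatticeA s t a → ∃[ p ] Core t p × aPoint t p ≋ a
  aPoint-surjective a pa (n , a≋n , n≡) = partition Σn≡C , partition-core Σn≡C , λ i →
    unlim (≃-trans {g = λ _ → ι (n i)} {seq (a i)} (pointwise λ _ → cong ι (trans (sym (point≡ t (partition Σn≡C) i)) (point-partition Σn≡C i))) (≃-sym {seq (a i)} (lim (a≋n i))))
    where
    open ≃-Reasoning
    open Abacus t n (λ i → mod (n≡ i))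
    -- The real hyperplane equation, read back in the integers, is the charge condition that
    -- `partition` requires.
    Σn≡C : sumℤ n ≡ + (t C 2)
    Σn≡C = ι-injective (constant-injective (
      (λ _ → ι (sumℤ n))                      ≃⟨ pointwise (λ _ → ι-sum n) ⟩
      (λ _ → sumℚ {t} (λ i → ι (n i)))        ≃⟨ ≃-sym (sum-cong {t} {λ i → seq (a i)} (λ i → lim (a≋n i))) ⟩
      (λ m → sumℚ {t} (λ i → seq (a i) m))    ≃⟨ pointwise (λ m → sym (seq-sum a m)) ⟩
      seq (sumℝ a)                            ≃⟨ lim pa ⟩
      (λ _ → ι (+ (t C 2))) ∎≃))

  bijection-cores : BijectionOn _≈ₚ_ _≋_ (aPoint t) (Core t) (HyperplaneA s t ∩ LatticeA s t)
  bijection-cores = bijectionOn ≈ₚ-equivalence ≋-equivalence {aPoint t} {Core t} {HyperplaneA s t ∩ LatticeA s t}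
    (λ {p} {q} _ _ → aPoint-cong {p} {q})
    (λ {p} core → aPoint-hyperplane p core , aPoint-lattice p)
    (λ {p} {q} → aPoint-injective p q)
    (λ {a} (pa , la) → aPoint-surjective a pa la)

  private
    lower : Vector ℤ t → Fin t → ℕ → ℚ
    lower n i _ = ι (n ⟦ idx i ℤ.+ + s ⟧) ℚ.- ι (+ s)

    lowerℝ : Vector ℝ t → Fin t → ℕ → ℚ
    lowerℝ a i m = seq (a ⟦ idx i ℤ.+ + s ⟧) m ℚ.- ι (+ s)

    lower≃ : ∀ a (n : Vector ℤ t) → a ≋ (λ i → fromℤ (n i)) → ∀ i → lowerℝ a i ≃ lower n i
    lower≃ a n a≋n i = +-cong {seq (a ⟦ idx i ℤ.+ + s ⟧)} {λ _ → ι (n ⟦ idx i ℤ.+ + s ⟧)}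
      (lim (a≋n (residue t (idx i ℤ.+ + s)))) (≃-refl {λ _ → ℚ.- ι (+ s)})

  integer-simplex : ∀ a (n : Vector ℤ t) → a ≋ (λ i → fromℤ (n i)) → HyperplaneA s t a →
    (∀ i → n ⟦ idx i ℤ.+ + s ⟧ ℤ.- + s ℤ.≤ n i) → SimplexA s t a
  integer-simplex a n a≋n pa ineq = pa , λ i →
    ≲-trans {lowerℝ a i} {lower n i} {seq (a i)} (≃⇒≲ (lower≃ a n a≋n i))
      (≲-trans {lower n i} {λ _ → ι (n i)} {seq (a i)}
        (constant-≲ (subst (ℚ._≤ ι (n i)) (ι-- (n ⟦ idx i ℤ.+ + s ⟧) (+ s)) (ι-mono (ineq i))))
        (≃⇒≲ (≃-sym {seq (a i)} {λ _ → ι (n i)} (lim (a≋n i)))))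

  -- Both sides converge to integers, so an inequality up to every positive tolerance is an
  -- inequality between these integers.
  integer-simplex⁻¹ : ∀ a (n : Vector ℤ t) → a ≋ (λ i → fromℤ (n i)) → SimplexA s t a →
    ∀ i → n ⟦ idx i ℤ.+ + s ⟧ ℤ.- + s ℤ.≤ n i
  integer-simplex⁻¹ a n a≋n (_ , ineq) i = ι-cancel-≤ (subst (ℚ._≤ ι (n i)) (sym (ι-- (n ⟦ idx i ℤ.+ + s ⟧) (+ s)))
    (constant-≲⁻¹ (≲-trans {lower n i} {lowerℝ a i} {λ _ → ι (n i)} (≃⇒≲ (≃-sym (lower≃ a n a≋n i)))
      (≲-trans {lowerℝ a i} {seq (a i)} {λ _ → ι (n i)} (ineq i) (≃⇒≲ {seq (a i)} {λ _ → ι (n i)} (lim (a≋n i)))))))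

  simplex-of-core : .{{_ : NonZero s}} → ∀ p → Core s p → Core t p → SimplexA s t (aPoint t p)
  simplex-of-core p s-core t-core = integer-simplex (aPoint t p) (point t p)
    (aPoint-integer p) (aPoint-hyperplane p t-core) (core⇒inequality s t p s-core)

  core-of-simplex : ∀ p a → Core t p → aPoint t p ≋ a → SimplexA s t a → Core s p
  core-of-simplex p a core p≋a σ = inequality⇒core s t p core (integer-simplex⁻¹ a (point t p) a≋point σ)
    where
    a≋point : a ≋ (λ i → fromℤ (point t p i))
    a≋point i = unlim (≃-trans {seq (a i)} {seq (aPoint t p i)} (≃-sym {seq (aPoint t p i)} {seq (a i)} (lim (p≋a i))) (lim (aPoint-integer p i)))

  bijection-simultaneous-cores : .{{_ : NonZero s}} → BijectionOn _≈ₚ_ _≋_ (aPoint t) (Core s ∩ Core t) (A s t)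
  bijection-simultaneous-cores = restrict ≈ₚ-equivalence ≋-equivalence
    {aPoint t} {Core t} {Core s ∩ Core t} {HyperplaneA s t ∩ LatticeA s t} {A s t}
    bijection-cores proj₂ (λ (σ , la) → proj₁ σ , la)
    (λ {p} (s-core , t-core) → simplex-of-core p s-core t-core , aPoint-lattice p)
    (λ {p} {a} t-core e (σ , _) → core-of-simplex p a t-core e σ , t-core)

proposition4p2 : (s t : ℕ) .{{_ : NonZero s}} .{{_ : NonZero t}} → Coprime s t →
    (2 * shift s t ≡ suc s * (t ∸ 1))
    × AffineOn (HyperplaneA s t) (toZ s t)
    × BijectionOn _≋_ _≋_ (toZ s t) (HyperplaneA s t) (HyperplaneZ s t)
    × BijectionOn _≋_ _≋_ (toZ s t) (SimplexA s t) (SimplexZ s t)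
    × (∀ a z → HyperplaneZ s t z → (HyperplaneA s t a × toZ s t a ≋ z) ⇔ InverseFormula s t a z)
    × BijectionOn _≈ₚ_ _≋_ (aPoint t) (Core s ∩ Core t) (A s t)
    × BijectionOn _≋_ _≋_ (toZ s t) (A s t) (TD s t)
    × BijectionOn _≈ₚ_ _≋_ (aPoint t) (Core t) (HyperplaneA s t ∩ LatticeA s t)
    × BijectionOn _≋_ _≋_ (toZ s t) (HyperplaneA s t ∩ LatticeA s t) (HyperplaneZ s t ∩ LatticeZ s t)
proposition4p2 s t cop =
    2*shift s t cop
  , affine-toZ
  , bijection-hyperplanes
  , bijection-simplices
  , inverse
  , bijection-simultaneous-cores
  , bijection-A-TD
  , bijection-cores
  , bijection-lattices
  where
  open Coordinates s t cop
  open CoreCoordinates s t
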